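{- Let $p\ge5$ be a prime with Legendre symbol $\left(\frac{ -3}{p}\right)=-1$, and let $m\ge0$, $\alpha\ge0$, $n\ge0$ be integers. Then for every $i\in\{1,2,\dots,p-1\}$, $$\overline{S}_9^{\,8m+1}\big(18p^{2\alpha+2}n+3(6i+p)p^{2\alpha+1}\big)\equiv0\pmod{16}.$$
   Context: For $|q|<1$ and a positive integer $k$, write $f_k=\prod_{j\ge1}(1-q^{kj})$. For a positive integer $r$, $\overline{S}_9^{\,r}(n)$ (number of $9$-Schur overpartitions of $n$ with $r$-tuples) is defined by $\sum_{n\ge0}\overline{S}_9^{\,r}(n)q^n=\prod_{n\ge1}\frac{(1+q^{2n-1})^r(1-q^{9(2n-1)})^r}{(1+q^{9(2n-1)})^r(1-q^{2n-1})^r}=\frac{f_2^{3r}f_9^{2r}f_{36}^r}{f_1^{2r}f_4^rf_{18}^{3r}}$. -}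

module Defs where

open import Data.Nat as ℕ using (ℕ; zero; suc; _∸_; _%_; _/_)
open import Data.Integer as ℤ using (ℤ; +_; -_; _*_; _+_; _-_)
open import Data.Integer.Divisibility using (_∣_)
open import Data.Product using (∃)
open import Data.Bool using (if_then_else_)
open import Relation.Nullary using (¬_)
open import Relation.Nullary.Decidable using (⌊_⌋)

-- Formal power series over ℤ, represented by their coefficient sequences.
PS : Set
PS = ℕ → ℤ

one : PS
one zero    = + 1
one (suc _) = + 0

sumTo : ℕ → (ℕ → ℤ) → ℤ
sumTo zero    f = f 0
sumTo (suc n) f = sumTo n f + f (suc n)

_⊛_ : PS → PS → PS
(f ⊛ g) n = sumTo n (λ i → f i * g (n ∸ i))

infixl 7 _⊛_

pow : PS → ℕ → PS
pow f zero    = one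
pow f (suc r) = f ⊛ pow f r

-- 1 + q^k  and  1 - q^k  (k ≥ 1, written k = suc k')
onePlus : ℕ → PS
onePlus k n = if ⌊ n ℕ.≟ 0 ⌋ then + 1 else (if ⌊ n ℕ.≟ k ⌋ then + 1 else + 0)

oneMinus : ℕ → PS
oneMinus k n = if ⌊ n ℕ.≟ 0 ⌋ then + 1 else (if ⌊ n ℕ.≟ k ⌋ then - + 1 else + 0)

-- 1/(1 - q^(suc k)) = Σ_j q^{j(k+1)}
invOneMinus : ℕ → PS
invOneMinus k n = if ⌊ n % suc k ℕ.≟ 0 ⌋ then + 1 else + 0

-- 1/(1 + q^(suc k)) = Σ_j (-1)^j q^{j(k+1)}
invOnePlus : ℕ → PS
invOnePlus k n = if ⌊ n % suc k ℕ.≟ 0 ⌋ then (- + 1) ℤ.^ (n / suc k) else + 0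

-- The n-th factor (n ≥ 1, with 2n-1 = 2j+1 for j = n-1):
-- (1+q^{2n-1})(1-q^{9(2n-1)}) / ((1+q^{9(2n-1)})(1-q^{2n-1}))
factor : ℕ → PS
factor j = onePlus o ⊛ oneMinus (9 ℕ.* o) ⊛ invOnePlus (9 ℕ.* o ∸ 1) ⊛ invOneMinus (o ∸ 1)
  where o = suc (2 ℕ.* j)

partialProd : ℕ → ℕ → PS
partialProd r zero    = one
partialProd r (suc N) = partialProd r N ⊛ pow (factor N) r

-- \overline{S}_9^r(n): the coefficient of q^n in the infinite product.
-- Factors with 2n'-1 > n are ≡ 1 mod q^{n+1}, so the product of the
-- first n+1 factors already determines the coefficient of q^n.
S9bar : ℕ → ℕ → ℤ
S9bar r n = partialProd r (suc n) n

LegendreMinusOne : ℤ → ℕ → Set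
LegendreMinusOne a p = ¬ ((+ p) ∣ a) × ¬ (∃ λ (x : ℤ) → (+ p) ∣ (x * x - a))
  where open import Data.Product using (_×_)

{-# OPTIONS --safe #-}

-- Write A(q) = Σ_{x≥1} q^(x²), φ(q) = 1 + 2A(q), and let S be the generating series for r = 1.
-- Since S ≡ 1 (mod 2), S⁸ ≡ 1 (mod 16), so only r = 1 matters modulo 16.  Gauss' product
-- φ(-q) = ∏ (1 - qⁿ)/(1 + qⁿ), applied at -q, q², q⁹ and q¹⁸, gives S φ(-q²) φ(-q¹⁸) = φ(q) φ(-q⁹).
-- Splitting φ(q) and φ(-q²) by exponents modulo 3 shows that, for k ≡ 1 (mod 6), the coefficient of
-- q^(3k) in S is, modulo 16, -4 times a signed count of the solutions of x² + 2y² = 3k with 3 ∤ xy,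
-- plus corrections by x² + 2y² + 9z² and x² + 2y² + 18z².
--
-- Multiplication by 1 + √-2 moves these to k itself: for k not a square only the parity of the number of
-- solutions of k = x² + 18y², x² + 6y² and x² + 3y² is left.  The same multiplication yields recursions
-- under q ↦ q³ that prove, modulo 2, s³ = t + t², X³ = O(q³) and X t⁸ = Y, where s, X and Y are the sums
-- of q^(x²) over x > 0 with 3 ∤ x, (x, 6) = 1 and x ≡ ±5 (mod 12), O is the sum over odd x and
-- t = A(q³) + A(q⁹).  Hence X t² = Y + s⁴ O(q³) modulo 2, so everything is expressed by squares and by
-- values of x² + 3y², and neither represents k when a prime p with (-3/p) = -1 divides k to an odd power.
module Submission where

open import Defs
import Data.Nat as ℕ
import Data.Nat.Properties as ℕP
import Data.Nat.DivMod as ℕD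
import Data.Nat.Divisibility as ℕDiv
import Data.Nat.Tactic.RingSolver as ℕRS
import Data.Integer as ℤ
import Data.Integer.Properties as ℤP
import Data.Integer.DivMod as ℤD
import Data.Integer.Divisibility.Signed as Div
import Data.Integer.Tactic.RingSolver as ℤRS
open import Data.Nat.Induction using (<-rec)
open import Data.Bool using (Bool; true; false; if_then_else_; _xor_; _∧_; _∨_)
open import Data.Maybe using (Maybe; just; nothing)
open import Data.Product using (_,_; _×_; proj₁; proj₂; ∃)
open import Data.Product.Properties using (≡-dec)
open import Data.Sum using (_⊎_; inj₁; inj₂; [_,_]′)
open import Data.Unit using (⊤; tt)
open import Data.List using (List; []; _∷_; _++_; map; cartesianProduct)
open import Data.List.Membership.Propositional using (_∈_)
open import Data.List.Membership.Propositional.Properties using (∈-cartesianProduct⁺)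
open import Data.List.Relation.Unary.Any using (here; there)
open import Data.List.Relation.Unary.All as All using ([]; _∷_)
open import Data.List.Relation.Unary.AllPairs using ([]; _∷_)
open import Data.List.Relation.Unary.Unique.Propositional using (Unique)
import Data.List.Relation.Unary.Unique.Propositional.Properties as UniqueP
open import Algebra using (CommutativeRing; IsCommutativeRing; RawRing)
open import Algebra.Solver.Ring.AlmostCommutativeRing
  using (AlmostCommutativeRing; fromCommutativeRing; _-Raw-AlmostCommutative⟶_)
import Algebra.Solver.Ring as RingSolver
open import Level using (0ℓ)
open import Function using (_∘_; id)
open import Relation.Binary.Definitions using (DecidableEquality)
open import Relation.Binary.PropositionalEquality
import Relation.Binary.Reasoning.Setoid as SetoidReasoning
open import Relation.Nullary using (yes; no; Dec; ¬_; contradiction)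
open import Relation.Nullary.Decidable using (True; toWitness; from-yes; _→-dec_; ¬?)
open import Relation.Unary using (Decidable)

-- The hypothesis on p does not by itself exclude k = x² + 6y² or k = x² + 18y², so these counts
-- have to be combined. Modulo 2 one has f(q²) = f(q)², so their generating series are s A(q³)² and
-- s A(q⁹)², and the sum is s t²: this is where t comes from. The operator U keeps the coefficients
-- at multiples of 3. It satisfies U t = t + s modulo 2, and a series in q³ that U fixes modulo 2
-- and whose constant term is even vanishes modulo 2. An identity between series in q³ therefore
-- follows once U changes both sides by the same amount. The cubes s³ = s(q) s(q²) and X³ = X(q)
-- X(q²) are weighted sums over values of x² + 2y², so multiplication by 1 + √-2 computes U on them.
-- The factor 1 + √-2 mixes residues modulo 4 as well as modulo 3, which is how odd x and the
-- classes ±5 modulo 12 enter. All signs and indicators have period 12, so every comparison of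
-- weights is a finite check.

module Series where
  open import Data.Nat using (ℕ; zero; suc; _≤_; _<_; z≤n; s≤s; _∸_; _%_; NonZero; _≡ᵇ_)
  open import Data.Integer using (ℤ; +_; -[1+_]; -_; _+_; _*_; _-_; 0ℤ; 1ℤ; ∣_∣; _%ℕ_)
  open import Data.Integer.Divisibility.Signed using (_∣_; divides)

  -- Power series modulo M

  infixl 6 _⊕_
  infix 8 ⊖_

  _⊕_ : PS → PS → PS
  (f ⊕ g) n = f n + g n

  ⊖_ : PS → PS
  (⊖ f) n = - f n

  const : ℤ → PS
  const c zero    = c
  const c (suc _) = 0ℤ

  tail : PS → PS
  tail f n = f (suc n)

  scale : ℤ → PS → PS
  scale c f n = c * f n

  sumTo-cong : ∀ n {F G : ℕ → ℤ} → (∀ i → i ≤ n → F i ≡ G i) → sumTo n F ≡ sumTo n G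
  sumTo-cong zero    e = e 0 z≤n
  sumTo-cong (suc n) e = cong₂ _+_ (sumTo-cong n (λ i i≤n → e i (ℕP.m≤n⇒m≤1+n i≤n))) (e (suc n) ℕP.≤-refl)

  sumTo-suc : ∀ n (F : ℕ → ℤ) → sumTo (suc n) F ≡ F 0 + sumTo n (F ∘ suc)
  sumTo-suc zero    F = refl
  sumTo-suc (suc n) F = trans (cong (_+ F (suc (suc n))) (sumTo-suc n F)) (ℤP.+-assoc (F 0) _ _)

  sumTo-+ : ∀ n (F G : ℕ → ℤ) → sumTo n (λ i → F i + G i) ≡ sumTo n F + sumTo n G
  sumTo-+ zero    F G = refl
  sumTo-+ (suc n) F G rewrite sumTo-+ n F G = lem (sumTo n F) (sumTo n G) (F (suc n)) (G (suc n))
    where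
    lem : ∀ a b c d → a + b + (c + d) ≡ a + c + (b + d)
    lem = ℤRS.solve-∀

  sumTo-scale : ∀ n c (F : ℕ → ℤ) → sumTo n (λ i → c * F i) ≡ c * sumTo n F
  sumTo-scale zero    c F = refl
  sumTo-scale (suc n) c F rewrite sumTo-scale n c F = sym (ℤP.*-distribˡ-+ c _ _)

  sumTo-zero : ∀ n {F : ℕ → ℤ} → (∀ i → i ≤ n → F i ≡ 0ℤ) → sumTo n F ≡ 0ℤ
  sumTo-zero zero    z = z 0 z≤n
  sumTo-zero (suc n) z = cong₂ _+_ (sumTo-zero n (λ i i≤n → z i (ℕP.m≤n⇒m≤1+n i≤n))) (z (suc n) ℕP.≤-refl)

  sumTo-∣ : ∀ {M} n {F : ℕ → ℤ} → (∀ i → i ≤ n → M ∣ F i) → M ∣ sumTo n F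
  sumTo-∣ zero    d = d 0 z≤n
  sumTo-∣ (suc n) d = Div.∣m∣n⇒∣m+n (sumTo-∣ n (λ i i≤n → d i (ℕP.m≤n⇒m≤1+n i≤n))) (d (suc n) ℕP.≤-refl)

  ⊛-suc : ∀ f g n → (f ⊛ g) (suc n) ≡ f 0 * g (suc n) + (tail f ⊛ g) n
  ⊛-suc f g n = sumTo-suc n _

  ⊛-sucʳ : ∀ f g n → (f ⊛ g) (suc n) ≡ (f ⊛ tail g) n + f (suc n) * g 0
  ⊛-sucʳ f g n = cong₂ _+_
    (sumTo-cong n (λ i i≤n → cong (λ k → f i * g k) (ℕP.+-∸-assoc 1 i≤n)))
    (cong (λ k → f (suc n) * g k) (ℕP.n∸n≡0 n))

  ⊛-comm : ∀ f g n → (f ⊛ g) n ≡ (g ⊛ f) n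
  ⊛-comm f g zero    = ℤP.*-comm (f 0) (g 0)
  ⊛-comm f g (suc n) = begin
    (f ⊛ g) (suc n)                        ≡⟨ ⊛-suc f g n ⟩
    f 0 * g (suc n) + (tail f ⊛ g) n       ≡⟨ cong₂ _+_ (ℤP.*-comm (f 0) _) (⊛-comm (tail f) g n) ⟩
    g (suc n) * f 0 + (g ⊛ tail f) n       ≡⟨ ℤP.+-comm (g (suc n) * f 0) _ ⟩
    (g ⊛ tail f) n + g (suc n) * f 0       ≡⟨ ⊛-sucʳ g f n ⟨
    (g ⊛ f) (suc n)                        ∎
    where open ≡-Reasoning

  ⊛-congˡ : ∀ f {g g′ : PS} n → (∀ i → i ≤ n → g i ≡ g′ i) → (f ⊛ g) n ≡ (f ⊛ g′) n
  ⊛-congˡ f n e = sumTo-cong n (λ i i≤n → cong (f i *_) (e (n ∸ i) (ℕP.m∸n≤m n i)))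

  ⊛-congʳ : ∀ {f f′ : PS} g n → (∀ i → i ≤ n → f i ≡ f′ i) → (f ⊛ g) n ≡ (f′ ⊛ g) n
  ⊛-congʳ g n e = sumTo-cong n (λ i i≤n → cong (_* g (n ∸ i)) (e i i≤n))

  ⊛-distribʳ : ∀ f g h n → ((f ⊕ g) ⊛ h) n ≡ (f ⊛ h ⊕ g ⊛ h) n
  ⊛-distribʳ f g h n = trans
    (sumTo-cong n (λ i _ → ℤP.*-distribʳ-+ (h (n ∸ i)) (f i) (g i)))
    (sumTo-+ n _ _)

  ⊛-scaleʳ : ∀ c f g n → (scale c f ⊛ g) n ≡ c * (f ⊛ g) n
  ⊛-scaleʳ c f g n = trans
    (sumTo-cong n (λ i _ → ℤP.*-assoc c (f i) (g (n ∸ i))))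
    (sumTo-scale n c _)

  ⊛-assoc : ∀ f g h n → ((f ⊛ g) ⊛ h) n ≡ (f ⊛ (g ⊛ h)) n
  ⊛-assoc f g h zero    = ℤP.*-assoc (f 0) (g 0) (h 0)
  ⊛-assoc f g h (suc n) = begin
    ((f ⊛ g) ⊛ h) (suc n)
      ≡⟨ ⊛-suc (f ⊛ g) h n ⟩
    f 0 * g 0 * h (suc n) + (tail (f ⊛ g) ⊛ h) n
      ≡⟨ cong (_+_ (f 0 * g 0 * h (suc n))) (trans (⊛-congʳ h n (λ i _ → ⊛-suc f g i))
          (⊛-distribʳ (scale (f 0) (tail g)) (tail f ⊛ g) h n)) ⟩
    f 0 * g 0 * h (suc n) + ((scale (f 0) (tail g) ⊛ h) n + ((tail f ⊛ g) ⊛ h) n)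
      ≡⟨ cong (_+_ (f 0 * g 0 * h (suc n))) (cong₂ _+_ (⊛-scaleʳ (f 0) (tail g) h n) (⊛-assoc (tail f) g h n)) ⟩
    f 0 * g 0 * h (suc n) + (f 0 * (tail g ⊛ h) n + (tail f ⊛ (g ⊛ h)) n)
      ≡⟨ lem (f 0) (g 0) (h (suc n)) _ _ ⟩
    f 0 * (g 0 * h (suc n) + (tail g ⊛ h) n) + (tail f ⊛ (g ⊛ h)) n
      ≡⟨ cong (λ z → f 0 * z + (tail f ⊛ (g ⊛ h)) n) (⊛-suc g h n) ⟨
    f 0 * (g ⊛ h) (suc n) + (tail f ⊛ (g ⊛ h)) n
      ≡⟨ ⊛-suc f (g ⊛ h) n ⟨
    (f ⊛ (g ⊛ h)) (suc n) ∎
    where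
    open ≡-Reasoning
    lem : ∀ a b c d e → a * b * c + (a * d + e) ≡ a * (b * c + d) + e
    lem = ℤRS.solve-∀

  const-⊛ : ∀ c f n → (const c ⊛ f) n ≡ c * f n
  const-⊛ c f zero    = refl
  const-⊛ c f (suc n) = begin
    (const c ⊛ f) (suc n)                       ≡⟨ ⊛-suc (const c) f n ⟩
    c * f (suc n) + (tail (const c) ⊛ f) n      ≡⟨ cong (_+_ (c * f (suc n))) (zeroˡ n) ⟩
    c * f (suc n) + 0ℤ                          ≡⟨ ℤP.+-identityʳ _ ⟩
    c * f (suc n)                               ∎
    where
    open ≡-Reasoning
    zeroˡ : ∀ m → (tail (const c) ⊛ f) m ≡ 0ℤ
    zeroˡ zero    = refl
    zeroˡ (suc m) = trans (⊛-suc (tail (const c)) f m) (trans (ℤP.+-identityˡ _) (zeroˡ m))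

  one≗const : ∀ n → one n ≡ const 1ℤ n
  one≗const zero    = refl
  one≗const (suc n) = refl

  ⊛-identityˡ : ∀ f n → (one ⊛ f) n ≡ f n
  ⊛-identityˡ f n = trans (⊛-congʳ f n (λ i _ → one≗const i)) (trans (const-⊛ 1ℤ f n) (ℤP.*-identityˡ (f n)))

  const-+ : ∀ a b n → const (a + b) n ≡ const a n + const b n
  const-+ a b zero    = refl
  const-+ a b (suc n) = refl

  const-neg : ∀ a n → const (- a) n ≡ - const a n
  const-neg a zero    = refl
  const-neg a (suc n) = refl

  const-0 : ∀ n → const 0ℤ n ≡ 0ℤ
  const-0 zero    = refl
  const-0 (suc n) = refl

  const-* : ∀ a b n → const (a * b) n ≡ (const a ⊛ const b) n
  const-* a b n = sym (trans (const-⊛ a (const b) n) (lem n))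
    where
    lem : ∀ n → a * const b n ≡ const (a * b) n
    lem zero    = refl
    lem (suc n) = ℤP.*-zeroʳ a

  module Mod (M : ℤ) (P : ℕ → Set) (down : ∀ {m n} → m ≤ n → P n → P m) where

    infix 4 _≋_

    record _≋_ (f g : PS) : Set where
      constructor mk
      field at : ∀ n → P n → M ∣ f n - g n
    open _≋_ public

    ≡⇒∣ : ∀ {a b} → a ≡ b → M ∣ a - b
    ≡⇒∣ {a} refl = divides 0ℤ (ℤP.+-inverseʳ a)

    ≗⇒≋ : ∀ {f g : PS} → (∀ n → f n ≡ g n) → f ≋ g
    ≗⇒≋ e = mk λ n _ → ≡⇒∣ (e n)

    ≋-refl : ∀ {f} → f ≋ f
    ≋-refl = ≗⇒≋ λ _ → refl

    ≡⇒≋ : ∀ {f g} → f ≡ g → f ≋ g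
    ≡⇒≋ refl = ≋-refl

    ≋-sym : ∀ {f g} → f ≋ g → g ≋ f
    ≋-sym {f} {g} e = mk λ n p → subst (M ∣_) (lem (f n) (g n)) (Div.∣m⇒∣-m (at e n p))
      where
      lem : ∀ a b → - (a - b) ≡ b - a
      lem = ℤRS.solve-∀

    ≋-trans : ∀ {f g h} → f ≋ g → g ≋ h → f ≋ h
    ≋-trans {f} {g} {h} e e′ = mk λ n p → subst (M ∣_) (lem (f n) (g n) (h n)) (Div.∣m∣n⇒∣m+n (at e n p) (at e′ n p))
      where
      lem : ∀ a b c → a - b + (b - c) ≡ a - c
      lem = ℤRS.solve-∀

    ⊕-cong : ∀ {f f′ g g′} → f ≋ f′ → g ≋ g′ → f ⊕ g ≋ f′ ⊕ g′
    ⊕-cong {f} {f′} {g} {g′} e e′ = mk λ n p → subst (M ∣_) (lem (f n) (f′ n) (g n) (g′ n))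
        (Div.∣m∣n⇒∣m+n (at e n p) (at e′ n p))
      where
      lem : ∀ a b c d → a - b + (c - d) ≡ a + c - (b + d)
      lem = ℤRS.solve-∀

    ⊖-cong : ∀ {f f′} → f ≋ f′ → ⊖ f ≋ ⊖ f′
    ⊖-cong {f} {f′} e = mk λ n p → subst (M ∣_) (lem (f n) (f′ n)) (Div.∣m⇒∣-m (at e n p))
      where
      lem : ∀ a b → - (a - b) ≡ - a - (- b)
      lem = ℤRS.solve-∀

    ⊛-cong : ∀ {f f′ g g′} → f ≋ f′ → g ≋ g′ → f ⊛ g ≋ f′ ⊛ g′
    ⊛-cong {f} {f′} {g} {g′} e e′ = mk λ n p → subst (M ∣_) (eq n)
      (sumTo-∣ n {λ i → (f i - f′ i) * g (n ∸ i) + f′ i * (g (n ∸ i) - g′ (n ∸ i))} λ i i≤n → Div.∣m∣n⇒∣m+n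
        (Div.∣m⇒∣m*n (g (n ∸ i)) (at e i (down i≤n p)))
        (Div.∣n⇒∣m*n (f′ i) (at e′ (n ∸ i) (down (ℕP.m∸n≤m n i) p))))
      where
      open ≡-Reasoning
      lem : ∀ a b c d → (a - b) * c + b * (c - d) ≡ a * c + - 1ℤ * (b * d)
      lem = ℤRS.solve-∀
      lem′ : ∀ a b → a + - 1ℤ * b ≡ a - b
      lem′ = ℤRS.solve-∀
      eq : ∀ n → sumTo n (λ i → (f i - f′ i) * g (n ∸ i) + f′ i * (g (n ∸ i) - g′ (n ∸ i))) ≡ (f ⊛ g) n - (f′ ⊛ g′) n
      eq n = begin
        _ ≡⟨ sumTo-cong n (λ i _ → lem (f i) (f′ i) (g (n ∸ i)) (g′ (n ∸ i))) ⟩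
        sumTo n (λ i → f i * g (n ∸ i) + - 1ℤ * (f′ i * g′ (n ∸ i))) ≡⟨ sumTo-+ n (λ i → f i * g (n ∸ i))
            (λ i → - 1ℤ * (f′ i * g′ (n ∸ i))) ⟩
        (f ⊛ g) n + sumTo n (λ i → - 1ℤ * (f′ i * g′ (n ∸ i))) ≡⟨ cong (_+_ ((f ⊛ g) n))
            (sumTo-scale n (- 1ℤ) (λ i → f′ i * g′ (n ∸ i))) ⟩
        (f ⊛ g) n + - 1ℤ * (f′ ⊛ g′) n ≡⟨ lem′ ((f ⊛ g) n) ((f′ ⊛ g′) n) ⟩
        (f ⊛ g) n - (f′ ⊛ g′) n ∎

    isCommutativeRing : IsCommutativeRing _≋_ _⊕_ _⊛_ ⊖_ (const 0ℤ) one
    isCommutativeRing = record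
      { isRing = record
        { +-isAbelianGroup = record
          { isGroup = record
            { isMonoid = record
              { isSemigroup = record
                { isMagma = record
                  { isEquivalence = record { refl = ≋-refl ; sym = ≋-sym ; trans = ≋-trans }
                  ; ∙-cong = ⊕-cong }
                ; assoc = λ f g h → ≗⇒≋ λ n → ℤP.+-assoc (f n) (g n) (h n) }
              ; identity = (λ f → ≗⇒≋ λ n → trans (cong (_+ f n) (const-0 n)) (ℤP.+-identityˡ (f n)))
                         , (λ f → ≗⇒≋ λ n → trans (cong (_+_ (f n)) (const-0 n)) (ℤP.+-identityʳ (f n))) }
            ; inverse = (λ f → ≗⇒≋ λ n → trans (ℤP.+-inverseˡ (f n)) (sym (const-0 n)))
                      , (λ f → ≗⇒≋ λ n → trans (ℤP.+-inverseʳ (f n)) (sym (const-0 n)))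
            ; ⁻¹-cong = ⊖-cong }
          ; comm = λ f g → ≗⇒≋ λ n → ℤP.+-comm (f n) (g n) }
        ; *-cong = ⊛-cong
        ; *-assoc = λ f g h → ≗⇒≋ (⊛-assoc f g h)
        ; *-identity = (λ f → ≗⇒≋ (⊛-identityˡ f))
                     , (λ f → ≗⇒≋ λ n → trans (⊛-comm f one n) (⊛-identityˡ f n))
        ; distrib = (λ f g h → ≗⇒≋ λ n → trans (⊛-comm f (g ⊕ h) n)
            (trans (⊛-distribʳ g h f n) (cong₂ _+_ (⊛-comm g f n) (⊛-comm h f n))))
                  , (λ f g h → ≗⇒≋ (⊛-distribʳ g h f)) }
      ; *-comm = λ f g → ≗⇒≋ (⊛-comm f g) }

    commutativeRing : CommutativeRing 0ℓ 0ℓ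
    commutativeRing = record { isCommutativeRing = isCommutativeRing }

    almostRing : AlmostCommutativeRing 0ℓ 0ℓ
    almostRing = fromCommutativeRing commutativeRing

    ℤ-morphism : CommutativeRing.rawRing ℤP.+-*-commutativeRing -Raw-AlmostCommutative⟶ almostRing
    ℤ-morphism = record
      { ⟦_⟧    = const
      ; +-homo = λ a b → ≗⇒≋ (const-+ a b)
      ; *-homo = λ a b → ≗⇒≋ (const-* a b)
      ; -‿homo = λ a → ≗⇒≋ (const-neg a)
      ; 0-homo = ≋-refl
      ; 1-homo = ≗⇒≋ (λ n → sym (one≗const n))
      }

    private
      ℤ≟ : ∀ a b → Maybe (const a ≋ const b)
      ℤ≟ a b with a ℤ.≟ b
      ... | yes refl = just ≋-refl
      ... | no _     = nothing

    module Solver = RingSolver (CommutativeRing.rawRing ℤP.+-*-commutativeRing) almostRing ℤ-morphism ℤ≟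

    module R = CommutativeRing commutativeRing

  -- Finite sums and theta series

  sumL : ∀ {A : Set} → List A → (A → ℤ) → ℤ
  sumL []       f = 0ℤ
  sumL (x ∷ xs) f = f x + sumL xs f

  sumL-cong : ∀ {A : Set} (xs : List A) {f g : A → ℤ} → (∀ x → x ∈ xs → f x ≡ g x) → sumL xs f ≡ sumL xs g
  sumL-cong []       e = refl
  sumL-cong (x ∷ xs) e = cong₂ _+_ (e x (here refl)) (sumL-cong xs (λ y y∈ → e y (there y∈)))

  sumL-zero : ∀ {A : Set} (xs : List A) {f : A → ℤ} → (∀ x → x ∈ xs → f x ≡ 0ℤ) → sumL xs f ≡ 0ℤ
  sumL-zero []       e = refl
  sumL-zero (x ∷ xs) e = cong₂ _+_ (e x (here refl)) (sumL-zero xs (λ y y∈ → e y (there y∈)))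

  sumL-+ : ∀ {A : Set} (xs : List A) (f g : A → ℤ) → sumL xs (λ x → f x + g x) ≡ sumL xs f + sumL xs g
  sumL-+ []       f g = refl
  sumL-+ (x ∷ xs) f g rewrite sumL-+ xs f g = lem (f x) (g x) (sumL xs f) (sumL xs g)
    where
    lem : ∀ a b c d → a + b + (c + d) ≡ a + c + (b + d)
    lem = ℤRS.solve-∀

  sumL-scale : ∀ {A : Set} (xs : List A) c (f : A → ℤ) → sumL xs (λ x → c * f x) ≡ c * sumL xs f
  sumL-scale []       c f = sym (ℤP.*-zeroʳ c)
  sumL-scale (x ∷ xs) c f rewrite sumL-scale xs c f = sym (ℤP.*-distribˡ-+ c _ _)

  sumL-∣ : ∀ {A : Set} {M} (xs : List A) {f : A → ℤ} → (∀ x → x ∈ xs → M ∣ f x) → M ∣ sumL xs f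
  sumL-∣ []       d = divides 0ℤ refl
  sumL-∣ (x ∷ xs) d = Div.∣m∣n⇒∣m+n (d x (here refl)) (sumL-∣ xs (λ y y∈ → d y (there y∈)))

  sumL-swap : ∀ {A B : Set} (xs : List A) (ys : List B) (f : A → B → ℤ) →
    sumL xs (λ x → sumL ys (f x)) ≡ sumL ys (λ y → sumL xs (λ x → f x y))
  sumL-swap []       ys f = sym (sumL-zero ys (λ _ _ → refl))
  sumL-swap (x ∷ xs) ys f rewrite sumL-swap xs ys f = sym (sumL-+ ys (f x) _)

  sumL-++ : ∀ {A : Set} (xs ys : List A) (f : A → ℤ) → sumL (xs ++ ys) f ≡ sumL xs f + sumL ys f
  sumL-++ []       ys f = sym (ℤP.+-identityˡ _)
  sumL-++ (x ∷ xs) ys f rewrite sumL-++ xs ys f = sym (ℤP.+-assoc (f x) _ _)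

  sumL-map : ∀ {A B : Set} (h : A → B) (xs : List A) (f : B → ℤ) → sumL (map h xs) f ≡ sumL xs (f ∘ h)
  sumL-map h []       f = refl
  sumL-map h (x ∷ xs) f = cong (_+_ (f (h x))) (sumL-map h xs f)

  sumL-product : ∀ {A B : Set} (xs : List A) (ys : List B) (f : A × B → ℤ) →
    sumL (cartesianProduct xs ys) f ≡ sumL xs (λ x → sumL ys (λ y → f (x , y)))
  sumL-product []       ys f = refl
  sumL-product (x ∷ xs) ys f = trans (sumL-++ (map (x ,_) ys) _ f)
    (cong₂ _+_ (sumL-map (x ,_) ys f) (sumL-product xs ys f))

  sumL-single : ∀ {A : Set} {xs : List A} (f : A → ℤ) {a} → Unique xs → a ∈ xs →
    (∀ x → x ∈ xs → x ≢ a → f x ≡ 0ℤ) → sumL xs f ≡ f a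
  sumL-single {xs = x ∷ xs} f (p ∷ u) (here refl) e =
    trans (cong (_+_ (f x)) (sumL-zero xs (λ y y∈ → e y (there y∈) (≢-sym (All.lookup p y∈))))) (ℤP.+-identityʳ _)
  sumL-single {xs = x ∷ xs} f (p ∷ u) (there a∈) e =
    trans (cong₂ _+_ (e x (here refl) (All.lookup p a∈)) (sumL-single f u a∈ (λ y y∈ → e y (there y∈))))
        (ℤP.+-identityˡ _)

  -- Double counting of the pairs (a , φ a) with f a ≢ 0.
  sumL-bijection : ∀ {A B : Set} → DecidableEquality B →
    ∀ {xs : List A} {ys : List B} → Unique xs → Unique ys →
    (f : A → ℤ) (g : B → ℤ) (φ : A → B) (ψ : B → A) →
    (∀ a → a ∈ xs → f a ≢ 0ℤ → φ a ∈ ys × ψ (φ a) ≡ a × g (φ a) ≡ f a) →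
    (∀ b → b ∈ ys → g b ≢ 0ℤ → ψ b ∈ xs × φ (ψ b) ≡ b × f (ψ b) ≡ g b) →
    sumL xs f ≡ sumL ys g
  sumL-bijection {A} {B} _≟_ {xs} {ys} uxs uys f g φ ψ to from = begin
    sumL xs f                                 ≡⟨ sumL-cong xs (λ a a∈ → sym (row a a∈)) ⟩
    sumL xs (λ a → sumL ys (λ b → w a b))     ≡⟨ sumL-swap xs ys w ⟩
    sumL ys (λ b → sumL xs (λ a → w a b))     ≡⟨ sumL-cong ys col ⟩
    sumL ys g                                 ∎
    where
    open ≡-Reasoning
    w : A → B → ℤ
    w a b with φ a ≟ b
    ... | yes _ = f a
    ... | no _  = 0ℤ

    w-yes : ∀ a b → φ a ≡ b → w a b ≡ f a
    w-yes a b e with φ a ≟ b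
    ... | yes _ = refl
    ... | no ¬e = contradiction e ¬e

    w-no : ∀ a b → φ a ≢ b → w a b ≡ 0ℤ
    w-no a b ¬e with φ a ≟ b
    ... | yes e = contradiction e ¬e
    ... | no _  = refl

    w-zero : ∀ a b → f a ≡ 0ℤ → w a b ≡ 0ℤ
    w-zero a b z with φ a ≟ b
    ... | yes _ = z
    ... | no _  = refl

    row : ∀ a → a ∈ xs → sumL ys (w a) ≡ f a
    row a a∈ with f a ℤ.≟ 0ℤ
    ... | yes z = trans (sumL-zero ys (λ b _ → w-zero a b z)) (sym z)
    ... | no nz = trans (sumL-single (w a) uys (proj₁ (to a a∈ nz)) (λ b _ b≢ → w-no a b (≢-sym b≢)))
                        (w-yes a (φ a) refl)

    col : ∀ b → b ∈ ys → sumL xs (λ a → w a b) ≡ g b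
    col b b∈ with g b ℤ.≟ 0ℤ
    ... | yes z = trans (sumL-zero xs λ a a∈ → off a a∈) (sym z)
      where
      off : ∀ a → a ∈ xs → w a b ≡ 0ℤ
      off a a∈ with f a ℤ.≟ 0ℤ
      ... | yes z′ = w-zero a b z′
      ... | no nz  = w-no a b λ e → nz (trans (sym (proj₂ (proj₂ (to a a∈ nz)))) (trans (cong g e) z))
    ... | no nz = trans (trans (sum≡ (proj₁ (from b b∈ nz))) (w-yes (ψ b) b (proj₁ (proj₂ (from b b∈ nz)))))
                        (proj₂ (proj₂ (from b b∈ nz)))
      where
      at-ψ : ∀ a → a ∈ xs → a ≢ ψ b → w a b ≡ 0ℤ
      at-ψ a a∈ a≢ with f a ℤ.≟ 0ℤ
      ... | yes z = w-zero a b z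
      ... | no n  = w-no a b λ e → a≢ (trans (sym (proj₁ (proj₂ (to a a∈ n)))) (cong ψ e))
      sum≡ : ψ b ∈ xs → sumL xs (λ a → w a b) ≡ w (ψ b) b
      sum≡ ψb∈ = sumL-single _ uxs ψb∈ at-ψ

  pos : ℕ → List ℕ
  pos zero    = []
  pos (suc n) = suc n ∷ pos n

  ∈-pos⁻ : ∀ {x} n → x ∈ pos n → 1 ≤ x × x ≤ n
  ∈-pos⁻ (suc n) (here refl) = s≤s z≤n , ℕP.≤-refl
  ∈-pos⁻ (suc n) (there x∈)  = let l , h = ∈-pos⁻ n x∈ in l , ℕP.m≤n⇒m≤1+n h

  ∈-pos⁺ : ∀ {x} n → 1 ≤ x → x ≤ n → x ∈ pos n
  ∈-pos⁺ {x} zero 1≤x x≤0 = contradiction (ℕP.≤-trans 1≤x x≤0) λ ()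
  ∈-pos⁺ {x} (suc n) 1≤x x≤n with x ℕ.≟ suc n
  ... | yes refl = here refl
  ... | no x≢    = there (∈-pos⁺ n 1≤x (ℕP.≤-pred (ℕP.≤∧≢⇒< x≤n x≢)))

  pos-unique : ∀ n → Unique (pos n)
  pos-unique zero    = []
  pos-unique (suc n) = All.tabulate (λ x∈ e → ℕP.<-irrefl (sym e) (s≤s (proj₂ (∈-pos⁻ n x∈)))) ∷ pos-unique n

  ints : ℕ → List ℤ
  ints zero    = 0ℤ ∷ []
  ints (suc n) = + suc n ∷ -[1+ n ] ∷ ints n

  ∈-ints⁻ : ∀ {z} n → z ∈ ints n → ∣ z ∣ ≤ n
  ∈-ints⁻ zero    (here refl)         = z≤n
  ∈-ints⁻ (suc n) (here refl)         = ℕP.≤-refl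
  ∈-ints⁻ (suc n) (there (here refl)) = ℕP.≤-refl
  ∈-ints⁻ (suc n) (there (there z∈))  = ℕP.m≤n⇒m≤1+n (∈-ints⁻ n z∈)

  ∈-ints⁺ : ∀ z n → ∣ z ∣ ≤ n → z ∈ ints n
  ∈-ints⁺ (+ zero)  zero    z≤n = here refl
  ∈-ints⁺ z (suc n) h with ∣ z ∣ ℕ.≟ suc n
  ∈-ints⁺ (+ _)    (suc n) h | yes refl = here refl
  ∈-ints⁺ -[1+ _ ] (suc n) h | yes refl = there (here refl)
  ... | no ≢ = there (there (∈-ints⁺ z n (ℕP.≤-pred (ℕP.≤∧≢⇒< h ≢))))

  ints-unique : ∀ n → Unique (ints n)
  ints-unique zero    = [] ∷ []
  ints-unique (suc n) =
    ((λ ()) ∷ All.tabulate (λ z∈ e → big z∈ (sym (cong ∣_∣ e)))) ∷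
    All.tabulate (λ z∈ e → big z∈ (sym (cong ∣_∣ e))) ∷ ints-unique n
    where
    big : ∀ {z} → z ∈ ints n → ∣ z ∣ ≢ suc n
    big z∈ e = ℕP.<-irrefl e (s≤s (∈-ints⁻ n z∈))

  sumL-ints : ∀ n (F : ℤ → ℤ) → sumL (ints n) F ≡ F 0ℤ + sumL (pos n) (λ x → F (+ x) + F (- + x))
  sumL-ints zero    F = refl
  sumL-ints (suc n) F rewrite sumL-ints n F = lem (F (+ suc n)) (F -[1+ n ]) (F 0ℤ)
      (sumL (pos n) (λ x → F (+ x) + F (- + x)))
    where
    lem : ∀ a b c d → a + (b + (c + d)) ≡ c + (a + b + d)
    lem = ℤRS.solve-∀

  sumL-pos-extend : ∀ {n} B (F : ℕ → ℤ) → n ≤ B → (∀ x → n < x → F x ≡ 0ℤ) → sumL (pos B) F ≡ sumL (pos n) F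
  sumL-pos-extend {n} B F n≤B z with n ℕ.≟ B
  ... | yes refl = refl
  sumL-pos-extend {n} zero F z≤n z | no n≢ = contradiction refl n≢
  sumL-pos-extend {n} (suc B) F n≤B z | no n≢ = trans
    (cong₂ _+_ (z (suc B) n<B) (sumL-pos-extend B F (ℕP.≤-pred n<B) z)) (ℤP.+-identityˡ _)
    where n<B = ℕP.≤∧≢⇒< n≤B n≢

  mono : ℕ → PS
  mono zero    zero    = 1ℤ
  mono zero    (suc n) = 0ℤ
  mono (suc k) zero    = 0ℤ
  mono (suc k) (suc n) = mono k n

  mono-refl : ∀ k → mono k k ≡ 1ℤ
  mono-refl zero    = refl
  mono-refl (suc k) = mono-refl k

  mono-≢ : ∀ {k n} → k ≢ n → mono k n ≡ 0ℤ
  mono-≢ {zero}  {zero}  k≢n = contradiction refl k≢n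
  mono-≢ {zero}  {suc n} k≢n = refl
  mono-≢ {suc k} {zero}  k≢n = refl
  mono-≢ {suc k} {suc n} k≢n = mono-≢ (k≢n ∘ cong suc)

  mono≢0 : ∀ c k n → c * mono k n ≢ 0ℤ → k ≡ n
  mono≢0 c k n nz with k ℕ.≟ n
  ... | yes e = e
  ... | no ¬e = contradiction (trans (cong (c *_) (mono-≢ ¬e)) (ℤP.*-zeroʳ c)) nz

  mono-⇔ : ∀ k n k′ n′ → (k ≡ n → k′ ≡ n′) → (k′ ≡ n′ → k ≡ n) → mono k n ≡ mono k′ n′
  mono-⇔ k n k′ n′ to from with k ℕ.≟ n
  ... | yes refl = trans (mono-refl k) (trans (sym (mono-refl k′)) (cong (mono k′) (to refl)))
  ... | no ¬e    = trans (mono-≢ ¬e) (sym (mono-≢ (¬e ∘ from)))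

  mono-⊛ : ∀ j k n → (mono j ⊛ mono k) n ≡ mono (j ℕ.+ k) n
  mono-⊛ zero    k n = trans (⊛-congʳ {mono 0} {one} (mono k) n (λ { zero _ → refl ; (suc _) _ → refl }))
      (⊛-identityˡ (mono k) n)
  mono-⊛ (suc j) k zero    = refl
  mono-⊛ (suc j) k (suc n) = trans (⊛-suc (mono (suc j)) (mono k) n) (trans (ℤP.+-identityˡ _) (mono-⊛ j k n))

  -- The theta series Σ_{x≥1} a(x) q^(m x²); all characters a needed have period 12.
  Sq : (ℕ → ℤ) → ℕ → PS
  Sq a m n = sumL (pos n) (λ x → a (x % 12) * mono (m ℕ.* (x ℕ.* x)) n)

  m≤sq : ∀ {m} x → 1 ≤ m → x ≤ m ℕ.* (x ℕ.* x)
  m≤sq zero    _ = z≤n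
  m≤sq {m} (suc x) 1≤m = ℕP.≤-trans (ℕP.m≤m*n (suc x) (suc x)) (ℕP.m≤n*m (suc x ℕ.* suc x) m {{ℕ.>-nonZero 1≤m}})

  Sq-extend : ∀ a {m} n B → 1 ≤ m → n ≤ B →
    sumL (pos B) (λ x → a (x % 12) * mono (m ℕ.* (x ℕ.* x)) n) ≡ Sq a m n
  Sq-extend a {m} n B 1≤m n≤B = sumL-pos-extend B _ n≤B λ x n<x →
    trans (cong (a (x % 12) *_) (mono-≢ λ e → ℕP.<-irrefl (sym e) (ℕP.≤-trans n<x (m≤sq x 1≤m))))
        (ℤP.*-zeroʳ (a (x % 12)))

  sumL-⊛ : ∀ {A : Set} (xs : List A) (c : A → ℤ) (F : A → PS) g n →
    ((λ k → sumL xs (λ x → c x * F x k)) ⊛ g) n ≡ sumL xs (λ x → c x * (F x ⊛ g) n)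
  sumL-⊛ [] c F g n = sumTo-zero n (λ i _ → ℤP.*-zeroˡ (g (n ∸ i)))
  sumL-⊛ (x ∷ xs) c F g n = trans (⊛-distribʳ (scale (c x) (F x)) _ g n)
    (cong₂ _+_ (⊛-scaleʳ (c x) (F x) g n) (sumL-⊛ xs c F g n))

  -- The box bound `B` may exceed n, so that coefficients at n and at 3n can be written over one and
  -- the same box.
  Sq-⊛ : ∀ a b {m l} n B → 1 ≤ m → 1 ≤ l → n ≤ B → (Sq a m ⊛ Sq b l) n ≡
    sumL (pos B) (λ x → sumL (pos B) (λ y →
      a (x % 12) * b (y % 12) * mono (m ℕ.* (x ℕ.* x) ℕ.+ l ℕ.* (y ℕ.* y)) n))
  Sq-⊛ a b {m} {l} n B 1≤m 1≤l n≤B = begin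
    (Sq a m ⊛ Sq b l) n
      ≡⟨ ⊛-congʳ (Sq b l) n (λ i i≤n → sym (Sq-extend a i B 1≤m (ℕP.≤-trans i≤n n≤B))) ⟩
    (SqB a m ⊛ Sq b l) n
      ≡⟨ ⊛-congˡ (SqB a m) n (λ i i≤n → sym (Sq-extend b i B 1≤l (ℕP.≤-trans i≤n n≤B))) ⟩
    (SqB a m ⊛ SqB b l) n
      ≡⟨ sumL-⊛ (pos B) (λ x → a (x % 12)) (λ x → mono (m ℕ.* (x ℕ.* x))) (SqB b l) n ⟩
    sumL (pos B) (λ x → a (x % 12) * (mono (m ℕ.* (x ℕ.* x)) ⊛ SqB b l) n)
      ≡⟨ sumL-cong (pos B) (λ x _ → inner x) ⟩
    sumL (pos B) (λ x → sumL (pos B) (λ y →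
      a (x % 12) * b (y % 12) * mono (m ℕ.* (x ℕ.* x) ℕ.+ l ℕ.* (y ℕ.* y)) n)) ∎
    where
    open ≡-Reasoning
    SqB : (ℕ → ℤ) → ℕ → PS
    SqB c k i = sumL (pos B) (λ x → c (x % 12) * mono (k ℕ.* (x ℕ.* x)) i)
    inner : ∀ x → a (x % 12) * (mono (m ℕ.* (x ℕ.* x)) ⊛ SqB b l) n ≡
      sumL (pos B) (λ y → a (x % 12) * b (y % 12) * mono (m ℕ.* (x ℕ.* x) ℕ.+ l ℕ.* (y ℕ.* y)) n)
    inner x = begin
      a (x % 12) * (mono X ⊛ SqB b l) n
        ≡⟨ cong (a (x % 12) *_) (trans (⊛-comm (mono X) (SqB b l) n)
            (sumL-⊛ (pos B) (λ y → b (y % 12)) (λ y → mono (l ℕ.* (y ℕ.* y))) (mono X) n)) ⟩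
      a (x % 12) * sumL (pos B) (λ y → b (y % 12) * (mono (l ℕ.* (y ℕ.* y)) ⊛ mono X) n)
        ≡⟨ sumL-scale (pos B) (a (x % 12)) _ ⟨
      sumL (pos B) (λ y → a (x % 12) * (b (y % 12) * (mono (l ℕ.* (y ℕ.* y)) ⊛ mono X) n))
        ≡⟨ sumL-cong (pos B) (λ y _ → trans (sym (ℤP.*-assoc (a (x % 12)) _ _))
             (cong (a (x % 12) * b (y % 12) *_) (trans (⊛-comm (mono (l ℕ.* (y ℕ.* y))) (mono X) n)
                 (mono-⊛ X (l ℕ.* (y ℕ.* y)) n)))) ⟩
      _ ∎
      where X = m ℕ.* (x ℕ.* x)

  -- Multiplication by 1 + √-2

  %-cong-∣ : ∀ d .{{_ : NonZero d}} a b → (+ d) ∣ + a - + b → a % d ≡ b % d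
  %-cong-∣ d a b (divides (+ k) e) = trans (cong (_% d) (ℤP.+-injective a≡)) (ℕD.[m+kn]%n≡m%n b k d)
    where
    lem : ∀ x y → x ≡ y + (x - y)
    lem = ℤRS.solve-∀
    a≡ : + a ≡ + (b ℕ.+ k ℕ.* d)
    a≡ = trans (lem (+ a) (+ b)) (cong (_+_ (+ b)) (trans e (sym (ℤP.pos-* k d))))
  %-cong-∣ d a b (divides -[1+ k ] e) = sym (trans (cong (_% d) (ℤP.+-injective b≡)) (ℕD.[m+kn]%n≡m%n a (suc k) d))
    where
    lem : ∀ x y → y ≡ x + - (x - y)
    lem = ℤRS.solve-∀
    lem′ : ∀ c d → - (- c * d) ≡ c * d
    lem′ = ℤRS.solve-∀
    b≡ : + b ≡ + (a ℕ.+ suc k ℕ.* d)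
    b≡ = trans (lem (+ a) (+ b)) (cong (_+_ (+ a))
        (trans (cong -_ e) (trans (lem′ (+ suc k) (+ d)) (sym (ℤP.pos-* (suc k) d)))))

  pos-% : ∀ d .{{_ : NonZero d}} a → + a ≡ + (a % d) + + (a ℕ./ d) * + d
  pos-% d a = trans (cong +_ (ℕD.m≡m%n+[m/n]*n a d)) (cong (_+_ (+ (a % d))) (ℤP.pos-* (a ℕ./ d) d))

  %-≡⇒∣ : ∀ d .{{_ : NonZero d}} a b → a % d ≡ b % d → (+ d) ∣ + a - + b
  %-≡⇒∣ d a b e = divides (+ (a ℕ./ d) - + (b ℕ./ d)) (begin
    + a - + b ≡⟨ cong₂ _-_ (trans (pos-% d a) (cong (λ r → + r + + (a ℕ./ d) * + d) e)) (pos-% d b) ⟩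
    _         ≡⟨ lem (+ (b % d)) (+ (a ℕ./ d)) (+ (b ℕ./ d)) (+ d) ⟩
    _         ∎)
    where
    open ≡-Reasoning
    lem : ∀ r x y d → r + x * d - (r + y * d) ≡ (x - y) * d
    lem = ℤRS.solve-∀

  res : ℤ → ℕ
  res z = z %ℕ 12

  res<12 : ∀ z → res z < 12
  res<12 z = ℤD.n%ℕd<d z 12

  res-unique : ∀ z i → (+ 12) ∣ z - + i → res z ≡ i % 12
  res-unique z i d = trans (sym (ℕD.m<n⇒m%n≡m (res<12 z)))
    (%-cong-∣ 12 (res z) i (subst ((+ 12) ∣_) eq (Div.∣m∣n⇒∣m-n d (Div.∣n⇒∣m*n (z ℤD./ℕ 12) {+ 12} Div.∣-refl))))
    where
    lem : ∀ r q i → (r + q * + 12) - i - q * + 12 ≡ r - i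
    lem = ℤRS.solve-∀
    eq : z - + i - (z ℤD./ℕ 12) * + 12 ≡ + res z - + i
    eq = trans (cong (λ w → w - + i - (z ℤD./ℕ 12) * + 12) (ℤD.a≡a%ℕn+[a/ℕn]*n z 12))
        (lem (+ res z) (z ℤD./ℕ 12) (+ i))

  -- The true coefficient of b is k - 12e. Thus e = 1 represents -2 and -1 by the naturals 10 and
  -- 11, and residues of integer combinations are computed in ℕ.
  res-linear : ∀ (a b k : ℕ) (e : ℤ) {z} → z ≡ + a + (+ k - e * + 12) * + b → res z ≡ (a % 12 ℕ.+ k ℕ.* (b % 12)) % 12
  res-linear a b k e {z} z≡ = res-unique z _ (divides (A + (+ k) * B - e * + b) (begin
    z - + (a % 12 ℕ.+ k ℕ.* (b % 12))
      ≡⟨ cong₂ (λ x y → x - (+ (a % 12) + y)) z≡ (ℤP.pos-* k (b % 12)) ⟩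
    + a + (+ k - e * + 12) * + b - (+ (a % 12) + + k * + (b % 12))
      ≡⟨ cong₂ (λ x y → x + (+ k - e * + 12) * + b - (+ (a % 12) + + k * y)) (pos-% 12 a)
          (lem₁ (+ b) (+ (b % 12)) (B * + 12) (pos-% 12 b)) ⟩
    + (a % 12) + A * + 12 + (+ k - e * + 12) * + b - (+ (a % 12) + + k * (+ b - B * + 12))
      ≡⟨ lem (+ (a % 12)) A (+ k) e (+ b) B ⟩
    (A + (+ k) * B - e * + b) * + 12 ∎))
    where
    open ≡-Reasoning
    A = + (a ℕ./ 12)
    B = + (b ℕ./ 12)
    lem₁ : ∀ x r q → x ≡ r + q → r ≡ x - q
    lem₁ x r q refl = lem₂ r q
      where
      lem₂ : ∀ r q → r ≡ r + q - q
      lem₂ = ℤRS.solve-∀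
    lem : ∀ r A k e b B → r + A * + 12 + (k - e * + 12) * b - (r + k * (b - B * + 12)) ≡ (A + k * B - e * b) * + 12
    lem = ℤRS.solve-∀

  res-neg : ∀ z → res (- z) ≡ (12 ∸ res z) % 12
  res-neg z = res-unique (- z) _ (divides (- 1ℤ - (z ℤD./ℕ 12)) (begin
    - z - + (12 ∸ res z)
      ≡⟨ cong₂ (λ x y → - x - y) (ℤD.a≡a%ℕn+[a/ℕn]*n z 12)
          (trans (sym (ℤP.⊖-≥ (ℕP.<⇒≤ (res<12 z)))) (sym (ℤP.m-n≡m⊖n 12 (res z)))) ⟩
    - (+ res z + (z ℤD./ℕ 12) * + 12) - (+ 12 - + res z)
      ≡⟨ lem (+ res z) (z ℤD./ℕ 12) ⟩
    _ ∎))
    where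
    open ≡-Reasoning
    lem : ∀ r q → - (r + q * + 12) - (+ 12 - r) ≡ (- 1ℤ - q) * + 12
    lem = ℤRS.solve-∀

  -- The norm of x + y√-2. The factor 1 gives it the shape of the exponent in `Sq-⊛` for m = 1 and l
  -- = 2.
  norm : ℤ → ℤ → ℕ
  norm x y = 1 ℕ.* (∣ x ∣ ℕ.* ∣ x ∣) ℕ.+ 2 ℕ.* (∣ y ∣ ℕ.* ∣ y ∣)

  pos-∣∣² : ∀ z → + (∣ z ∣ ℕ.* ∣ z ∣) ≡ z * z
  pos-∣∣² (+ n)    = ℤP.pos-* n n
  pos-∣∣² -[1+ n ] = refl

  pos-norm : ∀ x y → + norm x y ≡ x * x + + 2 * (y * y)
  pos-norm x y = cong₂ _+_ (trans (cong +_ (ℕP.*-identityˡ (∣ x ∣ ℕ.* ∣ x ∣))) (pos-∣∣² x))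
    (trans (ℤP.pos-* 2 (∣ y ∣ ℕ.* ∣ y ∣)) (cong (+ 2 *_) (pos-∣∣² y)))

  -- (1 + √-2)(u + v√-2) = (u - 2v) + (u + v)√-2, and 1 + √-2 has norm 3.
  norm-mult : ∀ u v → norm (u - + 2 * v) (u + v) ≡ norm u v ℕ.* 3
  norm-mult u v = ℤP.+-injective (begin
    + norm (u - + 2 * v) (u + v) ≡⟨ pos-norm (u - + 2 * v) (u + v) ⟩
    _                            ≡⟨ lem u v ⟩
    (u * u + + 2 * (v * v)) * + 3 ≡⟨ cong (_* + 3) (pos-norm u v) ⟨
    + norm u v * + 3             ≡⟨ ℤP.pos-* (norm u v) 3 ⟨
    + (norm u v ℕ.* 3)           ∎)
    where
    open ≡-Reasoning
    lem : ∀ u v → (u - + 2 * v) * (u - + 2 * v) + + 2 * ((u + v) * (u + v)) ≡ (u * u + + 2 * (v * v)) * + 3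
    lem = ℤRS.solve-∀

  norm-neg : ∀ x y → norm (- x) (- y) ≡ norm x y
  norm-neg x y rewrite ℤP.∣-i∣≡∣i∣ x | ℤP.∣-i∣≡∣i∣ y = refl

  ∣x∣≤norm : ∀ x y → ∣ x ∣ ≤ norm x y
  ∣x∣≤norm x y = ℕP.≤-trans (m≤sq {1} ∣ x ∣ (s≤s z≤n)) (ℕP.m≤m+n (1 ℕ.* (∣ x ∣ ℕ.* ∣ x ∣)) (2 ℕ.* (∣ y ∣ ℕ.* ∣ y ∣)))

  ∣y∣≤norm : ∀ x y → ∣ y ∣ ≤ norm x y
  ∣y∣≤norm x y = ℕP.≤-trans (m≤sq {2} ∣ y ∣ (s≤s z≤n)) (ℕP.m≤n+m (2 ℕ.* (∣ y ∣ ℕ.* ∣ y ∣)) (1 ℕ.* (∣ x ∣ ℕ.* ∣ x ∣)))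

  sumℤ² : ℕ → (ℤ → ℤ → ℤ) → ℤ
  sumℤ² B F = sumL (ints B) (λ x → sumL (ints B) (F x))

  -- Central symmetry pairs (x, y) with (-x, -y). One half of the plane without the origin consists
  -- of two half axes and the two quadrants with x > 0, and each of its points counts twice.
  sumℤ²-even : ∀ B (F : ℤ → ℤ → ℤ) → (∀ x y → F (- x) (- y) ≡ F x y) →
    sumℤ² B F ≡ F 0ℤ 0ℤ + + 2 * (sumL (pos B) (λ x → F (+ x) 0ℤ) + sumL (pos B) (λ y → F 0ℤ (+ y))
      + sumL (pos B) (λ x → sumL (pos B) (λ y → F (+ x) (+ y) + F (+ x) (- + y))))
  sumℤ²-even B F even = begin
    sumL (ints B) row
      ≡⟨ sumL-ints B row ⟩
    row 0ℤ + sumL (pos B) (λ x → row (+ x) + row (- + x))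
      ≡⟨ cong₂ _+_ (trans (sumL-ints B (F 0ℤ)) (cong (_+_ (F 0ℤ 0ℤ))
           (trans (sumL-cong (pos B) (λ y _ → trans (cong (_+_ (F 0ℤ (+ y))) (even 0ℤ (+ y))) (double (F 0ℤ (+ y)))))
             (sumL-scale (pos B) (+ 2) (λ y → F 0ℤ (+ y))))))
           (trans (sumL-cong (pos B) (λ x _ → rows x)) (trans (sumL-scale (pos B) (+ 2) (λ x → F (+ x) 0ℤ + inner x))
             (cong (+ 2 *_) (sumL-+ (pos B) (λ x → F (+ x) 0ℤ) inner)))) ⟩
    _ ≡⟨ lem (F 0ℤ 0ℤ) (sumL (pos B) (λ y → F 0ℤ (+ y))) (sumL (pos B) (λ x → F (+ x) 0ℤ)) (sumL (pos B) inner) ⟩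
    _ ∎
    where
    open ≡-Reasoning
    row : ℤ → ℤ
    row x = sumL (ints B) (F x)
    inner : ℕ → ℤ
    inner x = sumL (pos B) (λ y → F (+ x) (+ y) + F (+ x) (- + y))
    double : ∀ z → z + z ≡ + 2 * z
    double = ℤRS.solve-∀
    lem : ∀ z p q r → z + + 2 * p + + 2 * (q + r) ≡ z + + 2 * (q + p + r)
    lem = ℤRS.solve-∀
    lem′ : ∀ z r → (z + r) + (z + r) ≡ + 2 * (z + r)
    lem′ = ℤRS.solve-∀
    rows : ∀ x → row (+ x) + row (- + x) ≡ + 2 * (F (+ x) 0ℤ + inner x)
    rows x = trans (cong₂ _+_ (sumL-ints B (F (+ x))) (trans (sumL-ints B (F (- + x)))
        (cong₂ _+_ (even (+ x) 0ℤ) (sumL-cong (pos B) (λ y _ →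
          trans (cong₂ _+_ (trans (cong (F (- + x)) (sym (ℤP.neg-involutive (+ y)))) (even (+ x) (- + y)))
              (even (+ x) (+ y)))
                (ℤP.+-comm (F (+ x) (- + y)) _))))))
      (lem′ (F (+ x) 0ℤ) (inner x))

  -- Here the weight need not be a product of a function of x and one of y, as it is for
  -- `Sq a 1 ⊛ Sq b 2`: multiplication by 1 + √-2 destroys that shape.
  theta : ℕ → (ℕ → ℕ → ℤ) → PS
  theta B C n = sumL (pos B) (λ x → sumL (pos B) (λ y →
    C (x % 12) (y % 12) * mono (1 ℕ.* (x ℕ.* x) ℕ.+ 2 ℕ.* (y ℕ.* y)) n))

  -- `H` is a weight on x + y√-2 that depends on residues modulo 12. Its support lies in the ideal
  -- of 1 + √-2, which is 3 ∣ y - x; restricting to one of the two primes above 3 makes division by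
  -- 1 + √-2 a bijection.
  module Lattice (H : ℕ → ℕ → ℤ)
    (H-even : ∀ {i} → i < 12 → ∀ {j} → j < 12 → H ((12 ∸ i) % 12) ((12 ∸ j) % 12) ≡ H i j)
    (H-supp : ∀ i j → H i j ≢ 0ℤ → (+ 3) ∣ + j - + i)
    where

    -- The weights of (1 + √-2)(u + v√-2) and (1 + √-2)(u - v√-2), with 10 and 11 standing for -2
    -- and -1 modulo 12.
    H₊ H₋ : ℕ → ℕ → ℤ
    H₊ i j = H ((i ℕ.+ 10 ℕ.* j) % 12) ((i ℕ.+ 1 ℕ.* j) % 12)
    H₋ i j = H ((i ℕ.+ 2 ℕ.* j) % 12) ((i ℕ.+ 11 ℕ.* j) % 12)

    private
      F : ℕ → ℤ → ℤ → ℤ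
      F n x y = H (res x) (res y) * mono (norm x y) (n ℕ.* 3)

      G : ℕ → ℤ → ℤ → ℤ
      G n u v = H (res (u - + 2 * v)) (res (u + v)) * mono (norm u v) n

      F-even : ∀ n x y → F n (- x) (- y) ≡ F n x y
      F-even n x y = cong₂ _*_ (trans (cong₂ H (res-neg x) (res-neg y)) (H-even (res<12 x) (res<12 y)))
        (cong (λ k → mono k (n ℕ.* 3)) (norm-neg x y))

      G-even : ∀ n u v → G n (- u) (- v) ≡ G n u v
      G-even n u v = cong₂ _*_
        (trans (cong₂ H (trans (cong res (lem₁ u v)) (res-neg (u - + 2 * v)))
            (trans (cong res (lem₂ u v)) (res-neg (u + v))))
               (H-even (res<12 (u - + 2 * v)) (res<12 (u + v))))
        (cong (λ k → mono k n) (norm-neg u v))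
        where
        lem₁ : ∀ u v → - u - + 2 * - v ≡ - (u - + 2 * v)
        lem₁ = ℤRS.solve-∀
        lem₂ : ∀ u v → - u + - v ≡ - (u + v)
        lem₂ = ℤRS.solve-∀

      3∣res⇒3∣ : ∀ x y → (+ 3) ∣ + res y - + res x → (+ 3) ∣ y - x
      3∣res⇒3∣ x y (divides q e) = divides (q + + 4 * (y ℤD./ℕ 12 - x ℤD./ℕ 12)) (begin
        y - x ≡⟨ cong₂ _-_ (ℤD.a≡a%ℕn+[a/ℕn]*n y 12) (ℤD.a≡a%ℕn+[a/ℕn]*n x 12) ⟩
        _     ≡⟨ lem (+ res y) (+ res x) (y ℤD./ℕ 12) (x ℤD./ℕ 12) ⟩
        + res y - + res x + + 12 * (y ℤD./ℕ 12 - x ℤD./ℕ 12) ≡⟨ cong (_+ + 12 * (y ℤD./ℕ 12 - x ℤD./ℕ 12)) e ⟩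
        _     ≡⟨ lem′ q (y ℤD./ℕ 12 - x ℤD./ℕ 12) ⟩
        _     ∎)
        where
        open ≡-Reasoning
        lem : ∀ a b c d → a + c * + 12 - (b + d * + 12) ≡ a - b + + 12 * (c - d)
        lem = ℤRS.solve-∀
        lem′ : ∀ q d → q * + 3 + + 12 * d ≡ (q + + 4 * d) * + 3
        lem′ = ℤRS.solve-∀

      -- Solving x = u - 2v and y = u + v gives 3v = y - x and u = y - v. The default value is
      -- reached only off the ideal, where `H` vanishes.
      divide : ℤ × ℤ → ℤ × ℤ
      divide (x , y) with (+ 3) Div.∣? (y - x)
      ... | yes d = y - Div.quotient d , Div.quotient d
      ... | no _  = 0ℤ , 0ℤ

      multiply : ℤ × ℤ → ℤ × ℤ
      multiply (u , v) = u - + 2 * v , u + v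

      multiply-divide : ∀ x y → (+ 3) ∣ y - x → multiply (divide (x , y)) ≡ (x , y)
      multiply-divide x y d with (+ 3) Div.∣? (y - x)
      ... | no ¬d = contradiction d ¬d
      ... | yes (divides q e) = cong₂ _,_ (trans (lem₁ y q) (trans (cong (λ w → y - w) (sym e)) (lem₂ x y)))
          (lem₃ y q)
        where
        lem₁ : ∀ y q → y - q - + 2 * q ≡ y - q * + 3
        lem₁ = ℤRS.solve-∀
        lem₂ : ∀ x y → y - (y - x) ≡ x
        lem₂ = ℤRS.solve-∀
        lem₃ : ∀ y q → y - q + q ≡ y
        lem₃ = ℤRS.solve-∀

      divide-multiply : ∀ u v → divide (multiply (u , v)) ≡ (u , v)
      divide-multiply u v with (+ 3) Div.∣? (u + v - (u - + 2 * v))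
      ... | no ¬d = contradiction (divides v (lem u v)) ¬d
        where
        lem : ∀ u v → u + v - (u - + 2 * v) ≡ v * + 3
        lem = ℤRS.solve-∀
      ... | yes (divides q e) = cong₂ _,_ (trans (cong (λ w → u + v - w) q≡v) (lem₂ u v)) q≡v
        where
        lem : ∀ u v → u + v - (u - + 2 * v) ≡ v * + 3
        lem = ℤRS.solve-∀
        lem₂ : ∀ u v → u + v - v ≡ u
        lem₂ = ℤRS.solve-∀
        q≡v : q ≡ v
        q≡v = ℤP.*-cancelʳ-≡ q v (+ 3) (trans (sym e) (lem u v))

      F≡G : ∀ n u v → F n (u - + 2 * v) (u + v) ≡ G n u v
      F≡G n u v = cong (H (res (u - + 2 * v)) (res (u + v)) *_)
        (trans (cong (λ k → mono k (n ℕ.* 3)) (norm-mult u v))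
            (mono-⇔ (norm u v ℕ.* 3) (n ℕ.* 3) (norm u v) n (ℕP.*-cancelʳ-≡ (norm u v) n 3) (cong (ℕ._* 3))))

      ∈-square : ∀ B x y → norm x y ≤ B → (x , y) ∈ cartesianProduct (ints B) (ints B)
      ∈-square B x y h = ∈-cartesianProduct⁺ (∈-ints⁺ x B (ℕP.≤-trans (∣x∣≤norm x y) h))
          (∈-ints⁺ y B (ℕP.≤-trans (∣y∣≤norm x y) h))

      -- One box serves both sides: a coordinate is at most the norm, which is 3n on the left and n
      -- on the right.
      reindex : ∀ n → sumℤ² (n ℕ.* 3) (F n) ≡ sumℤ² (n ℕ.* 3) (G n)
      reindex n = trans (sym (sumL-product (ints B) (ints B) f)) (trans
        (sumL-bijection (≡-dec ℤ._≟_ ℤ._≟_) unique unique f g divide multiply to from)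
        (sumL-product (ints B) (ints B) g))
        where
        B = n ℕ.* 3
        f g : ℤ × ℤ → ℤ
        f (x , y) = F n x y
        g (u , v) = G n u v
        unique = UniqueP.cartesianProduct⁺ (ints-unique B) (ints-unique B)
        to : ∀ z → z ∈ cartesianProduct (ints B) (ints B) → f z ≢ 0ℤ →
             divide z ∈ cartesianProduct (ints B) (ints B) × multiply (divide z) ≡ z × g (divide z) ≡ f z
        to (x , y) _ nz = ∈-square B u v (ℕP.≤-trans (ℕP.m≤m*n (norm u v) 3) (ℕP.≤-reflexive
                            (trans (sym (norm-mult u v)) (trans (cong₂ norm (cong proj₁ back) (cong proj₂ back))
                                norm≡))))
                        , back , trans (sym (F≡G n u v)) (cong f back)
          where
          u = proj₁ (divide (x , y))
          v = proj₂ (divide (x , y))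
          norm≡ : norm x y ≡ n ℕ.* 3
          norm≡ = mono≢0 (H (res x) (res y)) (norm x y) (n ℕ.* 3) nz
          H≢0 : H (res x) (res y) ≢ 0ℤ
          H≢0 z = nz (trans (cong (_* mono (norm x y) B) z) (ℤP.*-zeroˡ (mono (norm x y) B)))
          back : multiply (u , v) ≡ (x , y)
          back = multiply-divide x y (3∣res⇒3∣ x y (H-supp _ _ H≢0))
        from : ∀ z → z ∈ cartesianProduct (ints B) (ints B) → g z ≢ 0ℤ →
               multiply z ∈ cartesianProduct (ints B) (ints B) × divide (multiply z) ≡ z × f (multiply z) ≡ g z
        from (u , v) _ nz = ∈-square B (u - + 2 * v) (u + v)
            (ℕP.≤-reflexive (trans (norm-mult u v) (cong (ℕ._* 3) norm≡)))
                          , divide-multiply u v , F≡G n u v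
          where
          norm≡ : norm u v ≡ n
          norm≡ = mono≢0 (H (res (u - + 2 * v)) (res (u + v))) (norm u v) n nz

      res-u-2v : ∀ x y → res (+ x - + 2 * + y) ≡ (x % 12 ℕ.+ 10 ℕ.* (y % 12)) % 12
      res-u-2v x y = res-linear x y 10 1ℤ (lem (+ x) (+ y))
        where
        lem : ∀ x y → x - + 2 * y ≡ x + (+ 10 - 1ℤ * + 12) * y
        lem = ℤRS.solve-∀

      res-u+v : ∀ x y → res (+ x + + y) ≡ (x % 12 ℕ.+ 1 ℕ.* (y % 12)) % 12
      res-u+v x y = res-linear x y 1 0ℤ (lem (+ x) (+ y))
        where
        lem : ∀ x y → x + y ≡ x + (1ℤ - 0ℤ * + 12) * y
        lem = ℤRS.solve-∀

      res-u+2v : ∀ x y → res (+ x - + 2 * - + y) ≡ (x % 12 ℕ.+ 2 ℕ.* (y % 12)) % 12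
      res-u+2v x y = res-linear x y 2 0ℤ (lem (+ x) (+ y))
        where
        lem : ∀ x y → x - + 2 * - y ≡ x + (+ 2 - 0ℤ * + 12) * y
        lem = ℤRS.solve-∀

      res-u-v : ∀ x y → res (+ x + - + y) ≡ (x % 12 ℕ.+ 11 ℕ.* (y % 12)) % 12
      res-u-v x y = res-linear x y 11 1ℤ (lem (+ x) (+ y))
        where
        lem : ∀ x y → x - y ≡ x + (+ 11 - 1ℤ * + 12) * y
        lem = ℤRS.solve-∀

    -- By `quad`, adding the weights of (x, y) and (x, -y) restores the full product of characters.
    -- Before the division both axes have weight 0; after it the axes v = 0 and u = 0 may carry
    -- weight, and they give the two one-variable series.
    lattice : ∀ (a b : ℕ → ℤ) →
      (∀ {j} → j < 12 → H 0 j ≡ 0ℤ) → (∀ {i} → i < 12 → H i 0 ≡ 0ℤ) →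
      (∀ {i} → i < 12 → ∀ {j} → j < 12 → H i j + H i ((12 ∸ j) % 12) ≡ a i * b j) →
      ∀ n → (Sq a 1 ⊛ Sq b 2) (n ℕ.* 3) ≡
        Sq (λ i → H₊ i 0) 1 n + Sq (λ j → H₊ 0 j) 2 n + theta (n ℕ.* 3) (λ i j → H₊ i j + H₋ i j) n
    lattice a b zˡ zʳ quad n = begin
      (Sq a 1 ⊛ Sq b 2) (n ℕ.* 3)
        ≡⟨ Sq-⊛ a b {1} {2} (n ℕ.* 3) B (s≤s z≤n) (s≤s z≤n) ℕP.≤-refl ⟩
      theta B (λ i j → a i * b j) (n ℕ.* 3)
        ≡⟨ sumL-cong (pos B) (λ x _ → sumL-cong (pos B) (λ y _ → sym (F-quad x y))) ⟩
      sumL (pos B) (λ x → sumL (pos B) (λ y → F n (+ x) (+ y) + F n (+ x) (- + y)))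
        -- The bijection relates sums over the whole lattice, which are twice the half-plane sums.
        ≡⟨ ℤP.*-cancelˡ-≡ (+ 2) SF SG doubled ⟩
      sumL (pos B) (λ x → G n (+ x) 0ℤ) + sumL (pos B) (λ y → G n 0ℤ (+ y))
        + sumL (pos B) (λ x → sumL (pos B) (λ y → G n (+ x) (+ y) + G n (+ x) (- + y)))
        ≡⟨ cong₂ _+_ (cong₂ _+_ axis₁ axis₂) (sumL-cong (pos B) (λ x _ → sumL-cong (pos B) (λ y _ → G-quad x y))) ⟩
      Sq (λ i → H₊ i 0) 1 n + Sq (λ j → H₊ 0 j) 2 n + theta B (λ i j → H₊ i j + H₋ i j) n ∎
      where
      open ≡-Reasoning
      B = n ℕ.* 3
      n≤B : n ≤ B
      n≤B = ℕP.m≤m*n n 3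
      SF = sumL (pos B) (λ x → sumL (pos B) (λ y → F n (+ x) (+ y) + F n (+ x) (- + y)))
      SG = sumL (pos B) (λ x → G n (+ x) 0ℤ) + sumL (pos B) (λ y → G n 0ℤ (+ y))
        + sumL (pos B) (λ x → sumL (pos B) (λ y → G n (+ x) (+ y) + G n (+ x) (- + y)))

      F-quad : ∀ x y → F n (+ x) (+ y) + F n (+ x) (- + y) ≡
        a (x % 12) * b (y % 12) * mono (1 ℕ.* (x ℕ.* x) ℕ.+ 2 ℕ.* (y ℕ.* y)) B
      F-quad x y = trans (cong₂ (λ i k → F n (+ x) (+ y) + H (x % 12) i * mono k B) (res-neg (+ y))
          (cong (λ k → 1 ℕ.* (x ℕ.* x) ℕ.+ 2 ℕ.* (k ℕ.* k)) (ℤP.∣-i∣≡∣i∣ (+ y))))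
        (trans (sym (ℤP.*-distribʳ-+ (mono (norm (+ x) (+ y)) B) (H (x % 12) (y % 12))
            (H (x % 12) ((12 ∸ y % 12) % 12))))
          (cong (_* mono (norm (+ x) (+ y)) B) (quad (ℕD.m%n<n x 12) (ℕD.m%n<n y 12))))

      G-quad : ∀ x y → G n (+ x) (+ y) + G n (+ x) (- + y) ≡
        (H₊ (x % 12) (y % 12) + H₋ (x % 12) (y % 12)) * mono (1 ℕ.* (x ℕ.* x) ℕ.+ 2 ℕ.* (y ℕ.* y)) n
      G-quad x y = trans (cong₂ _+_
          (cong (_* mono (norm (+ x) (+ y)) n) (cong₂ H (res-u-2v x y) (res-u+v x y)))
          (cong₂ _*_ (cong₂ H (res-u+2v x y) (res-u-v x y))
            (cong (λ k → mono (1 ℕ.* (x ℕ.* x) ℕ.+ 2 ℕ.* (k ℕ.* k)) n) (ℤP.∣-i∣≡∣i∣ (+ y)))))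
        (sym (ℤP.*-distribʳ-+ (mono (norm (+ x) (+ y)) n) (H₊ (x % 12) (y % 12)) (H₋ (x % 12) (y % 12))))

      axis₁ : sumL (pos B) (λ x → G n (+ x) 0ℤ) ≡ Sq (λ i → H₊ i 0) 1 n
      axis₁ = trans (sumL-cong (pos B) (λ x _ → cong₂ _*_ (cong₂ H (res-u-2v x 0) (res-u+v x 0))
          (cong (λ k → mono k n) (ℕP.+-identityʳ (1 ℕ.* (x ℕ.* x))))))
        (Sq-extend (λ i → H₊ i 0) {1} n B (s≤s z≤n) n≤B)

      axis₂ : sumL (pos B) (λ y → G n 0ℤ (+ y)) ≡ Sq (λ j → H₊ 0 j) 2 n
      axis₂ = trans (sumL-cong (pos B) (λ y _ → cong (_* mono (norm 0ℤ (+ y)) n)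
          (cong₂ H (res-u-2v 0 y) (res-u+v 0 y))))
        (Sq-extend (λ j → H₊ 0 j) {2} n B (s≤s z≤n) n≤B)

      zero-F : ∀ x y → H (res x) (res y) ≡ 0ℤ → F n x y ≡ 0ℤ
      zero-F x y e = trans (cong (_* mono (norm x y) B) e) (ℤP.*-zeroˡ (mono (norm x y) B))

      doubled : + 2 * SF ≡ + 2 * SG
      doubled = begin
        + 2 * SF ≡⟨ lem SF ⟨
        0ℤ + + 2 * (0ℤ + 0ℤ + SF) ≡⟨ cong₂ (λ p q → p + + 2 * (q + SF)) (sym (zero-F 0ℤ 0ℤ (zˡ (s≤s z≤n))))
          (sym (cong₂ _+_ (sumL-zero (pos B) (λ x _ → zero-F (+ x) 0ℤ (zʳ (res<12 (+ x)))))
                          (sumL-zero (pos B) (λ y _ → zero-F 0ℤ (+ y) (zˡ (res<12 (+ y))))))) ⟩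
        _ ≡⟨ sumℤ²-even B (F n) (F-even n) ⟨
        sumℤ² B (F n) ≡⟨ reindex n ⟩
        sumℤ² B (G n) ≡⟨ sumℤ²-even B (G n) (G-even n) ⟩
        G n 0ℤ 0ℤ + + 2 * SG ≡⟨ cong (_+ + 2 * SG) (trans (cong (_* mono 0 n) (zˡ (s≤s z≤n))) (ℤP.*-zeroˡ (mono 0 n)))
            ⟩
        0ℤ + + 2 * SG ≡⟨ ℤP.+-identityˡ _ ⟩
        + 2 * SG ∎
        where
        lem : ∀ s → 0ℤ + + 2 * (0ℤ + 0ℤ + s) ≡ + 2 * s
        lem = ℤRS.solve-∀

  -- Identities between functions of period 12 are settled by evaluating a decision procedure on all
  -- residues.
  below12 : {P : ℕ → Set} (P? : Decidable P) → {True (ℕP.allUpTo? P? 12)} → ∀ {i} → i < 12 → P i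
  below12 P? {w} = toWitness w

  below12² : {P : ℕ → ℕ → Set} (P? : ∀ i j → Dec (P i j)) →
    {True (ℕP.allUpTo? (λ i → ℕP.allUpTo? (P? i) 12) 12)} → ∀ {i} → i < 12 → ∀ {j} → j < 12 → P i j
  below12² P? {w} = toWitness w

  Sq-+ : ∀ a b m n → Sq (λ i → a i + b i) m n ≡ Sq a m n + Sq b m n
  Sq-+ a b m n = trans (sumL-cong (pos n) (λ x _ → ℤP.*-distribʳ-+ (mono (m ℕ.* (x ℕ.* x)) n) (a (x % 12))
      (b (x % 12))))
    (sumL-+ (pos n) _ _)

  sumL-∣- : ∀ {A : Set} {M} (xs : List A) {f g : A → ℤ} → (∀ x → x ∈ xs → M ∣ f x - g x) → M ∣ sumL xs f - sumL xs g
  sumL-∣- []       d = divides 0ℤ refl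
  sumL-∣- {M = M} (x ∷ xs) {f} {g} d = subst (M ∣_) (lem (f x) (g x) (sumL xs f) (sumL xs g))
    (Div.∣m∣n⇒∣m+n (d x (here refl)) (sumL-∣- xs (λ y y∈ → d y (there y∈))))
    where
    lem : ∀ a b c d → a - b + (c - d) ≡ a + c - (b + d)
    lem = ℤRS.solve-∀

  ∣-*-mono : ∀ {M} a b c → M ∣ a - b → M ∣ a * c - b * c
  ∣-*-mono {M} a b c d = subst (M ∣_) (lem a b c) (Div.∣m⇒∣m*n c d)
    where
    lem : ∀ a b c → (a - b) * c ≡ a * c - b * c
    lem = ℤRS.solve-∀

  Sq-cong-∣ : ∀ {M} a b m n → (∀ {i} → i < 12 → M ∣ a i - b i) → M ∣ Sq a m n - Sq b m n
  Sq-cong-∣ a b m n d = sumL-∣- (pos n) λ x _ → ∣-*-mono (a (x % 12)) (b (x % 12)) (mono (m ℕ.* (x ℕ.* x)) n)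
      (d (ℕD.m%n<n x 12))

  Sq-cong : ∀ a b m n → (∀ {i} → i < 12 → a i ≡ b i) → Sq a m n ≡ Sq b m n
  Sq-cong a b m n e = sumL-cong (pos n) λ x _ → cong (_* mono (m ℕ.* (x ℕ.* x)) n) (e (ℕD.m%n<n x 12))

  -- A term contributes only if x² + 2y² = n, and the class of x² + 2y² modulo 3 is determined by
  -- the residues modulo 12. Hence the weights have to agree only on residues compatible with n
  -- modulo 3.
  theta-cong-∣ : ∀ {M} B C C′ n →
    (∀ {i} → i < 12 → ∀ {j} → j < 12 → (1 ℕ.* (i ℕ.* i) ℕ.+ 2 ℕ.* (j ℕ.* j)) % 3 ≡ n % 3 → M ∣ C i j - C′ i j) →
    M ∣ theta B C n - theta B C′ n
  theta-cong-∣ {M} B C C′ n d = sumL-∣- (pos B) λ x _ → sumL-∣- (pos B) λ y _ → term x y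
    where
    N : ℕ → ℕ → ℕ
    N x y = 1 ℕ.* (x ℕ.* x) ℕ.+ 2 ℕ.* (y ℕ.* y)
    pos-N : ∀ x y → + N x y ≡ + x * + x + + 2 * (+ y * + y)
    pos-N x y = pos-norm (+ x) (+ y)
    residue : ∀ x y → N (x % 12) (y % 12) % 3 ≡ N x y % 3
    residue x y = %-cong-∣ 3 (N (x % 12) (y % 12)) (N x y)
        (divides (Q (+ (x % 12)) (+ (y % 12)) (+ (x ℕ./ 12)) (+ (y ℕ./ 12))) (begin
      + N (x % 12) (y % 12) - + N x y
        ≡⟨ cong₂ _-_ (pos-N (x % 12) (y % 12)) (trans (pos-N x y)
            (cong₂ (λ p q → p * p + + 2 * (q * q)) (pos-% 12 x) (pos-% 12 y))) ⟩
      _ ≡⟨ lem (+ (x % 12)) (+ (y % 12)) (+ (x ℕ./ 12)) (+ (y ℕ./ 12)) ⟩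
      _ ∎))
      where
      open ≡-Reasoning
      Q : ℤ → ℤ → ℤ → ℤ → ℤ
      Q r s p q = - (+ 8 * r * p) - + 48 * (p * p) - + 16 * s * q - + 96 * (q * q)
      lem : ∀ r s p q → r * r + + 2 * (s * s) - ((r + p * + 12) * (r + p * + 12) + + 2 *
          ((s + q * + 12) * (s + q * + 12)))
        ≡ (- (+ 8 * r * p) - + 48 * (p * p) - + 16 * s * q - + 96 * (q * q)) * + 3
      lem = ℤRS.solve-∀
    term : ∀ x y → M ∣ C (x % 12) (y % 12) * mono (N x y) n - C′ (x % 12) (y % 12) * mono (N x y) n
    term x y with N x y ℕ.≟ n
    ... | yes e = ∣-*-mono (C (x % 12) (y % 12)) (C′ (x % 12) (y % 12)) (mono (N x y) n)
                    (d (ℕD.m%n<n x 12) (ℕD.m%n<n y 12) (trans (residue x y) (cong (_% 3) e)))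
    ... | no ¬e = divides 0ℤ (trans (cong (λ z → C (x % 12) (y % 12) * z - C′ (x % 12) (y % 12) * z) (mono-≢ ¬e))
        (lem (C (x % 12) (y % 12)) (C′ (x % 12) (y % 12)) ))
      where
      lem : ∀ a b → a * 0ℤ - b * 0ℤ ≡ 0ℤ
      lem = ℤRS.solve-∀

  -- Dilated theta series, residue classes of exponents, and trisection

  Sq-stretch : ∀ d .{{_ : NonZero d}} a {m} n → 1 ≤ m → Sq a (d ℕ.* m) (n ℕ.* d) ≡ Sq a m n
  Sq-stretch d a {m} n 1≤m = trans (sumL-cong (pos (n ℕ.* d)) (λ x _ → cong (a (x % 12) *_)
      (mono-⇔ (d ℕ.* m ℕ.* (x ℕ.* x)) (n ℕ.* d) (m ℕ.* (x ℕ.* x)) n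
        (λ e → ℕP.*-cancelˡ-≡ _ _ d (trans (sym (ℕP.*-assoc d m (x ℕ.* x))) (trans e (ℕP.*-comm n d))))
        (λ e → trans (ℕP.*-assoc d m (x ℕ.* x)) (trans (cong (d ℕ.*_) e) (ℕP.*-comm d n))))))
    (Sq-extend a {m} n (n ℕ.* d) 1≤m (ℕP.m≤m*n n d))

  Sq-unrepresented : ∀ a m n → (∀ x → m ℕ.* (x ℕ.* x) ≢ n) → Sq a m n ≡ 0ℤ
  Sq-unrepresented a m n no-sol = sumL-zero (pos n) λ x _ →
    trans (cong (a (x % 12) *_) (mono-≢ (no-sol x))) (ℤP.*-zeroʳ (a (x % 12)))

  Sq-⊛-unrepresented : ∀ a b {m l} n → 1 ≤ m → 1 ≤ l → (∀ x y → m ℕ.* (x ℕ.* x) ℕ.+ l ℕ.* (y ℕ.* y) ≢ n) →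
      (Sq a m ⊛ Sq b l) n ≡ 0ℤ
  Sq-⊛-unrepresented a b n 1≤m 1≤l no-sol = trans (Sq-⊛ a b n n 1≤m 1≤l ℕP.≤-refl)
    (sumL-zero (pos n) λ x _ → sumL-zero (pos n) λ y _ →
      trans (cong (a (x % 12) * b (y % 12) *_) (mono-≢ (no-sol x y))) (ℤP.*-zeroʳ (a (x % 12) * b (y % 12))))

  -- Substitute x = k y. The condition k ∣ 12 makes divisibility of x by k visible in its residue
  -- modulo 12.
  Sq-dilate : ∀ k .{{_ : NonZero k}} a {m} n → k ℕDiv.∣ 12 → 1 ≤ m →
    (∀ {i} → i < 12 → i % k ≢ 0 → a i ≡ 0ℤ) →
    Sq a m n ≡ Sq (λ i → a ((k ℕ.* i) % 12)) (m ℕ.* (k ℕ.* k)) n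
  Sq-dilate k a {m} n k∣12 1≤m vanish = sumL-bijection ℕ._≟_ (pos-unique n) (pos-unique n) f g (ℕ._/ k) (k ℕ.*_) to
      from
    where
    f g : ℕ → ℤ
    f x = a (x % 12) * mono (m ℕ.* (x ℕ.* x)) n
    g y = a ((k ℕ.* (y % 12)) % 12) * mono (m ℕ.* (k ℕ.* k) ℕ.* (y ℕ.* y)) n
    fψ : ∀ y → f (k ℕ.* y) ≡ g y
    fψ y = cong₂ (λ r e → a r * mono e n) residue
      (trans (cong (m ℕ.*_) (ℕP.[m*n]*[o*p]≡[m*o]*[n*p] k y k y)) (sym (ℕP.*-assoc m (k ℕ.* k) (y ℕ.* y))))
      where
      residue : (k ℕ.* y) % 12 ≡ (k ℕ.* (y % 12)) % 12
      residue = trans (ℕD.%-distribˡ-* k y 12) (sym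
          (trans (ℕD.%-distribˡ-* k (y % 12) 12) (cong (λ r → ((k % 12) ℕ.* r) % 12) (ℕD.m%n%n≡m%n y 12))))
    k∣ : ∀ x → f x ≢ 0ℤ → k ℕDiv.∣ x
    k∣ x nz with x % k ℕ.≟ 0
    ... | yes e = ℕDiv.m%n≡0⇒n∣m x k e
    ... | no ¬e = contradiction (trans (cong (_* mono (m ℕ.* (x ℕ.* x)) n)
        (vanish (ℕD.m%n<n x 12) (λ e → ¬e (trans (sym (ℕD.m∣n⇒o%n%m≡o%m k 12 x k∣12)) e))))
                                 (ℤP.*-zeroˡ (mono (m ℕ.* (x ℕ.* x)) n))) nz
    to : ∀ x → x ∈ pos n → f x ≢ 0ℤ → x ℕ./ k ∈ pos n × k ℕ.* (x ℕ./ k) ≡ x × g (x ℕ./ k) ≡ f x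
    to x x∈ nz = ∈-pos⁺ n 1≤ (ℕP.≤-trans (ℕD.m/n≤m x k) (proj₂ (∈-pos⁻ n x∈))) , back , trans (sym (fψ (x ℕ./ k)))
        (cong f back)
      where
      back : k ℕ.* (x ℕ./ k) ≡ x
      back = ℕD.m*[n/m]≡n (k∣ x nz)
      1≤ : 1 ≤ x ℕ./ k
      1≤ with x ℕ./ k | back
      ... | zero  | e = contradiction (subst (1 ≤_) (trans (sym e) (ℕP.*-zeroʳ k)) (proj₁ (∈-pos⁻ n x∈))) λ ()
      ... | suc _ | _ = s≤s z≤n
    from : ∀ y → y ∈ pos n → g y ≢ 0ℤ → k ℕ.* y ∈ pos n × k ℕ.* y ℕ./ k ≡ y × f (k ℕ.* y) ≡ g y
    from y y∈ nz = ∈-pos⁺ n (ℕP.≤-trans (proj₁ (∈-pos⁻ n y∈)) (ℕP.m≤n*m y k))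
        (ℕP.≤-trans (m≤sq (k ℕ.* y) 1≤m) (ℕP.≤-reflexive
            (mono≢0 (a (k ℕ.* y % 12)) (m ℕ.* (k ℕ.* y ℕ.* (k ℕ.* y))) n (λ z → nz (trans (sym (fψ y)) z)))))
      , trans (cong (ℕ._/ k) (ℕP.*-comm k y)) (ℕD.m*n/n≡m y k) , fψ y

  Supp : (k : ℕ) .{{_ : NonZero k}} → ℕ → PS → Set
  Supp k r f = ∀ n → n % k ≢ r → f n ≡ 0ℤ

  Supp-⊕ : ∀ {k} .{{_ : NonZero k}} {r f g} → Supp k r f → Supp k r g → Supp k r (f ⊕ g)
  Supp-⊕ F G n h = cong₂ _+_ (F n h) (G n h)

  Supp-const : ∀ {k} .{{_ : NonZero k}} c → Supp k 0 (const c)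
  Supp-const {k} c zero    h = contradiction (ℕD.m*n%n≡0 0 k) h
  Supp-const c (suc n) h = refl

  Supp-⊖ : ∀ {k} .{{_ : NonZero k}} {r f} → Supp k r f → Supp k r (⊖ f)
  Supp-⊖ F n h = cong -_ (F n h)

  Supp-⊛ : ∀ {k} .{{_ : NonZero k}} {r q f g} → Supp k r f → Supp k q g → Supp k ((r ℕ.+ q) % k) (f ⊛ g)
  Supp-⊛ {k} {r} {q} {f} {g} F G n h = sumTo-zero n term
    where
    term : ∀ i → i ≤ n → f i * g (n ∸ i) ≡ 0ℤ
    term i i≤n with i % k ℕ.≟ r | (n ∸ i) % k ℕ.≟ q
    ... | no ¬e | _     = trans (cong (_* g (n ∸ i)) (F i ¬e)) (ℤP.*-zeroˡ (g (n ∸ i)))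
    ... | yes _ | no ¬e = trans (cong (f i *_) (G (n ∸ i) ¬e)) (ℤP.*-zeroʳ (f i))
    ... | yes e | yes e′ = contradiction (trans (cong (_% k) (sym (ℕP.m+[n∸m]≡n i≤n)))
          (trans (ℕD.%-distribˡ-+ i (n ∸ i) k) (cong₂ (λ x y → (x ℕ.+ y) % k) e e′))) h

  Supp-Sq : ∀ k .{{_ : NonZero k}} {r} a m → k ℕDiv.∣ 12 →
    (∀ {i} → i < 12 → (m ℕ.* (i ℕ.* i)) % k ≢ r → a i ≡ 0ℤ) → Supp k r (Sq a m)
  Supp-Sq k {r} a m k∣12 vanish n h = sumL-zero (pos n) λ x _ → term x
    where
    residue : ∀ x → (m ℕ.* (x % 12 ℕ.* (x % 12))) % k ≡ (m ℕ.* (x ℕ.* x)) % k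
    residue x = begin
      (m ℕ.* (x % 12 ℕ.* (x % 12))) % k ≡⟨ ℕD.m∣n⇒o%n%m≡o%m k 12 (m ℕ.* (x % 12 ℕ.* (x % 12))) k∣12 ⟨
      (m ℕ.* (x % 12 ℕ.* (x % 12))) % 12 % k ≡⟨ cong (_% k) (trans (ℕD.%-distribˡ-* m (x % 12 ℕ.* (x % 12)) 12)
          (trans (cong (λ z → (m % 12 ℕ.* z) % 12) (sym (ℕD.%-distribˡ-* x x 12)))
              (sym (ℕD.%-distribˡ-* m (x ℕ.* x) 12)))) ⟩
      (m ℕ.* (x ℕ.* x)) % 12 % k ≡⟨ ℕD.m∣n⇒o%n%m≡o%m k 12 (m ℕ.* (x ℕ.* x)) k∣12 ⟩
      (m ℕ.* (x ℕ.* x)) % k ∎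
      where open ≡-Reasoning
    term : ∀ x → a (x % 12) * mono (m ℕ.* (x ℕ.* x)) n ≡ 0ℤ
    term x with m ℕ.* (x ℕ.* x) ℕ.≟ n
    ... | no ¬e = trans (cong (a (x % 12) *_) (mono-≢ ¬e)) (ℤP.*-zeroʳ (a (x % 12)))
    ... | yes e = trans (cong (_* mono (m ℕ.* (x ℕ.* x)) n)
        (vanish (ℕD.m%n<n x 12) (λ e′ → h (trans (cong (_% k) (sym e)) (trans (sym (residue x)) e′)))))
                    (ℤP.*-zeroˡ (mono (m ℕ.* (x ℕ.* x)) n))

  U : PS → PS
  U f n = f (n ℕ.* 3)

  -- This is U (h(q³) f(q)) = h(q) U f(q). The induction removes three coefficients of `g` at a
  -- time, the second and third of which are zero.
  U-⊛ : ∀ f g → Supp 3 0 g → ∀ n → U (g ⊛ f) n ≡ (U g ⊛ U f) n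
  U-⊛ f g G zero    = refl
  U-⊛ f g G (suc n) = begin
    (g ⊛ f) (3 ℕ.+ N)
      ≡⟨ ⊛-suc g f (2 ℕ.+ N) ⟩
    g 0 * f (3 ℕ.+ N) + (tail g ⊛ f) (2 ℕ.+ N)
      ≡⟨ cong (_+_ (g 0 * f (3 ℕ.+ N))) (skip (tail g) (1 ℕ.+ N) (G 1 λ ())) ⟩
    g 0 * f (3 ℕ.+ N) + (tail (tail g) ⊛ f) (1 ℕ.+ N)
      ≡⟨ cong (_+_ (g 0 * f (3 ℕ.+ N))) (skip (tail (tail g)) N (G 2 λ ())) ⟩
    g 0 * f (3 ℕ.+ N) + (tail (tail (tail g)) ⊛ f) N
      ≡⟨ cong (_+_ (g 0 * f (3 ℕ.+ N))) (U-⊛ f (tail (tail (tail g))) G′ n) ⟩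
    g 0 * f (3 ℕ.+ N) + (tail (U g) ⊛ U f) n
      ≡⟨ ⊛-suc (U g) (U f) n ⟨
    (U g ⊛ U f) (suc n) ∎
    where
    open ≡-Reasoning
    N = n ℕ.* 3
    skip : ∀ h k → h 0 ≡ 0ℤ → (h ⊛ f) (suc k) ≡ (tail h ⊛ f) k
    skip h k e = trans (⊛-suc h f k) (trans (cong (λ z → z * f (suc k) + (tail h ⊛ f) k) e)
      (trans (cong (_+ (tail h ⊛ f) k) (ℤP.*-zeroˡ (f (suc k)))) (ℤP.+-identityˡ _)))
    G′ : Supp 3 0 (tail (tail (tail g)))
    G′ k h = G (3 ℕ.+ k) (λ e → h (trans (sym (trans (cong (_% 3) (ℕP.+-comm 3 k)) (ℕD.[m+n]%n≡m%n k 3))) e))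

  -- Characters modulo 12 and their behaviour under 1 + √-2

  𝟙 χs χo χx χy χe χ₃ σ : ℕ → ℤ
  𝟙 _  = 1ℤ
  χ₃ i = if i % 3 ≡ᵇ 0 then 1ℤ else 0ℤ
  χs i = 1ℤ - χ₃ i
  χo i = + (i % 2)
  χx i = χs i * χo i
  χe i = χs i * (1ℤ - χo i)
  χy i = if (i ≡ᵇ 5) ∨ (i ≡ᵇ 7) then 1ℤ else 0ℤ
  σ i  = 1ℤ - + 2 * χo i

  ≡mod3 : ℕ → ℕ → ℤ
  ≡mod3 i j = if i % 3 ≡ᵇ j % 3 then 1ℤ else 0ℤ

  -- When x and y are prime to 3, exactly one choice of sign gives x ≡ ±y modulo 3. Keeping only x ≡
  -- y therefore selects one of (x, y) and (x, -y), as `quad` demands for characters vanishing at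
  -- multiples of 3.
  diag : (ℕ → ℤ) → (ℕ → ℤ) → ℕ → ℕ → ℤ
  diag a b i j = a i * b j * ≡mod3 i j

  diag-supp : ∀ a b i j → diag a b i j ≢ 0ℤ → (+ 3) ∣ + j - + i
  diag-supp a b i j nz with i % 3 ≡ᵇ j % 3 in eq
  ... | true  = %-≡⇒∣ 3 j i (sym (ℕP.≡ᵇ⇒≡ (i % 3) (j % 3) (subst Data.Bool.T (sym eq) tt)))
  ... | false = contradiction (ℤP.*-zeroʳ (a i * b j)) nz

  module L (a b : ℕ → ℤ)
    (even : ∀ {i} → i < 12 → ∀ {j} → j < 12 → diag a b ((12 ∸ i) % 12) ((12 ∸ j) % 12) ≡ diag a b i j)
    (zˡ : ∀ {j} → j < 12 → diag a b 0 j ≡ 0ℤ) (zʳ : ∀ {i} → i < 12 → diag a b i 0 ≡ 0ℤ)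
    (quad : ∀ {i} → i < 12 → ∀ {j} → j < 12 → diag a b i j + diag a b i ((12 ∸ j) % 12) ≡ a i * b j)
    where
    open Lattice (diag a b) even (diag-supp a b) public

    -- Modulo `M` the weight `H₊ + H₋` can factor even if it does not over ℤ; the sum over the
    -- lattice then becomes a product of two theta series again.
    lattice-∣ : ∀ M c₁ c₂ c d n →
      (∀ {i} → i < 12 → M ∣ H₊ i 0 - c₁ i) →
      (∀ {j} → j < 12 → M ∣ H₊ 0 j - c₂ j) →
      (∀ {i} → i < 12 → ∀ {j} → j < 12 → (1 ℕ.* (i ℕ.* i) ℕ.+ 2 ℕ.* (j ℕ.* j)) % 3 ≡ n % 3 → M ∣ H₊ i j + H₋ i j - c i
          * d j) →
      M ∣ U (Sq a 1 ⊛ Sq b 2) n - (Sq c₁ 1 n + Sq c₂ 2 n + (Sq c 1 ⊛ Sq d 2) n)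
    lattice-∣ M c₁ c₂ c d n e₁ e₂ e = subst (M ∣_) eq (Div.∣m∣n⇒∣m+n
        (Div.∣m∣n⇒∣m+n (Sq-cong-∣ (λ i → H₊ i 0) c₁ 1 n e₁) (Sq-cong-∣ (λ j → H₊ 0 j) c₂ 2 n e₂))
        (theta-cong-∣ (n ℕ.* 3) (λ i j → H₊ i j + H₋ i j) (λ i j → c i * d j) n e))
      where
      lem : ∀ p p′ q q′ r r′ → p - p′ + (q - q′) + (r - r′) ≡ p + q + r - (p′ + q′ + r′)
      lem = ℤRS.solve-∀
      eq = trans (lem (Sq (λ i → H₊ i 0) 1 n) (Sq c₁ 1 n) (Sq (λ j → H₊ 0 j) 2 n) (Sq c₂ 2 n)
                      (theta (n ℕ.* 3) (λ i j → H₊ i j + H₋ i j) n) (theta (n ℕ.* 3) (λ i j → c i * d j) n))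
        (cong₂ _-_ (sym (lattice a b zˡ zʳ quad n))
          (cong (_+_ (Sq c₁ 1 n + Sq c₂ 2 n)) (sym (Sq-⊛ c d {1} {2} n (n ℕ.* 3) (s≤s z≤n) (s≤s z≤n)
              (ℕP.m≤m*n n 3)))))

  module _ (a b : ℕ → ℤ) where
    even? : ∀ i j → Dec (diag a b ((12 ∸ i) % 12) ((12 ∸ j) % 12) ≡ diag a b i j)
    even? i j = diag a b ((12 ∸ i) % 12) ((12 ∸ j) % 12) ℤ.≟ diag a b i j

    zˡ? : ∀ j → Dec (diag a b 0 j ≡ 0ℤ)
    zˡ? j = diag a b 0 j ℤ.≟ 0ℤ

    zʳ? : ∀ i → Dec (diag a b i 0 ≡ 0ℤ)
    zʳ? i = diag a b i 0 ℤ.≟ 0ℤ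

    quad? : ∀ i j → Dec (diag a b i j + diag a b i ((12 ∸ j) % 12) ≡ a i * b j)
    quad? i j = diag a b i j + diag a b i ((12 ∸ j) % 12) ℤ.≟ a i * b j

  _≡?_[mod_] : (f g : ℕ → ℤ) → ∀ M i → Dec (M ∣ f i - g i)
  (f ≡? g [mod M ]) i = M Div.∣? (f i - g i)

  module Lss = L χs χs (below12² (even? χs χs)) (below12 (zˡ? χs χs)) (below12 (zʳ? χs χs)) (below12² (quad? χs χs))
  module Lxx = L χx χx (below12² (even? χx χx)) (below12 (zˡ? χx χx)) (below12 (zʳ? χx χx)) (below12² (quad? χx χx))
  module Lyx = L χy χx (below12² (even? χy χx)) (below12 (zˡ? χy χx)) (below12 (zʳ? χy χx)) (below12² (quad? χy χx))

  -- Since u - 2v ≡ u + v modulo 3, the weight counts which of u + v and u - v are prime to 3. That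
  -- is one of them if 3 ∤ uv, both or neither otherwise.
  U-ss : ∀ n → (+ 2) ∣ U (Sq χs 1 ⊛ Sq χs 2) n - (Sq χs 1 n + Sq χs 2 n + (Sq χs 1 ⊛ Sq χs 2) n)
  U-ss n = Lss.lattice-∣ (+ 2) χs χs χs χs n
    (below12 ((λ i → Lss.H₊ i 0) ≡? χs [mod + 2 ])) (below12 ((λ j → Lss.H₊ 0 j) ≡? χs [mod + 2 ]))
    (λ i<12 j<12 _ → below12² (λ i j → (+ 2) Div.∣? (Lss.H₊ i j + Lss.H₋ i j - χs i * χs j)) i<12 j<12)

  -- Oddness of u - 2v and u + v means u odd and v even. This turns the second character into `χe`
  -- and removes the axis u = 0.
  U-xx : ∀ n → (+ 2) ∣ U (Sq χx 1 ⊛ Sq χx 2) n - (Sq χx 1 n + Sq (λ _ → 0ℤ) 2 n + (Sq χx 1 ⊛ Sq χe 2) n)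
  U-xx n = Lxx.lattice-∣ (+ 2) χx (λ _ → 0ℤ) χx χe n
    (below12 ((λ i → Lxx.H₊ i 0) ≡? χx [mod + 2 ])) (below12 ((λ j → Lxx.H₊ 0 j) ≡? (λ _ → 0ℤ) [mod + 2 ]))
    (λ i<12 j<12 _ → below12² (λ i j → (+ 2) Div.∣? (Lxx.H₊ i j + Lxx.H₋ i j - χx i * χe j)) i<12 j<12)

  -- Again u is odd and v even. If 3 ∤ v, then 2v ≡ ±4 modulo 12, and exactly one of u + 2v and u -
  -- 2v is ±5 modulo 12 unless u itself is, in which case neither is; this gives `χo + χy`. If 3 ∣
  -- v, both signs have equal weight and cancel modulo 2.
  U-yx : ∀ n → (+ 2) ∣ U (Sq χy 1 ⊛ Sq χx 2) n -
      (Sq χy 1 n + Sq (λ _ → 0ℤ) 2 n + (Sq (λ i → χo i + χy i) 1 ⊛ Sq χe 2) n)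
  U-yx n = Lyx.lattice-∣ (+ 2) χy (λ _ → 0ℤ) (λ i → χo i + χy i) χe n
    (below12 ((λ i → Lyx.H₊ i 0) ≡? χy [mod + 2 ])) (below12 ((λ j → Lyx.H₊ 0 j) ≡? (λ _ → 0ℤ) [mod + 2 ]))
    (λ i<12 j<12 _ → below12² (λ i j → (+ 2) Div.∣? (Lyx.H₊ i j + Lyx.H₋ i j - (χo i + χy i) * χe j)) i<12 j<12)

  module M₂ = Mod (+ 2) (λ _ → ⊤) (λ _ p → p)

  -- Theta series in characteristic 2

  module CharacteristicTwo where

    open M₂ using (_≋_; mk; at; ≋-refl; ≋-sym; ≋-trans; ⊕-cong; ⊛-cong; ≗⇒≋)

    -- With coefficients in the field of two elements the solver knows 1 + 1 = 0, on which the
    -- polynomial identities below rely.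
    𝔽₂ : RawRing 0ℓ 0ℓ
    𝔽₂ = record { Carrier = Bool ; _≈_ = _≡_ ; _+_ = _xor_ ; _*_ = _∧_ ; -_ = λ b → b ; 0# = false ; 1# = true }

    ⌜_⌝ : Bool → PS
    ⌜ true ⌝  = const 1ℤ
    ⌜ false ⌝ = const 0ℤ

    private
      even-const : ∀ k → const (+ 2 * k) ≋ const 0ℤ
      even-const k = mk λ { zero _ → divides k (lem k) ; (suc n) _ → divides 0ℤ refl }
        where
        lem : ∀ k → + 2 * k - 0ℤ ≡ k * + 2
        lem = ℤRS.solve-∀

      ⌜⌝-+ : ∀ a b → ⌜ a xor b ⌝ ≋ ⌜ a ⌝ ⊕ ⌜ b ⌝
      ⌜⌝-+ false b     = ≗⇒≋ λ n → sym (trans (cong (_+ ⌜ b ⌝ n) (const-0 n)) (ℤP.+-identityˡ _))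
      ⌜⌝-+ true  false = ≗⇒≋ λ n → sym (trans (cong (_+_ (const 1ℤ n)) (const-0 n)) (ℤP.+-identityʳ _))
      ⌜⌝-+ true  true  = ≋-trans (≋-sym (even-const 1ℤ)) (≗⇒≋ (const-+ 1ℤ 1ℤ))

      ⌜⌝-* : ∀ a b → ⌜ a ∧ b ⌝ ≋ ⌜ a ⌝ ⊛ ⌜ b ⌝
      ⌜⌝-* false false = ≗⇒≋ (const-* 0ℤ 0ℤ)
      ⌜⌝-* false true  = ≗⇒≋ (const-* 0ℤ 1ℤ)
      ⌜⌝-* true  false = ≗⇒≋ (const-* 1ℤ 0ℤ)
      ⌜⌝-* true  true  = ≗⇒≋ (const-* 1ℤ 1ℤ)

      ⌜⌝-neg : ∀ a → ⌜ a ⌝ ≋ ⊖ ⌜ a ⌝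
      ⌜⌝-neg false = ≗⇒≋ (const-neg 0ℤ)
      ⌜⌝-neg true  = mk λ { zero _ → divides 1ℤ refl ; (suc n) _ → divides 0ℤ refl }

    𝔽₂-morphism : 𝔽₂ -Raw-AlmostCommutative⟶ M₂.almostRing
    𝔽₂-morphism = record
        { ⟦_⟧ = ⌜_⌝ ; +-homo = ⌜⌝-+ ; *-homo = ⌜⌝-* ; -‿homo = ⌜⌝-neg ; 0-homo = ≋-refl ; 1-homo = ≗⇒≋
            (λ n → sym (one≗const n)) }

    𝔽₂≟ : ∀ a b → Maybe (⌜ a ⌝ ≋ ⌜ b ⌝)
    𝔽₂≟ false false = just ≋-refl
    𝔽₂≟ true  true  = just ≋-refl
    𝔽₂≟ _     _     = nothing

    open RingSolver 𝔽₂ M₂.almostRing 𝔽₂-morphism 𝔽₂≟ using (solve; _:=_; _:+_; _:*_; con; Polynomial)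

    square : PS → PS
    square f = f ⊛ f

    -- Write f = f(0) + q · `tail f`; the cross term of f² is twice f(0) q · `tail f`.
    square-shift : ∀ f n → (+ 2) ∣ square f (suc (suc n)) - square (tail f) n
    square-shift f n = divides (f 0 * f (suc (suc n))) (begin
      square f (suc (suc n)) - square (tail f) n
        ≡⟨ cong (_- square (tail f) n) (trans (⊛-suc f f (suc n))
            (cong (_+_ (f 0 * f (suc (suc n)))) (⊛-sucʳ (tail f) f n))) ⟩
      f 0 * f (suc (suc n)) + (square (tail f) n + f (suc (suc n)) * f 0) - square (tail f) n
        ≡⟨ lem (f 0) (f (suc (suc n))) (square (tail f) n) ⟩
      f 0 * f (suc (suc n)) * + 2 ∎)
      where
      open ≡-Reasoning
      lem : ∀ a b c → a * b + (c + b * a) - c ≡ a * b * + 2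
      lem = ℤRS.solve-∀

    ∣-trans-minus : ∀ {M} a b c → M ∣ a - b → M ∣ b - c → M ∣ a - c
    ∣-trans-minus {M} a b c d e = subst (M ∣_) (lem a b c) (Div.∣m∣n⇒∣m+n d e)
      where
      lem : ∀ a b c → a - b + (b - c) ≡ a - c
      lem = ℤRS.solve-∀

    even-or-odd : ∀ n → (∃ λ k → n ≡ k ℕ.* 2) ⊎ (∃ λ k → n ≡ suc (k ℕ.* 2))
    even-or-odd zero = inj₁ (0 , refl)
    even-or-odd (suc n) with even-or-odd n
    ... | inj₁ (k , refl) = inj₂ (k , refl)
    ... | inj₂ (k , refl) = inj₁ (suc k , refl)

    2∣z²-z : ∀ z → (+ 2) ∣ z * z - z
    2∣z²-z z with even-or-odd (z %ℕ 2) | ℤD.n%ℕd<d z 2 | ℤD.a≡a%ℕn+[a/ℕn]*n z 2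
    ... | inj₁ (zero , e)  | _ | z≡ rewrite e = divides (+ 2 * q * q - q) (trans (cong (λ w → w * w - w) z≡) (lem q))
      where
      q = z ℤD./ℕ 2
      lem : ∀ q → (0ℤ + q * + 2) * (0ℤ + q * + 2) - (0ℤ + q * + 2) ≡ (+ 2 * q * q - q) * + 2
      lem = ℤRS.solve-∀
    ... | inj₁ (suc k , e) | h | _ rewrite e = contradiction h λ { (s≤s (s≤s ())) }
    ... | inj₂ (zero , e)  | _ | z≡ rewrite e = divides (+ 2 * q * q + q) (trans (cong (λ w → w * w - w) z≡) (lem q))
      where
      q = z ℤD./ℕ 2
      lem : ∀ q → (1ℤ + q * + 2) * (1ℤ + q * + 2) - (1ℤ + q * + 2) ≡ (+ 2 * q * q + q) * + 2
      lem = ℤRS.solve-∀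
    ... | inj₂ (suc k , e) | h | _ rewrite e = contradiction h λ { (s≤s (s≤s ())) }

    square-even : ∀ f k → (+ 2) ∣ square f (k ℕ.* 2) - f k
    square-even f zero    = 2∣z²-z (f 0)
    square-even f (suc k) = ∣-trans-minus (square f (suc (suc (k ℕ.* 2)))) (square (tail f) (k ℕ.* 2)) (f (suc k))
      (square-shift f (k ℕ.* 2)) (square-even (tail f) k)

    square-odd : ∀ f k → (+ 2) ∣ square f (suc (k ℕ.* 2))
    square-odd f zero    = divides (f 0 * f 1) (lem (f 0) (f 1))
      where
      lem : ∀ a b → a * b + b * a ≡ a * b * + 2
      lem = ℤRS.solve-∀
    square-odd f (suc k) = subst ((+ 2) ∣_) (lem (square f (suc (suc (suc (k ℕ.* 2)))))
        (square (tail f) (suc (k ℕ.* 2))))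
      (Div.∣m∣n⇒∣m+n (square-shift f (suc (k ℕ.* 2))) (square-odd (tail f) k))
      where
      lem : ∀ a b → a - b + b ≡ a
      lem = ℤRS.solve-∀

    2m≢1+2k : ∀ m k → m ℕ.* 2 ≢ suc (k ℕ.* 2)
    2m≢1+2k (suc m) (suc k) e = 2m≢1+2k m k (ℕP.suc-injective (ℕP.suc-injective e))

    -- Replacing m by 2m substitutes q² for q. Modulo 2 this is squaring, because cross terms come
    -- in pairs and z² ≡ z.
    frobenius : ∀ a {m} → 1 ≤ m → Sq a (2 ℕ.* m) ≋ square (Sq a m)
    frobenius a {m} 1≤m = mk λ n _ → go n (even-or-odd n)
      where
      go : ∀ n → (∃ λ k → n ≡ k ℕ.* 2) ⊎ (∃ λ k → n ≡ suc (k ℕ.* 2)) → (+ 2) ∣ Sq a (2 ℕ.* m) n - square (Sq a m) n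
      go _ (inj₁ (k , refl)) = subst (λ z → (+ 2) ∣ z - square (Sq a m) (k ℕ.* 2)) (sym (Sq-stretch 2 a k 1≤m))
        (subst ((+ 2) ∣_) (lem (square (Sq a m) (k ℕ.* 2)) (Sq a m k)) (Div.∣m⇒∣-m (square-even (Sq a m) k)))
        where
        lem : ∀ a b → - (a - b) ≡ b - a
        lem = ℤRS.solve-∀
      go _ (inj₂ (k , refl)) = subst (λ z → (+ 2) ∣ z - square (Sq a m) (suc (k ℕ.* 2)))
        (sym (Sq-unrepresented a (2 ℕ.* m) _ λ x e → 2m≢1+2k (m ℕ.* (x ℕ.* x)) k
          (trans (trans (ℕP.*-comm (m ℕ.* (x ℕ.* x)) 2) (sym (ℕP.*-assoc 2 m (x ℕ.* x)))) e)))
        (subst ((+ 2) ∣_) (sym (ℤP.+-identityˡ (- square (Sq a m) (suc (k ℕ.* 2)))))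
            (Div.∣m⇒∣-m (square-odd (Sq a m) k)))

    s X Y t : PS
    s = Sq χs 1
    X = Sq χx 1
    Y = Sq χy 1
    A O : ℕ → PS
    A m = Sq 𝟙 m
    O m = Sq χo m
    t = A 3 ⊕ A 9

    Sq-χe : ∀ {m} n → 1 ≤ m → Sq χe m n ≡ Sq χs (m ℕ.* 4) n
    Sq-χe {m} n 1≤m = trans (Sq-dilate 2 χe n (ℕDiv.divides 6 refl) 1≤m
        (below12 (λ i → ¬? (i % 2 ℕ.≟ 0) →-dec χe i ℤ.≟ 0ℤ)))
      (Sq-cong (λ i → χe ((2 ℕ.* i) % 12)) χs (m ℕ.* 4) n (below12 (λ i → χe ((2 ℕ.* i) % 12) ℤ.≟ χs i)))

    χ₃o : ℕ → ℤ
    χ₃o i = χ₃ i * χo i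

    Sq-χ₃ : ∀ {m} n → 1 ≤ m → Sq χ₃ m n ≡ A (m ℕ.* 9) n
    Sq-χ₃ {m} n 1≤m = trans (Sq-dilate 3 χ₃ n (ℕDiv.divides 4 refl) 1≤m
        (below12 (λ i → ¬? (i % 3 ℕ.≟ 0) →-dec χ₃ i ℤ.≟ 0ℤ)))
      (Sq-cong (λ i → χ₃ ((3 ℕ.* i) % 12)) 𝟙 (m ℕ.* 9) n (below12 (λ i → χ₃ ((3 ℕ.* i) % 12) ℤ.≟ 𝟙 i)))

    Sq-χ₃o : ∀ {m} n → 1 ≤ m → Sq χ₃o m n ≡ O (m ℕ.* 9) n
    Sq-χ₃o {m} n 1≤m = trans (Sq-dilate 3 χ₃o n (ℕDiv.divides 4 refl) 1≤m
        (below12 (λ i → ¬? (i % 3 ℕ.≟ 0) →-dec χ₃o i ℤ.≟ 0ℤ)))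
      (Sq-cong (λ i → χ₃o ((3 ℕ.* i) % 12)) χo (m ℕ.* 9) n (below12 (λ i → χ₃o ((3 ℕ.* i) % 12) ℤ.≟ χo i)))

    Sq-even : ∀ {m} n → 1 ≤ m → Sq (λ i → 1ℤ - χo i) m n ≡ A (m ℕ.* 4) n
    Sq-even {m} n 1≤m = trans (Sq-dilate 2 (λ i → 1ℤ - χo i) n (ℕDiv.divides 6 refl) 1≤m
        (below12 (λ i → ¬? (i % 2 ℕ.≟ 0) →-dec 1ℤ - χo i ℤ.≟ 0ℤ)))
      (Sq-cong (λ i → 1ℤ - χo ((2 ℕ.* i) % 12)) 𝟙 (m ℕ.* 4) n (below12 (λ i → 1ℤ - χo ((2 ℕ.* i) % 12) ℤ.≟ 𝟙 i)))

    split : ∀ a b c m n → (∀ {i} → i < 12 → a i ≡ b i + c i) → Sq a m n ≡ Sq b m n + Sq c m n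
    split a b c m n e = trans (Sq-cong a (λ i → b i + c i) m n e) (Sq-+ b c m n)

    s-split : ∀ n → s n ≡ X n + Sq χs 4 n
    s-split n = trans (split χs χx χe 1 n (below12 (λ i → χs i ℤ.≟ χx i + χe i)))
        (cong (_+_ (X n)) (Sq-χe {1} n (s≤s z≤n)))

    A-split₃ : ∀ {m} n → 1 ≤ m → A m n ≡ Sq χs m n + A (m ℕ.* 9) n
    A-split₃ {m} n 1≤m = trans (split 𝟙 χs χ₃ m n (below12 (λ i → 𝟙 i ℤ.≟ χs i + χ₃ i)))
        (cong (_+_ (Sq χs m n)) (Sq-χ₃ n 1≤m))

    A-split₂ : ∀ {m} n → 1 ≤ m → A m n ≡ O m n + A (m ℕ.* 4) n
    A-split₂ {m} n 1≤m = trans (split 𝟙 χo (λ i → 1ℤ - χo i) m n (below12 (λ i → 𝟙 i ℤ.≟ χo i + (1ℤ - χo i))))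
        (cong (_+_ (O m n)) (Sq-even n 1≤m))

    O-split : ∀ {m} n → 1 ≤ m → O m n ≡ Sq χx m n + O (m ℕ.* 9) n
    O-split {m} n 1≤m = trans (split χo χx χ₃o m n (below12 (λ i → χo i ℤ.≟ χx i + χ₃o i)))
        (cong (_+_ (Sq χx m n)) (Sq-χ₃o n 1≤m))

    1≤ : ∀ {n} → 1 ≤ suc n
    1≤ = s≤s z≤n

    _⁴ _⁸ : PS → PS
    f ⁴ = square (square f)
    f ⁸ = square (f ⁴)

    square-cong : ∀ {f g} → f ≋ g → square f ≋ square g
    square-cong e = ⊛-cong e e

    frobenius⁴ : ∀ a {m} → 1 ≤ m → Sq a (2 ℕ.* (2 ℕ.* m)) ≋ (Sq a m) ⁴
    frobenius⁴ a {m} 1≤m = ≋-trans (frobenius a (ℕP.≤-trans 1≤m (ℕP.m≤n*m m 2))) (square-cong (frobenius a 1≤m))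

    s⁸ : Sq χs 8 ≋ s ⁸
    s⁸ = ≋-trans (frobenius χs {4} 1≤) (square-cong (frobenius⁴ χs {1} 1≤))

    s≋ : s ≋ X ⊕ s ⁴
    s≋ = ≋-trans (≗⇒≋ s-split) (⊕-cong (≋-refl {X}) (frobenius⁴ χs {1} 1≤))

    X≋ : X ≋ s ⊕ s ⁴
    X≋ = ≋-trans (solve 2 (λ x s → x := (x :+ ((s :* s) :* (s :* s))) :+ ((s :* s) :* (s :* s))) ≋-refl X s)
      (⊕-cong (≋-sym s≋) ≋-refl)

    A₁≋ : A 1 ≋ s ⊕ A 9
    A₁≋ = ≗⇒≋ (λ n → A-split₃ {1} n 1≤)

    -- In A(q^m) the even x contribute A(q^(4m)), which is A(q^m)⁴ modulo 2; the odd x remain.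
    t⊕t⁴≋ : t ⊕ t ⁴ ≋ O 3 ⊕ O 9
    t⊕t⁴≋ = begin
      t ⊕ t ⁴
        ≈⟨ solve 2 (λ a c → (a :+ c) :+ q⁴ (a :+ c) := (a :+ q⁴ a) :+ (c :+ q⁴ c)) ≋-refl (A 3) (A 9) ⟩
      (A 3 ⊕ A 3 ⁴) ⊕ (A 9 ⊕ A 9 ⁴)
        ≈⟨ ⊕-cong (step 3 1≤) (step 9 1≤) ⟩
      O 3 ⊕ O 9 ∎
      where
      open SetoidReasoning M₂.R.setoid
      q⁴ = λ z → (z :* z) :* (z :* z)
      A₄≋ : ∀ m → 1 ≤ m → A (m ℕ.* 4) ≋ A m ⁴
      A₄≋ m 1≤m = ≋-trans (≗⇒≋ (λ n → cong (λ k → A k n) (trans (ℕP.*-comm m 4) (ℕP.*-assoc 2 2 m))))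
          (frobenius⁴ 𝟙 1≤m)
      A≋ : ∀ m → 1 ≤ m → A m ≋ O m ⊕ A (m ℕ.* 4)
      A≋ m 1≤m = ≗⇒≋ (λ n → A-split₂ {m} n 1≤m)
      step : ∀ m → 1 ≤ m → A m ⊕ A m ⁴ ≋ O m
      step m 1≤m = begin
        A m ⊕ A m ⁴                  ≈⟨ ⊕-cong (A≋ m 1≤m) (≋-refl {A m ⁴}) ⟩
        (O m ⊕ A (m ℕ.* 4)) ⊕ A m ⁴  ≈⟨ ⊕-cong (⊕-cong (≋-refl {O m}) (A₄≋ m 1≤m)) (≋-refl {A m ⁴}) ⟩
        (O m ⊕ A m ⁴) ⊕ A m ⁴        ≈⟨ solve 2 (λ o a → (o :+ q⁴ a) :+ q⁴ a := o) ≋-refl (O m) (A m) ⟩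
        O m                          ∎

    U-cong : ∀ {f g} → f ≋ g → U f ≋ U g
    U-cong e = mk λ n _ → at e (n ℕ.* 3) tt

    U-⊛≋ : ∀ f g → Supp 3 0 g → U (f ⊛ g) ≋ U f ⊛ U g
    U-⊛≋ f g G = ≗⇒≋ λ n → trans (⊛-comm f g (n ℕ.* 3)) (trans (U-⊛ f g G n) (⊛-comm (U g) (U f) n))

    -- A series in q³ that is invariant under q³ ↦ q is constant.
    U-invariant⇒0 : ∀ Z → Supp 3 0 Z → U Z ≋ Z → (+ 2) ∣ Z 0 → ∀ n → (+ 2) ∣ Z n
    U-invariant⇒0 Z supp inv Z₀ = <-rec _ step
      where
      lem : ∀ a b → a - (a - b) ≡ b
      lem = ℤRS.solve-∀
      step : ∀ n → (∀ {k} → k < n → (+ 2) ∣ Z k) → (+ 2) ∣ Z n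
      step zero    ih = Z₀
      step n@(suc _) ih with n % 3 ℕ.≟ 0
      ... | no ¬e = divides 0ℤ (supp n ¬e)
      ... | yes e with ℕDiv.m%n≡0⇒n∣m n 3 e
      ...   | ℕDiv.divides (suc k) refl = subst ((+ 2) ∣_) (lem′ (Z (suc k ℕ.* 3)) (Z (suc k)))
                (Div.∣m∣n⇒∣m+n (at inv (suc k) tt) (ih (ℕP.m<m*n (suc k) 3 (s≤s (s≤s z≤n)))))
        where
        lem′ : ∀ a b → a - b + b ≡ a
        lem′ = ℤRS.solve-∀

    ≋0⇒≋ : ∀ {f g} → (∀ n → (+ 2) ∣ (f ⊕ g) n) → f ≋ g
    ≋0⇒≋ {f} {g} e = mk λ n _ → subst ((+ 2) ∣_) (lem (f n) (g n))
        (Div.∣m∣n⇒∣m-n (e n) (Div.∣m⇒∣m*n (g n) (Div.∣-refl {+ 2})))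
      where
      lem : ∀ f g → f + g - + 2 * g ≡ f - g
      lem = ℤRS.solve-∀

    sq : ∀ {n} → Polynomial n → Polynomial n
    sq p = p :* p

    s-supp : Supp 3 1 s
    s-supp = Supp-Sq 3 χs 1 (ℕDiv.divides 4 refl) (below12 (λ i → ¬? ((1 ℕ.* (i ℕ.* i)) % 3 ℕ.≟ 1) →-dec χs i ℤ.≟ 0ℤ))

    X-supp : Supp 3 1 X
    X-supp = Supp-Sq 3 χx 1 (ℕDiv.divides 4 refl) (below12 (λ i → ¬? ((1 ℕ.* (i ℕ.* i)) % 3 ℕ.≟ 1) →-dec χx i ℤ.≟ 0ℤ))

    Y-supp : Supp 3 1 Y
    Y-supp = Supp-Sq 3 χy 1 (ℕDiv.divides 4 refl) (below12 (λ i → ¬? ((1 ℕ.* (i ℕ.* i)) % 3 ℕ.≟ 1) →-dec χy i ℤ.≟ 0ℤ))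

    Sq-supp₀ : ∀ a m → 3 ℕDiv.∣ m → Supp 3 0 (Sq a m)
    Sq-supp₀ a m 3∣m = Supp-Sq 3 a m (ℕDiv.divides 4 refl) λ {i} _ h →
      contradiction (ℕDiv.n∣m⇒m%n≡0 (m ℕ.* (i ℕ.* i)) 3 (ℕDiv.∣m⇒∣m*n (i ℕ.* i) 3∣m)) h

    t-supp : Supp 3 0 t
    t-supp = Supp-⊕ (Sq-supp₀ 𝟙 3 (ℕDiv.divides 1 refl)) (Sq-supp₀ 𝟙 9 (ℕDiv.divides 3 refl))

    s³-supp : Supp 3 0 (s ⊛ square s)
    s³-supp = Supp-⊛ s-supp (Supp-⊛ s-supp s-supp)

    s⁸-supp : Supp 3 2 (s ⁸)
    s⁸-supp = Supp-⊛ s⁴-supp s⁴-supp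
      where s⁴-supp = Supp-⊛ (Supp-⊛ s-supp s-supp) (Supp-⊛ s-supp s-supp)

    -- Trisection turns A(q³) + A(q⁹) into A(q) + A(q³), and A(q) = s + A(q⁹).
    U-t : U t ≋ t ⊕ s
    U-t = ≋-trans (≗⇒≋ λ n → cong₂ _+_ (Sq-stretch 3 𝟙 {1} n 1≤) (Sq-stretch 3 𝟙 {3} n 1≤))
      (≋-trans (⊕-cong A₁≋ (≋-refl {A 3})) (solve 3 (λ s a c → (s :+ c) :+ a := (a :+ c) :+ s) ≋-refl s (A 3) (A 9)))

    U-t² : U (square t) ≋ square (t ⊕ s)
    U-t² = ≋-trans (U-⊛≋ t t t-supp) (square-cong U-t)

    t²-supp : Supp 3 0 (square t)
    t²-supp = Supp-⊛ t-supp t-supp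

    U-t⁴ : U (t ⁴) ≋ (t ⊕ s) ⁴
    U-t⁴ = ≋-trans (U-⊛≋ (square t) (square t) t²-supp) (square-cong U-t²)

    U-t⁸ : U (t ⁸) ≋ (t ⊕ s) ⁸
    U-t⁸ = ≋-trans (U-⊛≋ (t ⁴) (t ⁴) (Supp-⊛ t²-supp t²-supp)) (square-cong U-t⁴)

    U-s³ : U (s ⊛ square s) ≋ (s ⊕ square s) ⊕ s ⊛ square s
    U-s³ = begin
      U (s ⊛ square s)                     ≈⟨ U-cong (⊛-cong (≋-refl {s}) (≋-sym s²)) ⟩
      U (s ⊛ Sq χs 2)                      ≈⟨ mk (λ n _ → U-ss n) ⟩
      (s ⊕ Sq χs 2) ⊕ s ⊛ Sq χs 2          ≈⟨ ⊕-cong (⊕-cong (≋-refl {s}) s²) (⊛-cong (≋-refl {s}) s²) ⟩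
      (s ⊕ square s) ⊕ s ⊛ square s        ∎
      where
      open SetoidReasoning M₂.R.setoid
      s² : Sq χs 2 ≋ square s
      s² = frobenius χs {1} 1≤

    -- U adds s + s² to either side, so it fixes the difference, a series in q³ without constant
    -- term.
    s³≋ : s ⊛ square s ≋ t ⊕ square t
    s³≋ = ≋0⇒≋ (U-invariant⇒0 D (Supp-⊕ s³-supp (Supp-⊕ t-supp t²-supp)) invariant (divides 0ℤ refl))
      where
      open SetoidReasoning M₂.R.setoid
      D = s ⊛ square s ⊕ (t ⊕ square t)
      invariant : U D ≋ D
      invariant = begin
        U D ≈⟨ ⊕-cong U-s³ (⊕-cong U-t U-t²) ⟩
        ((s ⊕ square s) ⊕ s ⊛ square s) ⊕ ((t ⊕ s) ⊕ square (t ⊕ s))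
          ≈⟨ solve 2 (λ s t → ((s :+ sq s) :+ s :* sq s) :+ ((t :+ s) :+ sq (t :+ s)) := s :* sq s :+ (t :+ sq t))
              ≋-refl s t ⟩
        D ∎

    -- Substituting X = s + s⁴ collapses the left side to s³ + s⁶, which is (t + t²) + (t + t²)².
    X³≋ : X ⊛ square X ⊕ X ⊛ s ⁸ ≋ t ⊕ t ⁴
    X³≋ = begin
      X ⊛ square X ⊕ X ⊛ s ⁸
        ≈⟨ ⊕-cong (⊛-cong X≋ (square-cong X≋)) (⊛-cong X≋ (≋-refl {s ⁸})) ⟩
      (s ⊕ s ⁴) ⊛ square (s ⊕ s ⁴) ⊕ (s ⊕ s ⁴) ⊛ s ⁸
        ≈⟨ solve 1 (λ s → (s :+ sq (sq s)) :* sq (s :+ sq (sq s)) :+ (s :+ sq (sq s)) :* sq (sq (sq s))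
                          := s :* sq s :+ sq (s :* sq s)) ≋-refl s ⟩
      s ⊛ square s ⊕ square (s ⊛ square s)
        ≈⟨ ⊕-cong s³≋ (square-cong s³≋) ⟩
      (t ⊕ square t) ⊕ square (t ⊕ square t)
        ≈⟨ solve 1 (λ t → (t :+ sq t) :+ sq (t :+ sq t) := t :+ sq (sq t)) ≋-refl t ⟩
      t ⊕ t ⁴ ∎
      where open SetoidReasoning M₂.R.setoid

    Sq-0 : ∀ m → Sq (λ _ → 0ℤ) m ≋ const 0ℤ
    Sq-0 m = ≗⇒≋ λ n → trans (sumL-zero (pos n) (λ x _ → ℤP.*-zeroˡ (mono (m ℕ.* (x ℕ.* x)) n))) (sym (const-0 n))

    χe₂≋ : Sq χe 2 ≋ s ⁸
    χe₂≋ = ≋-trans (≗⇒≋ λ n → Sq-χe {2} n 1≤) s⁸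

    U-X³ : U (X ⊛ square X) ≋ X ⊕ X ⊛ s ⁸
    U-X³ = begin
      U (X ⊛ square X)
        ≈⟨ U-cong (⊛-cong (≋-refl {X}) (≋-sym (frobenius χx {1} 1≤))) ⟩
      U (X ⊛ Sq χx 2)
        ≈⟨ mk (λ n _ → U-xx n) ⟩
      (X ⊕ Sq (λ _ → 0ℤ) 2) ⊕ X ⊛ Sq χe 2
        ≈⟨ ⊕-cong (⊕-cong (≋-refl {X}) (Sq-0 2)) (⊛-cong (≋-refl {X}) χe₂≋) ⟩
      (X ⊕ const 0ℤ) ⊕ X ⊛ s ⁸
        ≈⟨ solve 2 (λ x y → (x :+ con false) :+ y := x :+ y) ≋-refl X (X ⊛ s ⁸) ⟩
      X ⊕ X ⊛ s ⁸ ∎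
      where open SetoidReasoning M₂.R.setoid

    U-YX² : U (Y ⊛ square X) ≋ Y ⊕ (O 1 ⊕ Y) ⊛ s ⁸
    U-YX² = begin
      U (Y ⊛ square X)
        ≈⟨ U-cong (⊛-cong (≋-refl {Y}) (≋-sym (frobenius χx {1} 1≤))) ⟩
      U (Y ⊛ Sq χx 2)
        ≈⟨ mk (λ n _ → U-yx n) ⟩
      (Y ⊕ Sq (λ _ → 0ℤ) 2) ⊕ Sq (λ i → χo i + χy i) 1 ⊛ Sq χe 2
        ≈⟨ ⊕-cong (⊕-cong (≋-refl {Y}) (Sq-0 2)) (⊛-cong oy≋ χe₂≋) ⟩
      (Y ⊕ const 0ℤ) ⊕ (O 1 ⊕ Y) ⊛ s ⁸
        ≈⟨ solve 2 (λ x y → (x :+ con false) :+ y := x :+ y) ≋-refl Y ((O 1 ⊕ Y) ⊛ s ⁸) ⟩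
      Y ⊕ (O 1 ⊕ Y) ⊛ s ⁸ ∎
      where
      open SetoidReasoning M₂.R.setoid
      oy≋ : Sq (λ i → χo i + χy i) 1 ≋ O 1 ⊕ Y
      oy≋ = ≗⇒≋ (Sq-+ χo χy 1)

    -- `X³≋` expresses X s⁸ through X³, t and t⁴, on all of which U is known. In U (X s⁸) the terms
    -- X + s + s⁴ cancel and t + t⁴ leaves O(q³) + O(q⁹); adding U (O(q⁹)) = O(q³) shows that U
    -- fixes the difference.
    Xs⁸≋O₉ : X ⊛ s ⁸ ≋ O 9
    Xs⁸≋O₉ = ≋0⇒≋ (U-invariant⇒0 D (Supp-⊕ (Supp-⊛ X-supp s⁸-supp) (Sq-supp₀ χo 9 (ℕDiv.divides 3 refl))) invariant
        (divides 0ℤ refl))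
      where
      open SetoidReasoning M₂.R.setoid
      D = X ⊛ s ⁸ ⊕ O 9
      U-O₉ : U (O 9) ≋ O 3
      U-O₉ = ≗⇒≋ λ n → Sq-stretch 3 χo {3} n 1≤
      q⁴ = λ {n} (p : Polynomial n) → sq (sq p)
      invariant : U D ≋ D
      invariant = begin
        U (X ⊛ s ⁸) ⊕ U (O 9)
          ≈⟨ ⊕-cong (U-cong (≋-trans (solve 2 (λ a b → b := a :+ (a :+ b)) ≋-refl (X ⊛ square X) (X ⊛ s ⁸))
              (⊕-cong (≋-refl {X ⊛ square X}) X³≋)))
                    U-O₉ ⟩
        U (X ⊛ square X) ⊕ (U t ⊕ U (t ⁴)) ⊕ O 3
          ≈⟨ ⊕-cong (⊕-cong U-X³ (⊕-cong U-t U-t⁴)) (≋-refl {O 3}) ⟩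
        (X ⊕ X ⊛ s ⁸) ⊕ ((t ⊕ s) ⊕ (t ⊕ s) ⁴) ⊕ O 3
          ≈⟨ solve 5 (λ x k t s o → (x :+ k) :+ ((t :+ s) :+ q⁴ (t :+ s)) :+ o := x :+ (s :+ q⁴ s) :+ (t :+ q⁴ t) :+ k
              :+ o) ≋-refl X (X ⊛ s ⁸) t s (O 3) ⟩
        X ⊕ (s ⊕ s ⁴) ⊕ (t ⊕ t ⁴) ⊕ X ⊛ s ⁸ ⊕ O 3
          ≈⟨ ⊕-cong (⊕-cong (⊕-cong (⊕-cong (≋-refl {X}) (≋-sym X≋)) t⊕t⁴≋) (≋-refl {X ⊛ s ⁸})) (≋-refl {O 3}) ⟩
        X ⊕ X ⊕ (O 3 ⊕ O 9) ⊕ X ⊛ s ⁸ ⊕ O 3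
          ≈⟨ solve 4 (λ x o o′ k → x :+ x :+ (o :+ o′) :+ k :+ o := k :+ o′) ≋-refl X (O 3) (O 9) (X ⊛ s ⁸) ⟩
        D ∎

    X³≋O₃ : X ⊛ square X ≋ O 3
    X³≋O₃ = begin
      X ⊛ square X ≈⟨ solve 2 (λ a b → a := (a :+ b) :+ b) ≋-refl (X ⊛ square X) (X ⊛ s ⁸) ⟩
      (X ⊛ square X ⊕ X ⊛ s ⁸) ⊕ X ⊛ s ⁸ ≈⟨ ⊕-cong (≋-trans X³≋ t⊕t⁴≋) Xs⁸≋O₉ ⟩
      (O 3 ⊕ O 9) ⊕ O 9 ≈⟨ solve 2 (λ a b → (a :+ b) :+ b := a) ≋-refl (O 3) (O 9) ⟩
      O 3 ∎
      where open SetoidReasoning M₂.R.setoid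

    O₁≋ : O 1 ≋ X ⊕ X ⊛ s ⁸
    O₁≋ = ≋-trans (≗⇒≋ λ n → O-split {1} n 1≤) (⊕-cong (≋-refl {X}) (≋-sym Xs⁸≋O₉))

    -- Every other term of the convolution at n contains a coefficient of `Z` below n.
    ⊛-leading : ∀ {M} f Z n → (∀ {k} → k < n → M ∣ Z k) → M ∣ (f ⊛ Z) n - f 0 * Z n
    ⊛-leading f Z zero    low = divides 0ℤ (ℤP.+-inverseʳ (f 0 * Z 0))
    ⊛-leading {M} f Z (suc n) low = subst (M ∣_) (sym
        (trans (cong (_- f 0 * Z (suc n)) (⊛-suc f Z n)) (lem (f 0 * Z (suc n)) ((tail f ⊛ Z) n))))
      (sumTo-∣ n λ i _ → Div.∣n⇒∣m*n (f (suc i)) (low (s≤s (ℕP.m∸n≤m n i))))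
      where
      lem : ∀ a b → a + b - a ≡ b
      lem = ℤRS.solve-∀

    -- Both sides live on exponents ≡ 1 modulo 3, out of reach of U. Multiplication by X², which
    -- starts with q², moves their difference `Z` to multiples of 3, and there `U-YX²` and `U-X³`
    -- apply.
    Y≋ : Y ≋ X ⊛ t ⁸
    Y≋ = ≋0⇒≋ (<-rec _ step)
      where
      Z = Y ⊕ X ⊛ t ⁸
      X² = square X

      Z-supp : Supp 3 1 Z
      Z-supp = Supp-⊕ Y-supp (Supp-⊛ X-supp (Supp-⊛ t⁴-supp t⁴-supp))
        where t⁴-supp = Supp-⊛ t²-supp t²-supp

      U-X²Z : U (X² ⊛ Z) ≋ (const 1ℤ ⊕ s ⁸) ⊛ Z
      U-X²Z = begin
        U (X² ⊛ Z)
          ≈⟨ U-cong (solve 3 (λ x y t → sq x :* (y :+ x :* t) := y :* sq x :+ (x :* sq x) :* t) ≋-refl X Y (t ⁸)) ⟩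
        U (Y ⊛ X²) ⊕ U (X ⊛ X² ⊛ t ⁸)
          ≈⟨ ⊕-cong U-YX² (≋-trans (U-⊛≋ (X ⊛ X²) (t ⁸) (Supp-⊛ t⁴-supp t⁴-supp)) (⊛-cong U-X³ U-t⁸)) ⟩
        (Y ⊕ (O 1 ⊕ Y) ⊛ s ⁸) ⊕ (X ⊕ X ⊛ s ⁸) ⊛ (t ⊕ s) ⁸
          ≈⟨ ⊕-cong (⊕-cong (≋-refl {Y}) (⊛-cong (⊕-cong O₁≋ (≋-refl {Y})) (≋-refl {s ⁸})))
              (⊛-cong (≋-refl {X ⊕ X ⊛ s ⁸}) add⁸) ⟩
        (Y ⊕ ((X ⊕ X ⊛ s ⁸) ⊕ Y) ⊛ s ⁸) ⊕ (X ⊕ X ⊛ s ⁸) ⊛ (t ⁸ ⊕ s ⁸)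
          ≈⟨ solve 4 (λ x y s t → (y :+ ((x :+ x :* s) :+ y) :* s) :+ (x :+ x :* s) :* (t :+ s)
               := (con true :+ s) :* (y :+ x :* t)) ≋-refl X Y (s ⁸) (t ⁸) ⟩
        (const 1ℤ ⊕ s ⁸) ⊛ Z ∎
        where
        open SetoidReasoning M₂.R.setoid
        t⁴-supp = Supp-⊛ t²-supp t²-supp
        add² : ∀ f g → square (f ⊕ g) ≋ square f ⊕ square g
        add² = solve 2 (λ f g → sq (f :+ g) := sq f :+ sq g) ≋-refl
        add⁸ : (t ⊕ s) ⁸ ≋ t ⁸ ⊕ s ⁸
        add⁸ = ≋-trans (square-cong (≋-trans (square-cong (add² t s)) (add² (square t) (square s))))
            (add² (t ⁴) (s ⁴))

      lem : ∀ a b → a - (a - b) ≡ b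
      lem = ℤRS.solve-∀

      -- X² Z = q² Z + ⋯ , so U (X² Z) ≋ (1 + s⁸) Z determines Z n from earlier coefficients.
      step : ∀ n → (∀ {k} → k < n → (+ 2) ∣ Z k) → (+ 2) ∣ Z n
      step 0 low = divides 0ℤ refl
      step 1 low = divides 0ℤ refl
      step n@(suc (suc m)) low = subst ((+ 2) ∣_) (lem ((tail (tail X²) ⊛ Z) n) (Z n))
          (Div.∣m∣n⇒∣m-n shifted (subst (λ z → (+ 2) ∣ (tail (tail X²) ⊛ Z) n - z) (ℤP.*-identityˡ (Z n))
              (⊛-leading (tail (tail X²)) Z n low)))
        where
        shift : (X² ⊛ Z) (2 ℕ.+ n) ≡ (tail (tail X²) ⊛ Z) n
        shift = trans (⊛-suc X² Z (suc n)) (trans (ℤP.+-identityˡ _) (trans (⊛-suc (tail X²) Z n) (ℤP.+-identityˡ _)))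
        shifted : (+ 2) ∣ (tail (tail X²) ⊛ Z) n
        shifted with (2 ℕ.+ n) % 3 ℕ.≟ 0
        ... | no ¬e = divides 0ℤ (trans (sym shift) (Supp-⊛ (Supp-⊛ X-supp X-supp) Z-supp (2 ℕ.+ n) ¬e))
        ... | yes e with ℕDiv.m%n≡0⇒n∣m (2 ℕ.+ n) 3 e
        ...   | ℕDiv.divides k n+2≡ = subst ((+ 2) ∣_)
            (trans (lem′ (U (X² ⊛ Z) k) (((const 1ℤ ⊕ s ⁸) ⊛ Z) k)) (trans (cong (X² ⊛ Z) (sym n+2≡)) shift))
                  (Div.∣m∣n⇒∣m+n (at U-X²Z k tt) (sumTo-∣ k λ i _ → Div.∣n⇒∣m*n ((const 1ℤ ⊕ s ⁸) i)
                      (low (ℕP.≤-<-trans (ℕP.m∸n≤m k i) k<n))))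
          where
          lem′ : ∀ a b → a - b + b ≡ a
          lem′ = ℤRS.solve-∀
          -- From 3k = n + 2 and n ≥ 2. For n = 1 this would give k = n, so the exponents 0 and 1
          -- are evaluated directly.
          k<n : k < n
          k<n = ℕP.*-cancelʳ-< 3 k n (subst (_< n ℕ.* 3) n+2≡
              (s≤s (s≤s (s≤s (s≤s (s≤s (ℕP.m≤n⇒m≤1+n (ℕP.m≤m*n m 3))))))))

    -- Pass from t² to t⁸ at the cost of (t + t⁴)². Since t + t⁴ = s³ + s⁶ = s² X, the cost is X (s²
    -- X)² = s⁴ X³.
    Xt²≋ : X ⊛ square t ≋ Y ⊕ s ⁴ ⊛ O 3
    Xt²≋ = begin
      X ⊛ square t
        ≈⟨ solve 2 (λ x t → x :* sq t := x :* sq (sq (sq t)) :+ x :* (sq t :+ sq (sq (sq t)))) ≋-refl X t ⟩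
      X ⊛ t ⁸ ⊕ X ⊛ (square t ⊕ t ⁸)
        ≈⟨ ⊕-cong (≋-sym Y≋) (⊛-cong (≋-refl {X}) (solve 1 (λ t → sq t :+ sq (sq (sq t)) := sq (t :+ sq (sq t)))
            ≋-refl t)) ⟩
      Y ⊕ X ⊛ square (t ⊕ t ⁴)
        ≈⟨ ⊕-cong (≋-refl {Y}) (⊛-cong (≋-refl {X}) (square-cong root)) ⟩
      Y ⊕ X ⊛ square (square s ⊛ X)
        ≈⟨ solve 3 (λ x y s → y :+ x :* sq (sq s :* x) := y :+ sq (sq s) :* (x :* sq x)) ≋-refl X Y s ⟩
      Y ⊕ s ⁴ ⊛ (X ⊛ square X)
        ≈⟨ ⊕-cong (≋-refl {Y}) (⊛-cong (≋-refl {s ⁴}) X³≋O₃) ⟩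
      Y ⊕ s ⁴ ⊛ O 3 ∎
      where
      open SetoidReasoning M₂.R.setoid
      root : t ⊕ t ⁴ ≋ square s ⊛ X
      root = begin
        t ⊕ t ⁴
          ≈⟨ solve 1 (λ t → t :+ sq (sq t) := (t :+ sq t) :+ sq (t :+ sq t)) ≋-refl t ⟩
        (t ⊕ square t) ⊕ square (t ⊕ square t)
          ≈⟨ ⊕-cong (≋-sym s³≋) (square-cong (≋-sym s³≋)) ⟩
        s ⊛ square s ⊕ square (s ⊛ square s)
          ≈⟨ solve 1 (λ s → s :* sq s :+ sq (s :* sq s) := sq s :* (s :+ sq (sq s))) ≋-refl s ⟩
        square s ⊛ (s ⊕ s ⁴)
          ≈⟨ ⊛-cong (≋-refl {square s}) (≋-sym X≋) ⟩
        square s ⊛ X ∎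

  open CharacteristicTwo

  -- Gauss' product for φ(-q)

  mono-⊛-< : ∀ k g n → n < k → (mono k ⊛ g) n ≡ 0ℤ
  mono-⊛-< (suc k) g zero    _         = ℤP.*-zeroˡ (g 0)
  mono-⊛-< (suc k) g (suc n) (s≤s n<k) = trans (⊛-suc (mono (suc k)) g n)
    (trans (cong (_+ (mono k ⊛ g) n) (ℤP.*-zeroˡ (g (suc n)))) (trans (ℤP.+-identityˡ _) (mono-⊛-< k g n n<k)))

  mono-⊛-+ : ∀ k g n → (mono k ⊛ g) (k ℕ.+ n) ≡ g n
  mono-⊛-+ zero    g n = trans (⊛-congʳ {mono 0} {one} g n (λ { zero _ → refl ; (suc _) _ → refl })) (⊛-identityˡ g n)
  mono-⊛-+ (suc k) g n = trans (⊛-suc (mono (suc k)) g (k ℕ.+ n))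
    (trans (cong (_+ (mono k ⊛ g) (k ℕ.+ n)) (ℤP.*-zeroˡ (g (suc (k ℕ.+ n)))))
        (trans (ℤP.+-identityˡ _) (mono-⊛-+ k g n)))

  scale-⊛ : ∀ a b f g n → (scale a f ⊛ scale b g) n ≡ a * b * (f ⊛ g) n
  scale-⊛ a b f g n = trans (⊛-scaleʳ a f (scale b g) n)
      (trans (cong (a *_) (trans (⊛-comm f (scale b g) n) (trans (⊛-scaleʳ b g f n) (cong (b *_) (⊛-comm g f n)))))
    (sym (ℤP.*-assoc a b _)))

  -- `c` is the ratio of coefficients `suc k` places apart: 1 for the inverse of 1 - q^(k+1), and -1
  -- for that of 1 + q^(k+1).
  inverse-split : ∀ k c g → g 0 ≡ 1ℤ → (∀ n → n < suc k → n ≢ 0 → g n ≡ 0ℤ) → (∀ n → g (suc k ℕ.+ n) ≡ c * g n) →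
    ∀ n → ((one ⊕ scale (- c) (mono (suc k))) ⊛ g) n ≡ one n
  inverse-split k c g g₀ low high n = trans (⊛-distribʳ one (scale (- c) (mono (suc k))) g n)
      (trans (cong₂ _+_ (⊛-identityˡ g n) (⊛-scaleʳ (- c) (mono (suc k)) g n)) (go n))
    where
    lem₀ : ∀ a c → a + - c * 0ℤ ≡ a
    lem₀ = ℤRS.solve-∀
    lem : ∀ c x → c * x + - c * x ≡ 0ℤ
    lem = ℤRS.solve-∀
    go : ∀ n → g n + - c * (mono (suc k) ⊛ g) n ≡ one n
    go n with n ℕ.<? suc k
    ... | yes n<k = trans (cong (λ z → g n + - c * z) (mono-⊛-< (suc k) g n n<k)) (trans (lem₀ (g n) c) (base n n<k))
      where
      base : ∀ n → n < suc k → g n ≡ one n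
      base zero    _ = g₀
      base (suc n) h = low (suc n) h λ ()
    ... | no n≮k with ℕP.m≤n⇒∃[o]m+o≡n (ℕP.≮⇒≥ n≮k)
    ...   | m , refl = trans (cong₂ (λ y z → y + - c * z) (high m) (mono-⊛-+ (suc k) g m)) (lem c (g m))

  onePlus≗ : ∀ k n → onePlus (suc k) n ≡ (one ⊕ mono (suc k)) n
  onePlus≗ k zero    = refl
  onePlus≗ k (suc n) with suc n ℕ.≟ suc k
  ... | yes refl = sym (trans (ℤP.+-identityˡ _) (mono-refl k))
  ... | no ¬e    = sym (trans (ℤP.+-identityˡ _) (mono-≢ λ e → ¬e (cong suc (sym e))))

  oneMinus≗ : ∀ k n → oneMinus (suc k) n ≡ (one ⊕ ⊖ mono (suc k)) n
  oneMinus≗ k zero    = refl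
  oneMinus≗ k (suc n) with suc n ℕ.≟ suc k
  ... | yes refl = sym (trans (ℤP.+-identityˡ _) (cong -_ (mono-refl k)))
  ... | no ¬e    = sym (trans (ℤP.+-identityˡ _) (cong -_ (mono-≢ λ e → ¬e (cong suc (sym e)))))

  invOneMinus-inverse : ∀ k n → ((one ⊕ ⊖ mono (suc k)) ⊛ invOneMinus k) n ≡ one n
  invOneMinus-inverse k n = trans (⊛-congʳ {one ⊕ ⊖ mono (suc k)} {one ⊕ scale (- 1ℤ) (mono (suc k))} (invOneMinus k)
      n
      (λ i _ → cong (_+_ (one i)) (sym (ℤP.-1*i≡-i (mono (suc k) i)))))
    (inverse-split k 1ℤ (invOneMinus k) refl low high n)
    where
    low : ∀ n → n < suc k → n ≢ 0 → invOneMinus k n ≡ 0ℤ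
    low n n<k n≢0 with n % suc k ℕ.≟ 0
    ... | yes e = contradiction (trans (sym (ℕD.m<n⇒m%n≡m n<k)) e) n≢0
    ... | no _  = refl
    high : ∀ n → invOneMinus k (suc k ℕ.+ n) ≡ 1ℤ * invOneMinus k n
    high n rewrite trans (cong (_% suc k) (ℕP.+-comm (suc k) n)) (ℕD.[m+n]%n≡m%n n (suc k)) = sym (ℤP.*-identityˡ _)

  invOnePlus-inverse : ∀ k n → ((one ⊕ mono (suc k)) ⊛ invOnePlus k) n ≡ one n
  invOnePlus-inverse k n = trans (⊛-congʳ {one ⊕ mono (suc k)} {one ⊕ scale 1ℤ (mono (suc k))} (invOnePlus k) n
      (λ i _ → cong (_+_ (one i)) (sym (ℤP.*-identityˡ (mono (suc k) i)))))
    (inverse-split k (- 1ℤ) (invOnePlus k) refl low high n)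
    where
    low : ∀ n → n < suc k → n ≢ 0 → invOnePlus k n ≡ 0ℤ
    low n n<k n≢0 with n % suc k ℕ.≟ 0
    ... | yes e = contradiction (trans (sym (ℕD.m<n⇒m%n≡m n<k)) e) n≢0
    ... | no _  = refl
    quot : ∀ n → (suc k ℕ.+ n) ℕ./ suc k ≡ suc (n ℕ./ suc k)
    quot n = trans (ℕD.+-distrib-/-∣ˡ n {suc k} (ℕDiv.∣-refl {suc k})) (cong (ℕ._+ n ℕ./ suc k) (ℕD.n/n≡1 (suc k)))
    high : ∀ n → invOnePlus k (suc k ℕ.+ n) ≡ - 1ℤ * invOnePlus k n
    high n rewrite trans (cong (_% suc k) (ℕP.+-comm (suc k) n)) (ℕD.[m+n]%n≡m%n n (suc k)) | quot n with n % suc k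
        ℕ.≟ 0
    ... | yes _ = refl
    ... | no _  = refl

  module Gauss (M : ℤ) (P : ℕ → Set) (down : ∀ {m n} → m ≤ n → P n → P m) where
    open Mod M P down
    open Solver using (solve; _:=_; _:+_; _:*_; _:-_; :-_; con; Polynomial)
    open SetoidReasoning R.setoid

    1# : PS
    1# = const 1ℤ

    identityˡ : ∀ f → 1# ⊛ f ≋ f
    identityˡ = solve 1 (λ f → con 1ℤ :* f := f) ≋-refl

    -- e k stands for xᵏ, where x is an arbitrary series.
    module Shanks (e : ℕ → PS) (e-+ : ∀ j k → e (j ℕ.+ k) ≋ e j ⊛ e k) where

      -- `Φ n` is the partial sum 1 + 2 Σ (-1)ʲ x^(j²) of φ(-x), and `D n` the partial denominator
      -- of Gauss' product.
      sgn D Φ : ℕ → PS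
      sgn zero    = 1#
      sgn (suc n) = ⊖ sgn n
      D zero    = 1#
      D (suc n) = D n ⊛ (1# ⊕ e (suc n))
      Φ zero    = 1#
      Φ (suc n) = Φ n ⊕ const (+ 2) ⊛ (sgn (suc n) ⊛ e (suc n ℕ.* suc n))

      -- Q s l is the product of 1 - xᵏ over s < k ≤ s + l.
      Q : ℕ → ℕ → PS
      Q s zero    = 1#
      Q s (suc l) = Q s l ⊛ (1# ⊕ ⊖ e (s ℕ.+ suc l))

      N : ℕ → PS
      N = Q 0

      Q-bottom : ∀ s l → Q s (suc l) ≋ (1# ⊕ ⊖ e (suc s)) ⊛ Q (suc s) l
      Q-bottom s zero    = ≋-trans (⊛-cong (≋-refl {1#}) (≡⇒≋ (cong (λ k → 1# ⊕ ⊖ e k) (ℕP.+-comm s 1))))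
          (R.*-comm 1# (1# ⊕ ⊖ e (suc s)))
      Q-bottom s (suc l) = begin
        Q s (suc l) ⊛ (1# ⊕ ⊖ e (s ℕ.+ suc (suc l)))
          ≈⟨ ⊛-cong (Q-bottom s l) (≡⇒≋ (cong (λ k → 1# ⊕ ⊖ e k) (ℕP.+-suc s (suc l)))) ⟩
        (1# ⊕ ⊖ e (suc s)) ⊛ Q (suc s) l ⊛ (1# ⊕ ⊖ e (suc s ℕ.+ suc l))
          ≈⟨ R.*-assoc (1# ⊕ ⊖ e (suc s)) (Q (suc s) l) (1# ⊕ ⊖ e (suc s ℕ.+ suc l)) ⟩
        (1# ⊕ ⊖ e (suc s)) ⊛ Q (suc s) (suc l) ∎

      -- The partial sums of Shanks' expansion N n + 2 Σ_{1≤s≤m} (-1)ˢ x^(s(n+1)) Q s (n-s) D (s-1) of D n · Φ n.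
      T : ℕ → ℕ → PS
      T n zero    = N n
      T n (suc m) = T n m ⊕ const (+ 2) ⊛ (sgn (suc m) ⊛ e (suc m ℕ.* suc n) ⊛ Q (suc m) (n ∸ suc m) ⊛ D m)

      -- Raising n by one multiplies the sum by 1 + xⁿ⁺¹ up to a single boundary term. Splitting `Q`
      -- once at its top and once at its bottom factor shows that adding the summand m + 1 only
      -- moves this boundary term one step on.
      T-telescope : ∀ n m → m ≤ n → T (suc n) m ≋
        (1# ⊕ e (suc n)) ⊛ T n m ⊕ ⊖ (const (+ 2) ⊛ (sgn m ⊛ e (suc m ℕ.* suc n) ⊛ Q m (n ∸ m) ⊛ D m))
      T-telescope n zero _ = begin
        N n ⊛ (1# ⊕ ⊖ e (suc n))
          ≈⟨ solve 2 (λ N b → N :* (con 1ℤ :- b) := (con 1ℤ :+ b) :* N :- con (+ 2) :* (con 1ℤ :* b :* N :* con 1ℤ))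
              ≋-refl (N n) (e (suc n)) ⟩
        (1# ⊕ e (suc n)) ⊛ N n ⊕ ⊖ (const (+ 2) ⊛ (1# ⊛ e (suc n) ⊛ N n ⊛ 1#))
          ≈⟨ ⊕-cong (≋-refl {(1# ⊕ e (suc n)) ⊛ N n})
               (⊖-cong (⊛-cong (≋-refl {const (+ 2)}) (⊛-cong
                   (⊛-cong (⊛-cong (≋-refl {1#}) (≡⇒≋ (cong e (sym (ℕP.*-identityˡ (suc n)))))) (≋-refl {N n}))
                   (≋-refl {1#})))) ⟩
        (1# ⊕ e (suc n)) ⊛ N n ⊕ ⊖ (const (+ 2) ⊛ (1# ⊛ e (1 ℕ.* suc n) ⊛ N n ⊛ 1#)) ∎
      T-telescope n (suc m) m<n = begin
        T (suc n) m ⊕ const (+ 2) ⊛ (⊖ σₘ ⊛ e (suc m ℕ.* suc (suc n)) ⊛ Q (suc m) (n ∸ m) ⊛ D m)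
          ≈⟨ ⊕-cong (T-telescope n m (ℕP.<⇒≤ m<n))
               (⊛-cong (≋-refl {const (+ 2)}) (⊛-cong (⊛-cong (⊛-cong (≋-refl {⊖ σₘ}) E₁) Q₁) (≋-refl {D m}))) ⟩
        ((1# ⊕ b) ⊛ T n m ⊕ ⊖ (const (+ 2) ⊛ (σₘ ⊛ E ⊛ Q m (n ∸ m) ⊛ D m)))
          ⊕ const (+ 2) ⊛ (⊖ σₘ ⊛ (E ⊛ a) ⊛ (q ⊛ (1# ⊕ ⊖ b)) ⊛ D m)
          ≈⟨ ⊕-cong (⊕-cong (≋-refl {(1# ⊕ b) ⊛ T n m})
              (⊖-cong (⊛-cong (≋-refl {const (+ 2)}) (⊛-cong (⊛-cong (≋-refl {σₘ ⊛ E}) Q₂) (≋-refl {D m})))))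
               (≋-refl {const (+ 2) ⊛ (⊖ σₘ ⊛ (E ⊛ a) ⊛ (q ⊛ (1# ⊕ ⊖ b)) ⊛ D m)}) ⟩
        ((1# ⊕ b) ⊛ T n m ⊕ ⊖ (const (+ 2) ⊛ (σₘ ⊛ E ⊛ ((1# ⊕ ⊖ a) ⊛ q) ⊛ D m)))
          ⊕ const (+ 2) ⊛ (⊖ σₘ ⊛ (E ⊛ a) ⊛ (q ⊛ (1# ⊕ ⊖ b)) ⊛ D m)
          ≈⟨ algebra (T n m) a b σₘ E q (D m) ⟩
        (1# ⊕ b) ⊛ (T n m ⊕ const (+ 2) ⊛ (⊖ σₘ ⊛ E ⊛ q ⊛ D m))
          ⊕ ⊖ (const (+ 2) ⊛ (⊖ σₘ ⊛ (b ⊛ E) ⊛ q ⊛ (D m ⊛ (1# ⊕ a))))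
          ≈⟨ ⊕-cong (≋-refl {(1# ⊕ b) ⊛ (T n m ⊕ const (+ 2) ⊛ (⊖ σₘ ⊛ E ⊛ q ⊛ D m))})
               (⊖-cong (⊛-cong (≋-refl {const (+ 2)}) (⊛-cong
                   (⊛-cong (⊛-cong (≋-refl {⊖ σₘ}) (≋-sym (e-+ (suc n) (suc m ℕ.* suc n)))) (≋-refl {q}))
                   (≋-refl {D (suc m)})))) ⟩
        (1# ⊕ b) ⊛ T n (suc m) ⊕ ⊖ (const (+ 2) ⊛ (sgn (suc m) ⊛ e (suc (suc m) ℕ.* suc n) ⊛ q ⊛ D (suc m))) ∎
        where
        σₘ = sgn m
        a = e (suc m)
        b = e (suc n)
        E = e (suc m ℕ.* suc n)
        q = Q (suc m) (n ∸ suc m)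
        n∸m≡ : n ∸ m ≡ suc (n ∸ suc m)
        n∸m≡ = ℕP.+-∸-assoc 1 m<n
        E₁ : e (suc m ℕ.* suc (suc n)) ≋ E ⊛ a
        E₁ = ≋-trans (≡⇒≋ (cong e (trans (ℕP.*-suc (suc m) (suc n)) (ℕP.+-comm (suc m) (suc m ℕ.* suc n)))))
            (e-+ (suc m ℕ.* suc n) (suc m))
        Q₁ : Q (suc m) (n ∸ m) ≋ q ⊛ (1# ⊕ ⊖ b)
        Q₁ = ≋-trans (≡⇒≋ (cong (Q (suc m)) n∸m≡)) (≋-trans (≋-refl {q ⊛ (1# ⊕ ⊖ e (suc m ℕ.+ suc (n ∸ suc m)))})
              (⊛-cong (≋-refl {q}) (≡⇒≋ (cong (λ k → 1# ⊕ ⊖ e k)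
                  (trans (ℕP.+-suc (suc m) (n ∸ suc m)) (cong suc (ℕP.m+[n∸m]≡n m<n)))))))
        Q₂ : Q m (n ∸ m) ≋ (1# ⊕ ⊖ a) ⊛ q
        Q₂ = ≋-trans (≡⇒≋ (cong (Q m) n∸m≡)) (Q-bottom m (n ∸ suc m))
        algebra : ∀ T a b σ E q D →
          ((1# ⊕ b) ⊛ T ⊕ ⊖ (const (+ 2) ⊛ (σ ⊛ E ⊛ ((1# ⊕ ⊖ a) ⊛ q) ⊛ D))) ⊕ const (+ 2) ⊛
              (⊖ σ ⊛ (E ⊛ a) ⊛ (q ⊛ (1# ⊕ ⊖ b)) ⊛ D)
          ≋ (1# ⊕ b) ⊛ (T ⊕ const (+ 2) ⊛ (⊖ σ ⊛ E ⊛ q ⊛ D)) ⊕ ⊖ (const (+ 2) ⊛ (⊖ σ ⊛ (b ⊛ E) ⊛ q ⊛ (D ⊛ (1# ⊕ a))))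
        algebra = solve 7 (λ T a b σ E q D →
          ((con 1ℤ :+ b) :* T :- con (+ 2) :* (σ :* E :* ((con 1ℤ :- a) :* q) :* D)) :+ con (+ 2) :*
              (:- σ :* (E :* a) :* (q :* (con 1ℤ :- b)) :* D)
          := (con 1ℤ :+ b) :* (T :+ con (+ 2) :* (:- σ :* E :* q :* D)) :- con (+ 2) :*
              (:- σ :* (b :* E) :* q :* (D :* (con 1ℤ :+ a)))) ≋-refl

      -- The boundary term at m = n and the new last summand of `T` differ by the factor xⁿ⁺¹.
      -- Together they form `D (suc n)` times the new term of `Φ`.
      T-full : ∀ n → T n n ≋ D n ⊛ Φ n
      T-full zero    = ≋-sym (identityˡ 1#)
      T-full (suc n) = begin
        T (suc n) n ⊕ const (+ 2) ⊛ (⊖ σₙ ⊛ e (suc n ℕ.* suc (suc n)) ⊛ Q (suc n) (n ∸ n) ⊛ D n)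
          ≈⟨ ⊕-cong (T-telescope n n ℕP.≤-refl) (⊛-cong (≋-refl {const (+ 2)})
              (⊛-cong (⊛-cong (⊛-cong (≋-refl {⊖ σₙ}) E₁) (Q-empty (suc n))) (≋-refl {D n}))) ⟩
        ((1# ⊕ b) ⊛ T n n ⊕ ⊖ (const (+ 2) ⊛ (σₙ ⊛ E ⊛ Q n (n ∸ n) ⊛ D n))) ⊕ const (+ 2) ⊛
            (⊖ σₙ ⊛ (E ⊛ b) ⊛ 1# ⊛ D n)
          ≈⟨ ⊕-cong (⊕-cong (⊛-cong (≋-refl {1# ⊕ b}) (T-full n))
              (⊖-cong (⊛-cong (≋-refl {const (+ 2)}) (⊛-cong (⊛-cong (≋-refl {σₙ ⊛ E}) (Q-empty n)) (≋-refl {D n})))))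
               (≋-refl {const (+ 2) ⊛ (⊖ σₙ ⊛ (E ⊛ b) ⊛ 1# ⊛ D n)}) ⟩
        ((1# ⊕ b) ⊛ (D n ⊛ Φ n) ⊕ ⊖ (const (+ 2) ⊛ (σₙ ⊛ E ⊛ 1# ⊛ D n))) ⊕ const (+ 2) ⊛ (⊖ σₙ ⊛ (E ⊛ b) ⊛ 1# ⊛ D n)
          ≈⟨ solve 5 (λ b D Φ σ E → ((con 1ℤ :+ b) :* (D :* Φ) :- con (+ 2) :* (σ :* E :* con 1ℤ :* D)) :+ con (+ 2)
              :* (:- σ :* (E :* b) :* con 1ℤ :* D)
               := (D :* (con 1ℤ :+ b)) :* (Φ :+ con (+ 2) :* (:- σ :* E))) ≋-refl b (D n) (Φ n) σₙ E ⟩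
        D (suc n) ⊛ Φ (suc n) ∎
        where
        σₙ = sgn n
        b = e (suc n)
        E = e (suc n ℕ.* suc n)
        E₁ : e (suc n ℕ.* suc (suc n)) ≋ E ⊛ b
        E₁ = ≋-trans (≡⇒≋ (cong e (trans (ℕP.*-suc (suc n) (suc n)) (ℕP.+-comm (suc n) (suc n ℕ.* suc n)))))
            (e-+ (suc n ℕ.* suc n) (suc n))
        Q-empty : ∀ s → Q s (n ∸ n) ≋ 1#
        Q-empty s = ≡⇒≋ (cong (Q s) (ℕP.n∸n≡0 n))

      -- Every correction in Shanks' sum carries a power of x above n, which the truncation kills.
      gauss : ∀ n → (∀ k → n < k → e k ≋ const 0ℤ) → D n ⊛ Φ n ≋ N n
      gauss n high = ≋-trans (≋-sym (T-full n)) (truncate n)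
        where
        truncate : ∀ m → T n m ≋ N n
        truncate zero    = ≋-refl
        truncate (suc m) = begin
          T n m ⊕ const (+ 2) ⊛ (sgn (suc m) ⊛ e (suc m ℕ.* suc n) ⊛ Q (suc m) (n ∸ suc m) ⊛ D m)
            ≈⟨ ⊕-cong (truncate m) (⊛-cong (≋-refl {const (+ 2)})
                (⊛-cong (⊛-cong (⊛-cong (≋-refl {sgn (suc m)}) (high (suc m ℕ.* suc n) (ℕP.m≤n*m (suc n) (suc m))))
                (≋-refl {Q (suc m) (n ∸ suc m)})) (≋-refl {D m}))) ⟩
          N n ⊕ const (+ 2) ⊛ (sgn (suc m) ⊛ const 0ℤ ⊛ Q (suc m) (n ∸ suc m) ⊛ D m)
            ≈⟨ solve 4 (λ N σ q D → N :+ con (+ 2) :* (σ :* con 0ℤ :* q :* D) := N) ≋-refl (N n) (sgn (suc m))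
                (Q (suc m) (n ∸ suc m)) (D m) ⟩
          N n ∎

    ∏ : (ℕ → PS) → ℕ → PS
    ∏ f zero    = 1#
    ∏ f (suc n) = ∏ f n ⊛ f n

    ∏-cong : ∀ {f g} → (∀ n → f n ≋ g n) → ∀ n → ∏ f n ≋ ∏ g n
    ∏-cong e zero    = ≋-refl
    ∏-cong e (suc n) = ⊛-cong (∏-cong e n) (e n)

    interchange : ∀ a b c d → (a ⊛ b) ⊛ (c ⊛ d) ≋ (a ⊛ c) ⊛ (b ⊛ d)
    interchange = solve 4 (λ a b c d → (a :* b) :* (c :* d) := (a :* c) :* (b :* d)) ≋-refl

    ∏-⊛ : ∀ f g n → ∏ f n ⊛ ∏ g n ≋ ∏ (λ j → f j ⊛ g j) n
    ∏-⊛ f g zero    = identityˡ 1#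
    ∏-⊛ f g (suc n) = ≋-trans (interchange (∏ f n) (f n) (∏ g n) (g n)) (⊛-cong (∏-⊛ f g n) (≋-refl {f n ⊛ g n}))

    record Unit (u : PS) : Set where
      constructor _,_
      field
        inverse   : PS
        u⊛inverse : u ⊛ inverse ≋ 1#

    Unit-⊛ : ∀ {u v} → Unit u → Unit v → Unit (u ⊛ v)
    Unit-⊛ {u} {v} (i , p) (j , q) = i ⊛ j , ≋-trans (interchange u v i j) (≋-trans (⊛-cong p q) (identityˡ 1#))

    Unit-1# : Unit 1#
    Unit-1# = 1# , identityˡ 1#

    Unit-∏ : ∀ {f} → (∀ j → Unit (f j)) → ∀ n → Unit (∏ f n)
    Unit-∏ u zero    = Unit-1#
    Unit-∏ u (suc n) = Unit-⊛ (Unit-∏ u n) (u n)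

    cancel : ∀ {u} f g → Unit u → u ⊛ f ≋ u ⊛ g → f ≋ g
    cancel {u} f g (i , p) e = begin
      f            ≈⟨ ≋-sym (identityˡ f) ⟩
      1# ⊛ f      ≈⟨ ⊛-cong (≋-sym p) (≋-refl {f}) ⟩
      u ⊛ i ⊛ f    ≈⟨ solve 3 (λ u i f → u :* i :* f := i :* (u :* f)) ≋-refl u i f ⟩
      i ⊛ (u ⊛ f)  ≈⟨ ⊛-cong (≋-refl {i}) e ⟩
      i ⊛ (u ⊛ g)  ≈⟨ solve 3 (λ u i f → i :* (u :* f) := u :* i :* f) ≋-refl u i g ⟩
      u ⊛ i ⊛ g    ≈⟨ ⊛-cong p (≋-refl {g}) ⟩
      1# ⊛ g      ≈⟨ identityˡ g ⟩
      g            ∎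

    -- Gauss' formula at x, divided by the one at x².
    module Odd (e e′ : ℕ → PS)
      (e-+ : ∀ j k → e (j ℕ.+ k) ≋ e j ⊛ e k) (e′-+ : ∀ j k → e′ (j ℕ.+ k) ≋ e′ j ⊛ e′ k)
      (double : ∀ j → e (j ℕ.+ j) ≋ e′ j) (unit : ∀ j → Unit (1# ⊕ e′ (suc j))) where
      module E  = Shanks e e-+
      module E′ = Shanks e′ e′-+

      1+odd 1-odd : ℕ → PS
      1+odd j = 1# ⊕ e (suc (j ℕ.+ j))
      1-odd j = 1# ⊕ ⊖ e (suc (j ℕ.+ j))

      private
        even : ∀ L → e (suc (suc (L ℕ.+ L))) ≋ e′ (suc L)
        even L = ≋-trans (≡⇒≋ (cong e (cong suc (sym (ℕP.+-suc L L))))) (double (suc L))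

        D-split : ∀ L → E.D (L ℕ.+ L) ≋ E′.D L ⊛ ∏ 1+odd L
        D-split zero    = ≋-sym (identityˡ 1#)
        D-split (suc L) rewrite ℕP.+-suc L L = begin
          E.D (L ℕ.+ L) ⊛ 1+odd L ⊛ (1# ⊕ e (suc (suc (L ℕ.+ L))))
            ≈⟨ ⊛-cong (⊛-cong (D-split L) (≋-refl {1+odd L})) (⊕-cong (≋-refl {1#}) (even L)) ⟩
          (E′.D L ⊛ ∏ 1+odd L) ⊛ 1+odd L ⊛ (1# ⊕ e′ (suc L))
            ≈⟨ solve 4 (λ D p o c → (D :* p) :* o :* c := (D :* c) :* (p :* o)) ≋-refl (E′.D L) (∏ 1+odd L) (1+odd L)
                (1# ⊕ e′ (suc L)) ⟩
          E′.D (suc L) ⊛ ∏ 1+odd (suc L) ∎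

        N-split : ∀ L → E.N (L ℕ.+ L) ≋ E′.N L ⊛ ∏ 1-odd L
        N-split zero    = ≋-sym (identityˡ 1#)
        N-split (suc L) rewrite ℕP.+-suc L L = begin
          E.N (L ℕ.+ L) ⊛ 1-odd L ⊛ (1# ⊕ ⊖ e (suc (suc (L ℕ.+ L))))
            ≈⟨ ⊛-cong (⊛-cong (N-split L) (≋-refl {1-odd L})) (⊕-cong (≋-refl {1#}) (⊖-cong (even L))) ⟩
          (E′.N L ⊛ ∏ 1-odd L) ⊛ 1-odd L ⊛ (1# ⊕ ⊖ e′ (suc L))
            ≈⟨ solve 4 (λ D p o c → (D :* p) :* o :* c := (D :* c) :* (p :* o)) ≋-refl (E′.N L) (∏ 1-odd L) (1-odd L)
                (1# ⊕ ⊖ e′ (suc L)) ⟩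
          E′.N (suc L) ⊛ ∏ 1-odd (suc L) ∎

        Unit-D : ∀ L → Unit (E′.D L)
        Unit-D zero    = Unit-1#
        Unit-D (suc L) = Unit-⊛ (Unit-D L) (unit L)

      gauss-odd : ∀ L → (∀ k → L ℕ.+ L < k → e k ≋ const 0ℤ) → (∀ k → L < k → e′ k ≋ const 0ℤ) →
        ∏ 1+odd L ⊛ E.Φ (L ℕ.+ L) ≋ E′.Φ L ⊛ ∏ 1-odd L
      gauss-odd L high high′ = cancel (∏ 1+odd L ⊛ E.Φ (L ℕ.+ L)) (E′.Φ L ⊛ ∏ 1-odd L) (Unit-D L) (begin
        E′.D L ⊛ (∏ 1+odd L ⊛ E.Φ (L ℕ.+ L))   ≈⟨ R.*-assoc (E′.D L) (∏ 1+odd L) (E.Φ (L ℕ.+ L)) ⟨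
        E′.D L ⊛ ∏ 1+odd L ⊛ E.Φ (L ℕ.+ L)     ≈⟨ ⊛-cong (≋-sym (D-split L)) (≋-refl {E.Φ (L ℕ.+ L)}) ⟩
        E.D (L ℕ.+ L) ⊛ E.Φ (L ℕ.+ L)          ≈⟨ E.gauss (L ℕ.+ L) high ⟩
        E.N (L ℕ.+ L)                          ≈⟨ N-split L ⟩
        E′.N L ⊛ ∏ 1-odd L                     ≈⟨ ⊛-cong (≋-sym (E′.gauss L high′)) (≋-refl {∏ 1-odd L}) ⟩
        E′.D L ⊛ E′.Φ L ⊛ ∏ 1-odd L            ≈⟨ R.*-assoc (E′.D L) (E′.Φ L) (∏ 1-odd L) ⟩
        E′.D L ⊛ (E′.Φ L ⊛ ∏ 1-odd L)          ∎)

  -- The generating series modulo 16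

  τ : ℕ → ℤ
  τ zero    = 1ℤ
  τ (suc n) = - τ n

  τ-+ : ∀ j k → τ (j ℕ.+ k) ≡ τ j * τ k
  τ-+ zero    k = sym (ℤP.*-identityˡ (τ k))
  τ-+ (suc j) k = trans (cong -_ (τ-+ j k)) (ℤP.neg-distribˡ-* (τ j) (τ k))

  τ-even : ∀ k → τ (k ℕ.* 2) ≡ 1ℤ
  τ-even zero    = refl
  τ-even (suc k) = trans (ℤP.neg-involutive (τ (k ℕ.* 2))) (τ-even k)

  τ-odd : ∀ k → τ (suc (k ℕ.* 2)) ≡ - 1ℤ
  τ-odd k = cong -_ (τ-even k)

  τ-double : ∀ j → τ (j ℕ.+ j) ≡ 1ℤ
  τ-double j = trans (cong τ (lem j)) (τ-even j)
    where
    lem : ∀ j → j ℕ.+ j ≡ j ℕ.* 2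
    lem = ℕRS.solve-∀

  -- The numbers j and j² have equal parity, so at x = -q the signs in φ(-x) cancel and φ(q)
  -- appears.
  τ-square : ∀ j → τ j * τ (j ℕ.* j) ≡ 1ℤ
  τ-square j with even-or-odd j
  ... | inj₁ (k , refl) = cong₂ _*_ (τ-even k) (trans (cong τ (lem k)) (τ-even (2 ℕ.* (k ℕ.* k))))
    where
    lem : ∀ k → k ℕ.* 2 ℕ.* (k ℕ.* 2) ≡ 2 ℕ.* (k ℕ.* k) ℕ.* 2
    lem = ℕRS.solve-∀
  ... | inj₂ (k , refl) = cong₂ _*_ (τ-odd k) (trans (cong τ (lem k)) (τ-odd (2 ℕ.* (k ℕ.* k) ℕ.+ 2 ℕ.* k)))
    where
    lem : ∀ k → suc (k ℕ.* 2) ℕ.* suc (k ℕ.* 2) ≡ suc ((2 ℕ.* (k ℕ.* k) ℕ.+ 2 ℕ.* k) ℕ.* 2)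
    lem = ℕRS.solve-∀

  τ≡σ : ∀ j → τ j ≡ σ (j % 12)
  τ≡σ j = trans (go (even-or-odd j)) (cong (λ r → 1ℤ - + 2 * + r)
      (sym (ℕD.m∣n⇒o%n%m≡o%m 2 12 j (ℕDiv.divides 6 refl))))
    where
    go : (∃ λ k → j ≡ k ℕ.* 2) ⊎ (∃ λ k → j ≡ suc (k ℕ.* 2)) → τ j ≡ 1ℤ - + 2 * + (j % 2)
    go (inj₁ (k , refl)) = trans (τ-even k) (cong (λ r → 1ℤ - + 2 * + r) (sym (ℕD.m*n%n≡0 k 2)))
    go (inj₂ (k , refl)) = trans (τ-odd k) (cong (λ r → 1ℤ - + 2 * + r) (sym (ℕD.[m+kn]%n≡m%n 1 k 2)))

  module Sixteen (K : ℕ) where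
    open Mod (+ 16) (_≤ K) ℕP.≤-trans
    open Gauss (+ 16) (_≤ K) ℕP.≤-trans
    open Solver using (solve; _:=_; _:+_; _:*_; _:-_; :-_; con; Polynomial)
    open SetoidReasoning R.setoid

    -- The powers of x = ±q^c, where `ε j` is the sign of xʲ.
    power : (ℕ → ℤ) → ℕ → ℕ → PS
    power ε c j = scale (ε j) (mono (c ℕ.* j))

    power-+ : ∀ ε c → (∀ j k → ε (j ℕ.+ k) ≡ ε j * ε k) → ∀ j k → power ε c (j ℕ.+ k) ≋ power ε c j ⊛ power ε c k
    power-+ ε c ε-+ j k = ≗⇒≋ λ n → sym (trans (scale-⊛ (ε j) (ε k) (mono (c ℕ.* j)) (mono (c ℕ.* k)) n)
      (cong₂ _*_ (sym (ε-+ j k)) (trans (mono-⊛ (c ℕ.* j) (c ℕ.* k) n)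
          (cong (λ i → mono i n) (sym (ℕP.*-distribˡ-+ c j k))))))

    power-high : ∀ ε c k → K < k → power ε (suc c) k ≋ const 0ℤ
    power-high ε c k K<k = mk λ n n≤K → ≡⇒∣ (trans (cong (ε k *_) (mono-≢ λ e →
        ℕP.<-irrefl (sym e) (ℕP.≤-trans (s≤s n≤K) (ℕP.≤-trans K<k (ℕP.m≤m+n k (c ℕ.* k))))))
      (trans (ℤP.*-zeroʳ (ε k)) (sym (const-0 n))))

    1+mono-unit : ∀ k → Unit (1# ⊕ mono (suc k))
    1+mono-unit k = invOnePlus k , ≗⇒≋ λ n → trans (⊛-congʳ {1# ⊕ mono (suc k)} {one ⊕ mono (suc k)} (invOnePlus k) n
      (λ i _ → cong (_+ mono (suc k) i) (sym (one≗const i)))) (trans (invOnePlus-inverse k n) (one≗const n))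

    1-mono-unit : ∀ k → Unit (1# ⊕ ⊖ mono (suc k))
    1-mono-unit k = invOneMinus k , ≗⇒≋ λ n → trans
        (⊛-congʳ {1# ⊕ ⊖ mono (suc k)} {one ⊕ ⊖ mono (suc k)} (invOneMinus k) n
      (λ i _ → cong (_+ - mono (suc k) i) (sym (one≗const i)))) (trans (invOneMinus-inverse k n) (one≗const n))

    Unit-≋ : ∀ {u v} → u ≋ v → Unit u → Unit v
    Unit-≋ {u} {v} e (i , p) = i , ≋-trans (⊛-cong (≋-sym e) (≋-refl {i})) p

    1+power : ∀ c j → 1# ⊕ mono (suc c ℕ.* suc j) ≋ 1# ⊕ power 𝟙 (suc c) (suc j)
    1+power c j = ≗⇒≋ λ n → cong (_+_ (1# n)) (sym (ℤP.*-identityˡ (mono (suc c ℕ.* suc j) n)))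

    module Φ-series (ε : ℕ → ℤ) (c : ℕ) (ε-+ : ∀ j k → ε (j ℕ.+ k) ≡ ε j * ε k) (a : ℕ → ℤ)
        (a≡ : ∀ j → τ j * ε (j ℕ.* j) ≡ a (j % 12)) where
      open Shanks (power ε (suc c)) (power-+ ε (suc c) ε-+)

      sgn≗τ : ∀ j n → sgn j n ≡ const (τ j) n
      sgn≗τ zero    n = refl
      sgn≗τ (suc j) n = trans (cong -_ (sgn≗τ j n)) (sym (const-neg (τ j) n))

      Φ-sum : ∀ L n → Φ L n ≡ 1# n + + 2 * sumL (pos L) (λ j → a (j % 12) * mono (suc c ℕ.* (j ℕ.* j)) n)
      Φ-sum zero    n = sym (ℤP.+-identityʳ (1# n))
      Φ-sum (suc L) n = trans (cong₂ _+_ (Φ-sum L n)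
          (trans (const-⊛ (+ 2) (sgn j ⊛ power ε (suc c) (j ℕ.* j)) n) (cong (+ 2 *_) term)))
        (lem (1# n) (sumL (pos L) (λ j → a (j % 12) * mono (suc c ℕ.* (j ℕ.* j)) n))
            (a (j % 12) * mono (suc c ℕ.* (j ℕ.* j)) n))
        where
        j = suc L
        lem : ∀ x y z → x + + 2 * y + + 2 * z ≡ x + + 2 * (z + y)
        lem = ℤRS.solve-∀
        term : (sgn j ⊛ power ε (suc c) (j ℕ.* j)) n ≡ a (j % 12) * mono (suc c ℕ.* (j ℕ.* j)) n
        term = trans (⊛-congʳ {sgn j} {const (τ j)} (power ε (suc c) (j ℕ.* j)) n (λ i _ → sgn≗τ j i))
          (trans (const-⊛ (τ j) (power ε (suc c) (j ℕ.* j)) n)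
            (trans (sym (ℤP.*-assoc (τ j) (ε (j ℕ.* j)) (mono (suc c ℕ.* (j ℕ.* j)) n)))
                (cong (_* mono (suc c ℕ.* (j ℕ.* j)) n) (a≡ j))))

      Φ≋ : ∀ L → K ≤ L → Φ L ≋ 1# ⊕ const (+ 2) ⊛ Sq a (suc c)
      Φ≋ L K≤L = mk λ n n≤K → ≡⇒∣ (trans (Φ-sum L n) (cong (_+_ (1# n))
        (trans (cong (+ 2 *_) (Sq-extend a {suc c} n L (s≤s z≤n) (ℕP.≤-trans n≤K K≤L)))
            (sym (const-⊛ (+ 2) (Sq a (suc c)) n)))))

    𝟙-+ : ∀ j k → 𝟙 (j ℕ.+ k) ≡ 𝟙 j * 𝟙 k
    𝟙-+ j k = refl

    double₁ : ∀ j → power τ 1 (j ℕ.+ j) ≋ power 𝟙 2 j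
    double₁ j = ≗⇒≋ λ n → cong₂ _*_ (τ-double j) (cong (λ k → mono k n) (lem j))
      where
      lem : ∀ j → 1 ℕ.* (j ℕ.+ j) ≡ 2 ℕ.* j
      lem = ℕRS.solve-∀

    double₉ : ∀ j → power 𝟙 9 (j ℕ.+ j) ≋ power 𝟙 18 j
    double₉ j = ≗⇒≋ λ n → cong (λ k → 1ℤ * mono k n) (lem j)
      where
      lem : ∀ j → 9 ℕ.* (j ℕ.+ j) ≡ 18 ℕ.* j
      lem = ℕRS.solve-∀

    module G₁ = Odd (power τ 1) (power 𝟙 2) (power-+ τ 1 τ-+) (power-+ 𝟙 2 𝟙-+) double₁
      (λ j → Unit-≋ (1+power 1 j) (1+mono-unit (j ℕ.+ 1 ℕ.* suc j)))
    module G₉ = Odd (power 𝟙 9) (power 𝟙 18) (power-+ 𝟙 9 𝟙-+) (power-+ 𝟙 18 𝟙-+) double₉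
      (λ j → Unit-≋ (1+power 17 j) (1+mono-unit (j ℕ.+ 17 ℕ.* suc j)))

    φ⟨q⟩ φ⟨-q²⟩ φ⟨-q⁹⟩ φ⟨-q¹⁸⟩ : PS
    φ⟨q⟩    = 1# ⊕ const (+ 2) ⊛ A 1
    φ⟨-q²⟩  = 1# ⊕ const (+ 2) ⊛ Sq σ 2
    φ⟨-q⁹⟩  = 1# ⊕ const (+ 2) ⊛ Sq σ 9
    φ⟨-q¹⁸⟩ = 1# ⊕ const (+ 2) ⊛ Sq σ 18

    -- The number of factors that `S9bar` multiplies at exponent K.
    L = suc K

    K≤L : K ≤ L
    K≤L = ℕP.n≤1+n K

    K≤L+L : K ≤ L ℕ.+ L
    K≤L+L = ℕP.≤-trans K≤L (ℕP.m≤m+n L L)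

    τ*1≡σ : ∀ j → τ j * 1ℤ ≡ σ (j % 12)
    τ*1≡σ j = trans (ℤP.*-identityʳ (τ j)) (τ≡σ j)

    gauss₁ : ∏ G₁.1+odd L ⊛ φ⟨q⟩ ≋ φ⟨-q²⟩ ⊛ ∏ G₁.1-odd L
    gauss₁ = begin
      ∏ G₁.1+odd L ⊛ φ⟨q⟩               ≈⟨ ⊛-cong (≋-refl {∏ G₁.1+odd L})
          (≋-sym (Φ-series.Φ≋ τ 0 τ-+ 𝟙 τ-square (L ℕ.+ L) K≤L+L)) ⟩
      ∏ G₁.1+odd L ⊛ G₁.E.Φ (L ℕ.+ L)   ≈⟨ G₁.gauss-odd L (λ k h → power-high τ 0 k (ℕP.≤-<-trans K≤L+L h))
          (λ k h → power-high 𝟙 1 k (ℕP.≤-<-trans K≤L h)) ⟩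
      G₁.E′.Φ L ⊛ ∏ G₁.1-odd L          ≈⟨ ⊛-cong (Φ-series.Φ≋ 𝟙 1 𝟙-+ σ τ*1≡σ L K≤L) (≋-refl {∏ G₁.1-odd L}) ⟩
      φ⟨-q²⟩ ⊛ ∏ G₁.1-odd L             ∎

    gauss₉ : ∏ G₉.1+odd L ⊛ φ⟨-q⁹⟩ ≋ φ⟨-q¹⁸⟩ ⊛ ∏ G₉.1-odd L
    gauss₉ = begin
      ∏ G₉.1+odd L ⊛ φ⟨-q⁹⟩             ≈⟨ ⊛-cong (≋-refl {∏ G₉.1+odd L})
          (≋-sym (Φ-series.Φ≋ 𝟙 8 𝟙-+ σ τ*1≡σ (L ℕ.+ L) K≤L+L)) ⟩
      ∏ G₉.1+odd L ⊛ G₉.E.Φ (L ℕ.+ L)   ≈⟨ G₉.gauss-odd L (λ k h → power-high 𝟙 8 k (ℕP.≤-<-trans K≤L+L h))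
          (λ k h → power-high 𝟙 17 k (ℕP.≤-<-trans K≤L h)) ⟩
      G₉.E′.Φ L ⊛ ∏ G₉.1-odd L          ≈⟨ ⊛-cong (Φ-series.Φ≋ 𝟙 17 𝟙-+ σ τ*1≡σ L K≤L) (≋-refl {∏ G₉.1-odd L}) ⟩
      φ⟨-q¹⁸⟩ ⊛ ∏ G₉.1-odd L            ∎

    odd : ℕ → ℕ
    odd j = suc (2 ℕ.* j)

    odd≡ : ∀ j → suc (j ℕ.+ j) ≡ odd j
    odd≡ j = cong (λ i → suc (j ℕ.+ i)) (sym (ℕP.+-identityʳ j))

    power-odd : ∀ j n → power τ 1 (suc (j ℕ.+ j)) n ≡ - mono (odd j) n
    power-odd j n = trans (cong₂ _*_ (cong -_ (τ-double j))
        (cong (λ k → mono k n) (trans (ℕP.*-identityˡ _) (odd≡ j)))) (ℤP.-1*i≡-i (mono (odd j) n))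

    -- At x = -q odd powers change sign, so `1+odd` is a factor 1 - q^(2j+1) of the denominator of
    -- S.
    1+odd₁ : ∀ j → G₁.1+odd j ≋ 1# ⊕ ⊖ mono (odd j)
    1+odd₁ j = ≗⇒≋ λ n → cong (_+_ (1# n)) (power-odd j n)

    1-odd₁ : ∀ j → G₁.1-odd j ≋ 1# ⊕ mono (odd j)
    1-odd₁ j = ≗⇒≋ λ n → cong (_+_ (1# n)) (trans (cong -_ (power-odd j n)) (ℤP.neg-involutive (mono (odd j) n)))

    power₉-odd : ∀ j n → power 𝟙 9 (suc (j ℕ.+ j)) n ≡ mono (9 ℕ.* odd j) n
    power₉-odd j n = trans (ℤP.*-identityˡ _) (cong (λ k → mono (9 ℕ.* k) n) (odd≡ j))

    1+odd₉ : ∀ j → G₉.1+odd j ≋ 1# ⊕ mono (9 ℕ.* odd j)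
    1+odd₉ j = ≗⇒≋ λ n → cong (_+_ (1# n)) (power₉-odd j n)

    1-odd₉ : ∀ j → G₉.1-odd j ≋ 1# ⊕ ⊖ mono (9 ℕ.* odd j)
    1-odd₉ j = ≗⇒≋ λ n → cong (_+_ (1# n)) (cong -_ (power₉-odd j n))

    onePlus≋ : ∀ k → onePlus (suc k) ≋ 1# ⊕ mono (suc k)
    onePlus≋ k = ≗⇒≋ λ n → trans (onePlus≗ k n) (cong (_+ mono (suc k) n) (one≗const n))

    oneMinus≋ : ∀ k → oneMinus (suc k) ≋ 1# ⊕ ⊖ mono (suc k)
    oneMinus≋ k = ≗⇒≋ λ n → trans (oneMinus≗ k n) (cong (_+ - mono (suc k) n) (one≗const n))

    factor≋ : ∀ j → (G₉.1+odd j ⊛ G₁.1+odd j) ⊛ factor j ≋ G₁.1-odd j ⊛ G₉.1-odd j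
    factor≋ j = begin
      (G₉.1+odd j ⊛ G₁.1+odd j) ⊛ factor j
        ≈⟨ ⊛-cong (⊛-cong (1+odd₉ j) (1+odd₁ j)) (⊛-cong
            (⊛-cong (⊛-cong (onePlus≋ (2 ℕ.* j)) (oneMinus≋ (9 ℕ.* odd j ∸ 1))) (≋-refl {i₉})) (≋-refl {i₁})) ⟩
      ((1# ⊕ y) ⊛ (1# ⊕ ⊖ x)) ⊛ ((1# ⊕ x) ⊛ (1# ⊕ ⊖ y) ⊛ i₉ ⊛ i₁)
        ≈⟨ solve 6 (λ a b c d i j → (a :* b) :* (c :* d :* i :* j) := (a :* i) :* (b :* j) :* (c :* d)) ≋-refl
             (1# ⊕ y) (1# ⊕ ⊖ x) (1# ⊕ x) (1# ⊕ ⊖ y) i₉ i₁ ⟩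
      ((1# ⊕ y) ⊛ i₉) ⊛ ((1# ⊕ ⊖ x) ⊛ i₁) ⊛ ((1# ⊕ x) ⊛ (1# ⊕ ⊖ y))
        ≈⟨ ⊛-cong (⊛-cong (Unit.u⊛inverse (1+mono-unit (9 ℕ.* odd j ∸ 1))) (Unit.u⊛inverse (1-mono-unit (2 ℕ.* j))))
            (≋-refl {(1# ⊕ x) ⊛ (1# ⊕ ⊖ y)}) ⟩
      1# ⊛ 1# ⊛ ((1# ⊕ x) ⊛ (1# ⊕ ⊖ y))
        ≈⟨ solve 1 (λ f → con 1ℤ :* con 1ℤ :* f := f) ≋-refl ((1# ⊕ x) ⊛ (1# ⊕ ⊖ y)) ⟩
      (1# ⊕ x) ⊛ (1# ⊕ ⊖ y)
        ≈⟨ ⊛-cong (≋-sym (1-odd₁ j)) (≋-sym (1-odd₉ j)) ⟩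
      G₁.1-odd j ⊛ G₉.1-odd j ∎
      where
      x  = mono (odd j)
      y  = mono (9 ℕ.* odd j)
      i₉ = invOnePlus (9 ℕ.* odd j ∸ 1)
      i₁ = invOneMinus (odd j ∸ 1)

    S : PS
    S = ∏ factor L

    S≋quotient : S ⊛ (φ⟨-q²⟩ ⊛ φ⟨-q¹⁸⟩) ≋ φ⟨q⟩ ⊛ φ⟨-q⁹⟩
    S≋quotient = cancel (S ⊛ (φ⟨-q²⟩ ⊛ φ⟨-q¹⁸⟩)) (φ⟨q⟩ ⊛ φ⟨-q⁹⟩) unit (begin
      (p₉ ⊛ p₁) ⊛ (S ⊛ (φ⟨-q²⟩ ⊛ φ⟨-q¹⁸⟩))
        ≈⟨ R.*-assoc (p₉ ⊛ p₁) S (φ⟨-q²⟩ ⊛ φ⟨-q¹⁸⟩) ⟨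
      (p₉ ⊛ p₁) ⊛ S ⊛ (φ⟨-q²⟩ ⊛ φ⟨-q¹⁸⟩)
        ≈⟨ ⊛-cong products (≋-refl {φ⟨-q²⟩ ⊛ φ⟨-q¹⁸⟩}) ⟩
      (n₁ ⊛ n₉) ⊛ (φ⟨-q²⟩ ⊛ φ⟨-q¹⁸⟩)
        ≈⟨ solve 4 (λ n n′ d d′ → (n :* n′) :* (d :* d′) := (d :* n) :* (d′ :* n′)) ≋-refl n₁ n₉ φ⟨-q²⟩ φ⟨-q¹⁸⟩ ⟩
      (φ⟨-q²⟩ ⊛ n₁) ⊛ (φ⟨-q¹⁸⟩ ⊛ n₉)
        ≈⟨ ⊛-cong (≋-sym gauss₁) (≋-sym gauss₉) ⟩
      (p₁ ⊛ φ⟨q⟩) ⊛ (p₉ ⊛ φ⟨-q⁹⟩)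
        ≈⟨ solve 4 (λ p f p′ f′ → (p :* f) :* (p′ :* f′) := (p′ :* p) :* (f :* f′)) ≋-refl p₁ φ⟨q⟩ p₉ φ⟨-q⁹⟩ ⟩
      (p₉ ⊛ p₁) ⊛ (φ⟨q⟩ ⊛ φ⟨-q⁹⟩) ∎)
      where
      p₁ = ∏ G₁.1+odd L
      n₁ = ∏ G₁.1-odd L
      p₉ = ∏ G₉.1+odd L
      n₉ = ∏ G₉.1-odd L
      unit : Unit (p₉ ⊛ p₁)
      unit = Unit-⊛ (Unit-∏ (λ j → Unit-≋ (≋-sym (1+odd₉ j)) (1+mono-unit (9 ℕ.* odd j ∸ 1))) L)
                    (Unit-∏ (λ j → Unit-≋ (≋-sym (1+odd₁ j)) (1-mono-unit (2 ℕ.* j))) L)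
      products : (p₉ ⊛ p₁) ⊛ S ≋ n₁ ⊛ n₉
      products = begin
        (p₉ ⊛ p₁) ⊛ S
          ≈⟨ ⊛-cong (∏-⊛ G₉.1+odd G₁.1+odd L) (≋-refl {S}) ⟩
        ∏ (λ j → G₉.1+odd j ⊛ G₁.1+odd j) L ⊛ S
          ≈⟨ ∏-⊛ (λ j → G₉.1+odd j ⊛ G₁.1+odd j) factor L ⟩
        ∏ (λ j → (G₉.1+odd j ⊛ G₁.1+odd j) ⊛ factor j) L
          ≈⟨ ∏-cong factor≋ L ⟩
        ∏ (λ j → G₁.1-odd j ⊛ G₉.1-odd j) L
          ≈⟨ ∏-⊛ G₁.1-odd G₉.1-odd L ⟨
        n₁ ⊛ n₉ ∎

  module Two where
    open M₂
    open Gauss (+ 2) (λ _ → ⊤) (λ _ p → p)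
    open Solver using (solve; _:=_; _:+_; _:*_; con)
    open SetoidReasoning R.setoid

    ⊖≋ : ∀ f → ⊖ f ≋ f
    ⊖≋ f = mk λ n _ → divides (- f n) (lem (f n))
      where
      lem : ∀ x → - x - x ≡ - x * + 2
      lem = ℤRS.solve-∀

    one≋ : one ≋ 1#
    one≋ = ≗⇒≋ one≗const

    -- Signs are invisible modulo 2, so numerator and denominator factors with the same exponent
    -- cancel.
    factor≋1 : ∀ j → factor j ≋ 1#
    factor≋1 j = begin
      onePlus o ⊛ oneMinus (9 ℕ.* o) ⊛ i₉ ⊛ i₁
        ≈⟨ ⊛-cong (⊛-cong (⊛-cong (≋-trans (≗⇒≋ (onePlus≗ (2 ℕ.* j))) x≋)
            (≋-trans (≗⇒≋ (oneMinus≗ (9 ℕ.* o ∸ 1))) y≋)) (≋-refl {i₉})) (≋-refl {i₁}) ⟩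
      (one ⊕ ⊖ x) ⊛ (one ⊕ y) ⊛ i₉ ⊛ i₁
        ≈⟨ solve 4 (λ a b i j → a :* b :* i :* j := (a :* j) :* (b :* i)) ≋-refl (one ⊕ ⊖ x) (one ⊕ y) i₉ i₁ ⟩
      ((one ⊕ ⊖ x) ⊛ i₁) ⊛ ((one ⊕ y) ⊛ i₉)
        ≈⟨ ⊛-cong (≋-trans (≗⇒≋ (invOneMinus-inverse (2 ℕ.* j))) one≋)
            (≋-trans (≗⇒≋ (invOnePlus-inverse (9 ℕ.* o ∸ 1))) one≋) ⟩
      1# ⊛ 1# ≈⟨ identityˡ 1# ⟩
      1# ∎
      where
      o  = suc (2 ℕ.* j)
      x  = mono o
      y  = mono (9 ℕ.* o)
      i₉ = invOnePlus (9 ℕ.* o ∸ 1)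
      i₁ = invOneMinus (o ∸ 1)
      x≋ : one ⊕ x ≋ one ⊕ ⊖ x
      x≋ = ⊕-cong (≋-refl {one}) (≋-sym (⊖≋ x))
      y≋ : one ⊕ ⊖ y ≋ one ⊕ y
      y≋ = ⊕-cong (≋-refl {one}) (⊖≋ y)

    S≋1 : ∀ L → ∏ factor L ≋ 1#
    S≋1 zero    = ≋-refl
    S≋1 (suc L) = ≋-trans (⊛-cong (S≋1 L) (factor≋1 L)) (identityˡ 1#)

  -- Expansion of S modulo 16 by residue classes of exponents

  χe′ σs : ℕ → ℤ
  χe′ i = 1ℤ - χo i
  σs i  = χs i * σ i

  module Expansion (K : ℕ) where
    open Sixteen K
    open Mod (+ 16) (_≤ K) ℕP.≤-trans
    open Gauss (+ 16) (_≤ K) ℕP.≤-trans using (1#)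
    open Solver using (solve; _:=_; _:+_; _:*_; _:-_; :-_; con; Polynomial)
    open SetoidReasoning R.setoid

    half : PS
    half n = Div.quotient (M₂.at (Two.S≋1 L) n tt)

    S≗ : ∀ n → S n ≡ (1# ⊕ const (+ 2) ⊛ half) n
    S≗ n = trans (lem (S n) (1# n)) (cong (_+_ (1# n)) (trans (Div._∣_.equality (M₂.at (Two.S≋1 L) n tt))
        (trans (ℤP.*-comm (half n) (+ 2)) (sym (const-⊛ (+ 2) half n)))))
      where
      lem : ∀ a b → a ≡ b + (a - b)
      lem = ℤRS.solve-∀

    16≋0 : ∀ f → const (+ 16) ⊛ f ≋ const 0ℤ
    16≋0 f = mk λ n _ → divides (f n) (trans (cong₂ _-_ (const-⊛ (+ 16) f n) (const-0 n)) (lem (f n)))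
      where
      lem : ∀ x → + 16 * x - 0ℤ ≡ x * + 16
      lem = ℤRS.solve-∀

    drop-16 : ∀ f g → f ⊕ const (+ 16) ⊛ g ≋ f
    drop-16 f g = ≋-trans (⊕-cong (≋-refl {f}) (16≋0 g)) (solve 1 (λ f → f :+ con 0ℤ := f) ≋-refl f)

    -- Each squaring of a series 1 + 2ʲf gains a factor 2: the moduli are 2, 4, 8 and 16.
    S⁸≋1 : S ⁸ ≋ 1#
    S⁸≋1 = begin
      S ⁸
        ≈⟨ sq-cong (sq-cong (sq-cong (≗⇒≋ S≗))) ⟩
      (1# ⊕ const (+ 2) ⊛ half) ⁸
        ≈⟨ sq-cong (sq-cong (solve 1 (λ e → (con 1ℤ :+ con (+ 2) :* e) :* (con 1ℤ :+ con (+ 2) :* e) := con 1ℤ :+ con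
            (+ 4) :* (e :+ e :* e)) ≋-refl half)) ⟩
      (1# ⊕ const (+ 4) ⊛ f) ⁴
        ≈⟨ sq-cong (solve 1 (λ f → (con 1ℤ :+ con (+ 4) :* f) :* (con 1ℤ :+ con (+ 4) :* f) := con 1ℤ :+ con (+ 8) :*
            (f :+ con (+ 2) :* f :* f)) ≋-refl f) ⟩
      square (1# ⊕ const (+ 8) ⊛ g)
        ≈⟨ solve 1 (λ g → (con 1ℤ :+ con (+ 8) :* g) :* (con 1ℤ :+ con (+ 8) :* g) := con 1ℤ :+ con (+ 16) :*
            (g :+ con (+ 4) :* g :* g)) ≋-refl g ⟩
      1# ⊕ const (+ 16) ⊛ (g ⊕ const (+ 4) ⊛ g ⊛ g)
        ≈⟨ drop-16 1# (g ⊕ const (+ 4) ⊛ g ⊛ g) ⟩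
      1# ∎
      where
      f = half ⊕ half ⊛ half
      g = f ⊕ const (+ 2) ⊛ f ⊛ f
      sq-cong : ∀ {f g} → f ≋ g → square f ≋ square g
      sq-cong e = ⊛-cong e e

    -- `w` and `v` hold the terms of A(q) and of its signed analogue at q² with 3 ∤ x, and `ε` the
    -- remaining terms of the latter. `Ev` and `Od` divide A(q⁹) by the parity of exponents; φ(q)
    -- and φ(-q⁹) then share them up to the sign of `Od`.
    w v ε Ev Od : PS
    w  = s
    v  = Sq σs 2
    ε  = Sq σ 18
    Ev = Sq χe′ 9
    Od = O 9

    twice : PS → PS
    twice f = const (+ 2) ⊛ f

    twice≗ : ∀ {f g} → (∀ n → f n ≡ g n) → twice f ≋ twice g
    twice≗ e = ⊛-cong (≋-refl {const (+ 2)}) (≗⇒≋ e)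

    A₉≗ : ∀ n → A 9 n ≡ (Ev ⊕ Od) n
    A₉≗ n = split 𝟙 χe′ χo 9 n (below12 (λ i → 𝟙 i ℤ.≟ χe′ i + χo i))

    φ⟨q⟩≋ : φ⟨q⟩ ≋ 1# ⊕ twice (w ⊕ (Ev ⊕ Od))
    φ⟨q⟩≋ = ⊕-cong (≋-refl {1#}) (twice≗ λ n → trans (A-split₃ {1} n 1≤) (cong (_+_ (s n)) (A₉≗ n)))

    φ⟨-q⁹⟩≋ : φ⟨-q⁹⟩ ≋ 1# ⊕ twice (Ev ⊕ ⊖ Od)
    φ⟨-q⁹⟩≋ = ⊕-cong (≋-refl {1#}) (twice≗ λ n → trans (lem (Sq σ 9 n) (Od n)) (cong (_- Od n)
        (sym (split χe′ σ χo 9 n (below12 (λ i → χe′ i ℤ.≟ σ i + χo i))))))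
      where
      lem : ∀ a b → a ≡ a + b - b
      lem = ℤRS.solve-∀

    φ⟨-q²⟩≋ : φ⟨-q²⟩ ≋ 1# ⊕ twice (v ⊕ ε)
    φ⟨-q²⟩≋ = ⊕-cong (≋-refl {1#}) (twice≗ λ n → trans
        (split σ σs (λ i → χ₃ i * σ i) 2 n (below12 (λ i → σ i ℤ.≟ σs i + χ₃ i * σ i)))
      (cong (_+_ (v n)) (trans (Sq-dilate 3 (λ i → χ₃ i * σ i) {2} n (ℕDiv.divides 4 refl) (s≤s z≤n)
          (below12 (λ i → ¬? (i % 3 ℕ.≟ 0) →-dec χ₃ i * σ i ℤ.≟ 0ℤ)))
        (Sq-cong (λ i → χ₃ ((3 ℕ.* i) % 12) * σ ((3 ℕ.* i) % 12)) σ 18 n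
            (below12 (λ i → χ₃ ((3 ℕ.* i) % 12) * σ ((3 ℕ.* i) % 12) ℤ.≟ σ i))))))

    -- `a⁻` and `d` are φ(-q⁹) and φ(-q¹⁸), and φ(-q²) = d + 2v. `quadratic` is the cofactor in (d +
    -- 2v)(d² - 2dv + 4v²) = d³ + 8v³.
    a⁻ d quadratic : PS
    a⁻ = 1# ⊕ twice (Ev ⊕ ⊖ Od)
    d  = 1# ⊕ twice ε
    quadratic = (d ⊛ d ⊕ ⊖ (const (+ 2) ⊛ d ⊛ v)) ⊕ const (+ 4) ⊛ v ⊛ v

    -- evenPart has only even exponents, classOne and classTwo only exponents ≡ 1 and ≡ 2 (mod 3):
    -- at an odd exponent divisible by 3 only mixed contributes.
    evenPart classOne classTwo mixed : PS
    evenPart = (((1# ⊕ twice Ev) ⊛ (1# ⊕ twice Ev) ⊕ ⊖ (const (+ 4) ⊛ (Od ⊛ Od))) ⊛ quadratic ⊕ ⊖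
        (const (+ 8) ⊛ (v ⊛ v ⊛ v)))
      ⊕ ⊖ (const (+ 8) ⊛ (ε ⊕ ε ⊛ ε))
    classOne = const (+ 2) ⊛ (w ⊛ a⁻ ⊛ d ⊛ d)
    classTwo = const (+ 8) ⊛ (w ⊛ a⁻ ⊛ (v ⊛ v))
    mixed    = w ⊛ v ⊛ (a⁻ ⊛ d)

    -- Multiplying the relation for S by `quadratic` replaces the division by theta series: it
    -- yields S (d⁴ + 8dv³). Modulo 16, d⁴ = 1 + 8(ε + ε²), and S and d are 1 modulo 2, so this
    -- equals S + 8(ε + ε²) + 8v³. On the other side, 2w a⁻ `quadratic` splits into the two classes
    -- and the mixed term.
    S≋parts : S ≋ ((evenPart ⊕ classOne) ⊕ classTwo) ⊕ ⊖ (const (+ 4) ⊛ mixed)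
    S≋parts = begin
      S
        ≈⟨ ≗⇒≋ S≗ ⟩
      1# ⊕ twice half
        ≈⟨ solve 3 (λ h e v → con 1ℤ :+ con (+ 2) :* h
             := ((con 1ℤ :+ con (+ 2) :* h) :* ((con 1ℤ :+ con (+ 2) :* (v :+ e)) :* D e) :* Q e v
                 :- con (+ 8) :* (v :* v :* v) :- con (+ 8) :* (e :+ e :* e))
                -- The solver computes over ℤ, so the discarded multiple of 16 is given explicitly,
                -- with h = (S - 1)/2.
                :+ con (+ 16) :* Rem h e v) ≋-refl half ε v ⟩
      ((1# ⊕ twice half) ⊛ ((1# ⊕ twice (v ⊕ ε)) ⊛ d) ⊛ quadratic ⊕ ⊖ (const (+ 8) ⊛ (v ⊛ v ⊛ v)) ⊕ ⊖
          (const (+ 8) ⊛ (ε ⊕ ε ⊛ ε)))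
        ⊕ const (+ 16) ⊛ remainder
        ≈⟨ drop-16 ((1# ⊕ twice half) ⊛ ((1# ⊕ twice (v ⊕ ε)) ⊛ d) ⊛ quadratic ⊕ ⊖ (const (+ 8) ⊛ (v ⊛ v ⊛ v)) ⊕ ⊖
            (const (+ 8) ⊛ (ε ⊕ ε ⊛ ε))) remainder ⟩
      (1# ⊕ twice half) ⊛ ((1# ⊕ twice (v ⊕ ε)) ⊛ d) ⊛ quadratic ⊕ ⊖ (const (+ 8) ⊛ (v ⊛ v ⊛ v)) ⊕ ⊖
          (const (+ 8) ⊛ (ε ⊕ ε ⊛ ε))
        ≈⟨ ⊕-cong (⊕-cong (⊛-cong quotient (≋-refl {quadratic})) (≋-refl {⊖ (const (+ 8) ⊛ (v ⊛ v ⊛ v))}))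
            (≋-refl {⊖ (const (+ 8) ⊛ (ε ⊕ ε ⊛ ε))}) ⟩
      ((1# ⊕ twice (w ⊕ (Ev ⊕ Od))) ⊛ a⁻) ⊛ quadratic ⊕ ⊖ (const (+ 8) ⊛ (v ⊛ v ⊛ v)) ⊕ ⊖ (const (+ 8) ⊛ (ε ⊕ ε ⊛ ε))
        ≈⟨ solve 5 (λ w p o e v →
             ((con 1ℤ :+ con (+ 2) :* (w :+ (p :+ o))) :* (con 1ℤ :+ con (+ 2) :* (p :- o))) :* Q e v
               :- con (+ 8) :* (v :* v :* v) :- con (+ 8) :* (e :+ e :* e)
             := (((((con 1ℤ :+ con (+ 2) :* p) :* (con 1ℤ :+ con (+ 2) :* p) :- con (+ 4) :* (o :* o)) :* Q e v
                 :- con (+ 8) :* (v :* v :* v)) :- con (+ 8) :* (e :+ e :* e))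
                 :+ con (+ 2) :* (w :* (con 1ℤ :+ con (+ 2) :* (p :- o)) :* D e :* D e))
                 :+ con (+ 8) :* (w :* (con 1ℤ :+ con (+ 2) :* (p :- o)) :* (v :* v))
                 :- con (+ 4) :* (w :* v :* ((con 1ℤ :+ con (+ 2) :* (p :- o)) :* D e))) ≋-refl w Ev Od ε v ⟩
      ((evenPart ⊕ classOne) ⊕ classTwo) ⊕ ⊖ (const (+ 4) ⊛ mixed) ∎
      where
      D : ∀ {n} → Polynomial n → Polynomial n
      D e = con 1ℤ :+ con (+ 2) :* e
      Q : ∀ {n} → Polynomial n → Polynomial n → Polynomial n
      Q e v = (D e :* D e :- con (+ 2) :* D e :* v) :+ con (+ 4) :* v :* v
      Rem : ∀ {n} → Polynomial n → Polynomial n → Polynomial n → Polynomial n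
      Rem h e v = :- ((con 1ℤ :+ con (+ 2) :* h) :* (con (+ 2) :* e :* e :* e :+ e :* e :* e :* e) :+ e :* e
        :+ h :* (e :+ con (+ 3) :* e :* e) :+ v :* v :* v :* (h :+ e :+ con (+ 2) :* h :* e))
      remainder : PS
      remainder = ⊖ ((1# ⊕ twice half) ⊛ (const (+ 2) ⊛ ε ⊛ ε ⊛ ε ⊕ ε ⊛ ε ⊛ ε ⊛ ε) ⊕ ε ⊛ ε
        ⊕ half ⊛ (ε ⊕ const (+ 3) ⊛ ε ⊛ ε) ⊕ v ⊛ v ⊛ v ⊛ (half ⊕ ε ⊕ const (+ 2) ⊛ half ⊛ ε))
      quotient : (1# ⊕ twice half) ⊛ ((1# ⊕ twice (v ⊕ ε)) ⊛ d) ≋ (1# ⊕ twice (w ⊕ (Ev ⊕ Od))) ⊛ a⁻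
      quotient = ≋-trans (⊛-cong (≋-sym (≗⇒≋ S≗)) (⊛-cong (≋-sym φ⟨-q²⟩≋) (≋-refl {d})))
        (≋-trans S≋quotient (⊛-cong φ⟨q⟩≋ φ⟨-q⁹⟩≋))

  -- Vanishing modulo 16 of the coefficient of S at 3k

  ∣-minus-cancel : ∀ {M} a b → M ∣ a - b → M ∣ b → M ∣ a
  ∣-minus-cancel {M} a b d e = subst (M ∣_) (lem a b) (Div.∣m∣n⇒∣m+n d e)
    where
    lem : ∀ a b → a - b + b ≡ a
    lem = ℤRS.solve-∀

  module Lsσ = L χs σs (below12² (even? χs σs)) (below12 (zˡ? χs σs)) (below12 (zʳ? χs σs)) (below12² (quad? χs σs))

  module Vanishing (k : ℕ) (odd-k : k % 2 ≡ 1) (1-mod-3 : k % 3 ≡ 1)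
    (inert : ∀ x y → 1 ℕ.* (x ℕ.* x) ℕ.+ 3 ℕ.* (y ℕ.* y) ≢ k) where

    K : ℕ
    K = k ℕ.* 3

    open Expansion K

    v-supp₂ : Supp 2 0 v
    v-supp₂ = Supp-Sq 2 σs 2 (ℕDiv.divides 6 refl)
        (below12 (λ i → ¬? ((2 ℕ.* (i ℕ.* i)) % 2 ℕ.≟ 0) →-dec σs i ℤ.≟ 0ℤ))

    ε-supp₂ : Supp 2 0 ε
    ε-supp₂ = Supp-Sq 2 σ 18 (ℕDiv.divides 6 refl)
        (below12 (λ i → ¬? ((18 ℕ.* (i ℕ.* i)) % 2 ℕ.≟ 0) →-dec σ i ℤ.≟ 0ℤ))

    Ev-supp₂ : Supp 2 0 Ev
    Ev-supp₂ = Supp-Sq 2 χe′ 9 (ℕDiv.divides 6 refl)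
        (below12 (λ i → ¬? ((9 ℕ.* (i ℕ.* i)) % 2 ℕ.≟ 0) →-dec χe′ i ℤ.≟ 0ℤ))

    Od-supp₂ : Supp 2 1 Od
    Od-supp₂ = Supp-Sq 2 χo 9 (ℕDiv.divides 6 refl)
        (below12 (λ i → ¬? ((9 ℕ.* (i ℕ.* i)) % 2 ℕ.≟ 1) →-dec χo i ℤ.≟ 0ℤ))

    multiple-supp : ∀ {j} .{{_ : NonZero j}} {r f} c → Supp j r f → Supp j r (const c ⊛ f)
    multiple-supp {f = f} c F n h = trans (const-⊛ c f n) (trans (cong (c *_) (F n h)) (ℤP.*-zeroʳ c))

    1+twice-supp : ∀ {j} .{{_ : NonZero j}} {f} → Supp j 0 f → Supp j 0 (const 1ℤ ⊕ const (+ 2) ⊛ f)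
    1+twice-supp F = Supp-⊕ (Supp-const 1ℤ) (multiple-supp (+ 2) F)

    d-supp₂ : Supp 2 0 d
    d-supp₂ = 1+twice-supp ε-supp₂

    evenPart-supp : Supp 2 0 evenPart
    evenPart-supp = Supp-⊕ (Supp-⊕ (Supp-⊛ (Supp-⊕ (Supp-⊛ (1+twice-supp Ev-supp₂) (1+twice-supp Ev-supp₂))
          (Supp-⊖ (multiple-supp (+ 4) (Supp-⊛ Od-supp₂ Od-supp₂))))
          (Supp-⊕ (Supp-⊕ (Supp-⊛ d-supp₂ d-supp₂) (Supp-⊖ (Supp-⊛ (multiple-supp (+ 2) d-supp₂) v-supp₂)))
            (Supp-⊛ (multiple-supp (+ 4) v-supp₂) v-supp₂)))
        (Supp-⊖ (multiple-supp (+ 8) (Supp-⊛ (Supp-⊛ v-supp₂ v-supp₂) v-supp₂))))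
      (Supp-⊖ (multiple-supp (+ 8) (Supp-⊕ ε-supp₂ (Supp-⊛ ε-supp₂ ε-supp₂))))

    v-supp₃ : Supp 3 2 v
    v-supp₃ = Supp-Sq 3 σs 2 (ℕDiv.divides 4 refl)
        (below12 (λ i → ¬? ((2 ℕ.* (i ℕ.* i)) % 3 ℕ.≟ 2) →-dec σs i ℤ.≟ 0ℤ))

    d-supp₃ : Supp 3 0 d
    d-supp₃ = 1+twice-supp (Sq-supp₀ σ 18 (ℕDiv.divides 6 refl))

    a⁻-supp₃ : Supp 3 0 a⁻
    a⁻-supp₃ = 1+twice-supp (Supp-⊕ (Sq-supp₀ χe′ 9 (ℕDiv.divides 3 refl))
        (Supp-⊖ (Sq-supp₀ χo 9 (ℕDiv.divides 3 refl))))

    classOne-supp : Supp 3 1 classOne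
    classOne-supp = multiple-supp (+ 2) (Supp-⊛ (Supp-⊛ (Supp-⊛ s-supp a⁻-supp₃) d-supp₃) d-supp₃)

    classTwo-supp : Supp 3 2 classTwo
    classTwo-supp = multiple-supp (+ 8) (Supp-⊛ (Supp-⊛ s-supp a⁻-supp₃) (Supp-⊛ v-supp₃ v-supp₃))

    K-odd : K % 2 ≢ 0
    K-odd e = contradiction (trans (sym (trans (ℕD.%-distribˡ-* k 3 2) (cong (λ r → (r ℕ.* 1) % 2) odd-k))) e) λ ()

    K%3 : K % 3 ≡ 0
    K%3 = ℕD.m*n%n≡0 k 3

    K%3≢ : ∀ {r} → r ≢ 0 → K % 3 ≢ r
    K%3≢ r≢0 e = r≢0 (trans (sym e) K%3)

    -- If u² + 2v² = k ≡ 1 modulo 3, then 3 ∤ u and 3 ∣ v. Both u + v and u - v are prime to 3 and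
    -- carry the same sign, so the weight is ±2, which is 2 modulo 4. Writing v = 3y turns 2v² into
    -- 18y².
    wv[K] : (+ 4) ∣ (w ⊛ v) K - + 2 * (s ⊛ A 18) k
    wv[K] = subst (λ z → (+ 4) ∣ (w ⊛ v) K - z) rhs
        (Lsσ.lattice-∣ (+ 4) (λ i → Lsσ.H₊ i 0) (λ j → Lsσ.H₊ 0 j) (λ i → + 2 * χs i) χ₃ k
        (λ {i} _ → self (Lsσ.H₊ i 0)) (λ {j} _ → self (Lsσ.H₊ 0 j))
        (λ i<12 j<12 e → check i<12 j<12 (trans e 1-mod-3)))
      where
      self : ∀ z → (+ 4) ∣ z - z
      self z = divides 0ℤ (ℤP.+-inverseʳ z)
      check : ∀ {i} → i < 12 → ∀ {j} → j < 12 → (1 ℕ.* (i ℕ.* i) ℕ.+ 2 ℕ.* (j ℕ.* j)) % 3 ≡ 1 →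
        (+ 4) ∣ Lsσ.H₊ i j + Lsσ.H₋ i j - + 2 * χs i * χ₃ j
      check = below12² (λ i j → ((1 ℕ.* (i ℕ.* i) ℕ.+ 2 ℕ.* (j ℕ.* j)) % 3 ℕ.≟ 1) →-dec
          ((+ 4) Div.∣? (Lsσ.H₊ i j + Lsσ.H₋ i j - + 2 * χs i * χ₃ j)))
      -- The case y = 0 of `inert` says that k is not a square; the other axis is excluded because k
      -- is odd.
      axis₁ : Sq (λ i → Lsσ.H₊ i 0) 1 k ≡ 0ℤ
      axis₁ = Sq-unrepresented (λ i → Lsσ.H₊ i 0) 1 k λ x e → inert x 0 (trans (ℕP.+-identityʳ (1 ℕ.* (x ℕ.* x))) e)
      axis₂ : Sq (λ j → Lsσ.H₊ 0 j) 2 k ≡ 0ℤ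
      axis₂ = Sq-unrepresented (λ j → Lsσ.H₊ 0 j) 2 k λ x e → contradiction
        (trans (sym odd-k) (trans (cong (_% 2) (trans (sym e) (ℕP.*-comm 2 (x ℕ.* x)))) (ℕD.m*n%n≡0 (x ℕ.* x) 2)))
            λ ()
      doubled : ∀ n → Sq (λ i → + 2 * χs i) 1 n ≡ + 2 * s n
      doubled n = trans (sumL-cong (pos n) (λ x _ → ℤP.*-assoc (+ 2) (χs (x % 12)) (mono (1 ℕ.* (x ℕ.* x)) n)))
        (sumL-scale (pos n) (+ 2) (λ x → χs (x % 12) * mono (1 ℕ.* (x ℕ.* x)) n))
      rhs : Sq (λ i → Lsσ.H₊ i 0) 1 k + Sq (λ j → Lsσ.H₊ 0 j) 2 k + (Sq (λ i → + 2 * χs i) 1 ⊛ Sq χ₃ 2) k ≡ + 2 *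
          (s ⊛ A 18) k
      rhs = trans (cong₂ _+_ (cong₂ _+_ axis₁ axis₂)
          (trans (⊛-congʳ {Sq (λ i → + 2 * χs i) 1} {scale (+ 2) s} (Sq χ₃ 2) k (λ i _ → doubled i))
          (trans (⊛-scaleʳ (+ 2) s (Sq χ₃ 2) k) (cong (+ 2 *_)
              (⊛-congˡ s {Sq χ₃ 2} {A 18} k (λ i _ → Sq-χ₃ {2} i (s≤s z≤n)))))))
        (ℤP.+-identityˡ _)

    module Mod2 where
      open M₂
      open RingSolver 𝔽₂ M₂.almostRing 𝔽₂-morphism 𝔽₂≟ using (solve; _:=_; _:+_; _:*_)
      open SetoidReasoning M₂.R.setoid

      B = A 3 ⊕ A 6

      -- Modulo 2 all signs disappear and v becomes s(q²) = s², which produces the cube on which U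
      -- is known.
      reduce : w ⊛ v ⊛ ((Ev ⊕ ⊖ Od) ⊕ ε) ≋ (s ⊛ square s) ⊛ (A 9 ⊕ A 18)
      reduce = ⊛-cong (⊛-cong (≋-refl {s}) v≋) (⊕-cong b≋ ε≋)
        where
        v≋ : v ≋ square s
        v≋ = ≋-trans (mk λ n _ → Sq-cong-∣ σs χs 2 n (below12 (σs ≡? χs [mod + 2 ]))) (frobenius χs {1} 1≤)
        b≋ : Ev ⊕ ⊖ Od ≋ A 9
        b≋ = ≋-trans (⊕-cong (≋-refl {Ev}) (Two.⊖≋ Od)) (≗⇒≋ λ n → sym (A₉≗ n))
        ε≋ : ε ≋ A 18
        ε≋ = mk λ n _ → Sq-cong-∣ σ 𝟙 18 n (below12 (σ ≡? 𝟙 [mod + 2 ]))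

      U-reduce : U ((s ⊛ square s) ⊛ (A 9 ⊕ A 18)) ≋ ((s ⊕ square s) ⊕ s ⊛ square s) ⊛ B
      U-reduce = ≋-trans (U-⊛≋ (s ⊛ square s) (A 9 ⊕ A 18)
          (Supp-⊕ (Sq-supp₀ 𝟙 9 (ℕDiv.divides 3 refl)) (Sq-supp₀ 𝟙 18 (ℕDiv.divides 6 refl))))
        (⊛-cong U-s³ (⊕-cong (≗⇒≋ λ n → Sq-stretch 3 𝟙 {3} n 1≤) (≗⇒≋ λ n → Sq-stretch 3 𝟙 {6} n 1≤)))

      B-supp : Supp 3 0 B
      B-supp = Supp-⊕ (Sq-supp₀ 𝟙 3 (ℕDiv.divides 1 refl)) (Sq-supp₀ 𝟙 6 (ℕDiv.divides 2 refl))

      k%3≢ : ∀ {r} → r ≢ 1 → k % 3 ≢ r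
      k%3≢ r≢1 e = r≢1 (trans (sym e) 1-mod-3)

      -- As k ≡ 1 modulo 3, the terms with s² and s³ drop out: their exponents lie in the classes 2
      -- and 0.
      expand : (((s ⊕ square s) ⊕ s ⊛ square s) ⊛ B) k ≡ (s ⊛ B) k
      expand = trans (⊛-distribʳ (s ⊕ square s) (s ⊛ square s) B k) (trans
        (cong₂ _+_ (trans (⊛-distribʳ s (square s) B k)
            (trans (cong (_+_ ((s ⊛ B) k)) (Supp-⊛ (Supp-⊛ s-supp s-supp) B-supp k (k%3≢ λ ())))
            (ℤP.+-identityʳ ((s ⊛ B) k))))
                   (Supp-⊛ s³-supp B-supp k (k%3≢ λ ())))
        (ℤP.+-identityʳ ((s ⊛ B) k)))

      wvb[K] : (+ 2) ∣ (w ⊛ v ⊛ ((Ev ⊕ ⊖ Od) ⊕ ε)) K - (s ⊛ B) k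
      wvb[K] = subst (λ z → (+ 2) ∣ (w ⊛ v ⊛ ((Ev ⊕ ⊖ Od) ⊕ ε)) K - z) expand
        (∣-trans-minus ((w ⊛ v ⊛ ((Ev ⊕ ⊖ Od) ⊕ ε)) K) (((s ⊛ square s) ⊛ (A 9 ⊕ A 18)) K)
            ((((s ⊕ square s) ⊕ s ⊛ square s) ⊛ B) k)
          (at reduce K tt) (at U-reduce k tt))

      -- Since A(q^(2m)) = A(q^m)², the three counts add up to s A(q³) + s t². Writing s = X + s⁴
      -- leaves X t², to which `Xt²≋` applies, and the square of s² t.
      forms : s ⊛ A 18 ⊕ s ⊛ B ≋ (s ⊛ A 3 ⊕ (Y ⊕ Sq χs 4 ⊛ O 3)) ⊕ square (square s ⊛ t)
      forms = begin
        s ⊛ A 18 ⊕ s ⊛ (A 3 ⊕ A 6)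
          ≈⟨ ⊕-cong (⊛-cong (≋-refl {s}) (frobenius 𝟙 {9} 1≤))
              (⊛-cong (≋-refl {s}) (⊕-cong (≋-refl {A 3}) (frobenius 𝟙 {3} 1≤))) ⟩
        s ⊛ square (A 9) ⊕ s ⊛ (A 3 ⊕ square (A 3))
          ≈⟨ solve 3 (λ s a c → s :* (c :* c) :+ s :* (a :+ a :* a) := s :* a :+ s :* ((a :+ c) :* (a :+ c))) ≋-refl s
              (A 3) (A 9) ⟩
        s ⊛ A 3 ⊕ s ⊛ square t
          ≈⟨ ⊕-cong (≋-refl {s ⊛ A 3}) (⊛-cong s≋ (≋-refl {square t})) ⟩
        s ⊛ A 3 ⊕ (X ⊕ s ⁴) ⊛ square t
          ≈⟨ solve 4 (λ y x s t → y :+ (x :+ (s :* s) :* (s :* s)) :* (t :* t) := (y :+ x :* (t :* t)) :+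
              ((s :* s) :* t) :* ((s :* s) :* t)) ≋-refl (s ⊛ A 3) X s t ⟩
        (s ⊛ A 3 ⊕ X ⊛ square t) ⊕ square (square s ⊛ t)
          ≈⟨ ⊕-cong (⊕-cong (≋-refl {s ⊛ A 3}) (≋-trans Xt²≋
              (⊕-cong (≋-refl {Y}) (⊛-cong (≋-sym (frobenius⁴ χs {1} 1≤)) (≋-refl {O 3})))))
              (≋-refl {square (square s ⊛ t)}) ⟩
        (s ⊛ A 3 ⊕ (Y ⊕ Sq χs 4 ⊛ O 3)) ⊕ square (square s ⊛ t) ∎

      no-forms : ((s ⊛ A 3 ⊕ (Y ⊕ Sq χs 4 ⊛ O 3))) k ≡ 0ℤ
      no-forms = cong₂ _+_ (Sq-⊛-unrepresented χs 𝟙 {1} {3} k 1≤ 1≤ inert)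
        (cong₂ _+_ (Sq-unrepresented χy 1 k λ x e → inert x 0 (trans (ℕP.+-identityʳ (1 ℕ.* (x ℕ.* x))) e))
          (Sq-⊛-unrepresented χs χo {4} {3} k 1≤ 1≤ λ x y e → inert (2 ℕ.* x) y (trans (lem x y) e)))
        where
        lem : ∀ x y → 1 ℕ.* (2 ℕ.* x ℕ.* (2 ℕ.* x)) ℕ.+ 3 ℕ.* (y ℕ.* y) ≡ 4 ℕ.* (x ℕ.* x) ℕ.+ 3 ℕ.* (y ℕ.* y)
        lem = ℕRS.solve-∀

      -- A square modulo 2 has only even exponents, and k is odd.
      square-k : (+ 2) ∣ square (square s ⊛ t) k
      square-k with even-or-odd k
      ... | inj₂ (j , e) = subst (λ i → (+ 2) ∣ square (square s ⊛ t) i) (sym e) (square-odd (square s ⊛ t) j)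
      ... | inj₁ (j , e) = contradiction (trans (sym odd-k) (trans (cong (_% 2) e) (ℕD.m*n%n≡0 j 2))) λ ()

      forms[k] : (+ 2) ∣ (s ⊛ A 18) k + (s ⊛ B) k
      forms[k] = ∣-minus-cancel ((s ⊛ A 18 ⊕ s ⊛ B) k) (((s ⊛ A 3 ⊕ (Y ⊕ Sq χs 4 ⊛ O 3)) ⊕ square (square s ⊛ t)) k)
          (at forms k tt)
        (subst ((+ 2) ∣_) (sym (trans (cong (_+ square (square s ⊛ t) k) no-forms) (ℤP.+-identityˡ _))) square-k)

    open Mod2 using (B; wvb[K]; forms[k])
    open Mod (+ 16) (_≤ K) ℕP.≤-trans
    open Solver using (solve; _:=_; _:+_; _:*_; _:-_; :-_; con)

    weaken : ∀ j {z} → (+ j * + 4) ∣ z → (+ 4) ∣ z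
    weaken j d = Div.∣-trans (Div.∣n⇒∣m*n (+ j) Div.∣-refl) d

    mixed-expand : mixed ≋ (w ⊛ v ⊕ const (+ 2) ⊛ (w ⊛ v ⊛ ((Ev ⊕ ⊖ Od) ⊕ ε))) ⊕ const (+ 4) ⊛
        (w ⊛ v ⊛ (Ev ⊕ ⊖ Od) ⊛ ε)
    mixed-expand = solve 4 (λ w v b e → w :* v :* ((con 1ℤ :+ con (+ 2) :* b) :* (con 1ℤ :+ con (+ 2) :* e))
      := (w :* v :+ con (+ 2) :* (w :* v :* (b :+ e))) :+ con (+ 4) :* (w :* v :* b :* e)) ≋-refl w v (Ev ⊕ ⊖ Od) ε

    -- Expanding (1 + 2b)(1 + 2ε) leaves wv + 2wv(b + ε) modulo 4. The first term is 2(s A(q¹⁸)) and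
    -- the second 2(s B) at k, so the parity in `forms[k]` supplies the other factor 2.
    4∣mixed : (+ 4) ∣ mixed K
    4∣mixed = ∣-minus-cancel (mixed K) _ (weaken 4 (at mixed-expand K ℕP.≤-refl))
      (subst ((+ 4) ∣_) (sym (cong₂ _+_ (cong (_+_ ((w ⊛ v) K)) (const-⊛ (+ 2) wvb K)) (const-⊛ (+ 4) wvbe K)))
        (Div.∣m∣n⇒∣m+n sum (Div.∣m⇒∣m*n (wvbe K) Div.∣-refl)))
      where
      wvb wvbe : PS
      wvb  = w ⊛ v ⊛ ((Ev ⊕ ⊖ Od) ⊕ ε)
      wvbe = w ⊛ v ⊛ (Ev ⊕ ⊖ Od) ⊛ ε
      lem : ∀ x p y q → x - + 2 * p + + 2 * (y - q) + + 2 * (p + q) ≡ x + + 2 * y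
      lem = ℤRS.solve-∀
      sum : (+ 4) ∣ (w ⊛ v) K + + 2 * wvb K
      sum = subst ((+ 4) ∣_) (lem ((w ⊛ v) K) ((s ⊛ A 18) k) (wvb K) ((s ⊛ B) k))
        (Div.∣m∣n⇒∣m+n (Div.∣m∣n⇒∣m+n wv[K] (Div.*-monoʳ-∣ (+ 2) wvb[K])) (Div.*-monoʳ-∣ (+ 2) forms[k]))

    16∣S : (+ 16) ∣ Sixteen.S K K
    16∣S = ∣-minus-cancel (Sixteen.S K K) _ (at S≋parts K ℕP.≤-refl)
      (subst ((+ 16) ∣_) (sym value) (Div.∣m⇒∣-m (Div.*-monoʳ-∣ (+ 4) 4∣mixed)))
      where
      value : (((evenPart ⊕ classOne) ⊕ classTwo) ⊕ ⊖ (const (+ 4) ⊛ mixed)) K ≡ - (+ 4 * mixed K)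
      value = trans (cong₂ (λ x y → x + - y) (cong₂ _+_
          (cong₂ _+_ (evenPart-supp K K-odd) (classOne-supp K (K%3≢ λ ()))) (classTwo-supp K (K%3≢ λ ())))
        (const-⊛ (+ 4) mixed K)) (ℤP.+-identityˡ _)

open import Data.Nat using (ℕ; zero; suc; _+_; _*_; _^_; _≤_; _<_; z≤n; s≤s; _∸_; _%_; NonZero)
open import Data.Nat.Divisibility as Nat∣ using () renaming (_∣_ to _∣ℕ_)
open import Data.Nat.Primality
  using (Prime; prime?; prime[2]; ¬prime[1]; prime⇒irreducible; prime⇒nonZero; euclidsLemma)
open import Data.Nat.Coprimality using (coprime-Bézout)
open import Data.Nat.GCD using (module Bézout)
open import Data.Integer using (ℤ; +_; -_)
open import Data.Integer.Divisibility using (_∣_)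
open import Data.Integer.Divisibility.Signed using (divides)
open Series
open CharacteristicTwo using (_⁸)

-- Values of x² + 3y²

inverse-mod : ∀ {p} y → Prime p → ¬ p ∣ℕ y → ∃ λ z → (+ p) Div.∣ z ℤ.* + y ℤ.- + 1
inverse-mod {p} y pp p∤y with coprime-Bézout {p} {y} coprime
  where
  coprime : ∀ {d} → d ∣ℕ p × d ∣ℕ y → d ≡ 1
  coprime (d∣p , d∣y) with prime⇒irreducible pp d∣p
  ... | inj₁ d≡1  = d≡1
  ... | inj₂ refl = contradiction d∣y p∤y
... | Bézout.+- a b e = - + b , divides (- + a) (begin
    - + b ℤ.* + y ℤ.- + 1       ≡⟨ lem (+ b) (+ y) ⟩
    - (+ 1 ℤ.+ + b ℤ.* + y)     ≡⟨ cong -_ (trans (cong (ℤ._+_ (+ 1)) (sym (ℤP.pos-* b y)))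
        (trans (cong +_ e) (ℤP.pos-* a p))) ⟩
    - (+ a ℤ.* + p)             ≡⟨ ℤP.neg-distribˡ-* (+ a) (+ p) ⟩
    - + a ℤ.* + p               ∎)
  where
  open ≡-Reasoning
  lem : ∀ b y → - b ℤ.* y ℤ.- + 1 ≡ - (+ 1 ℤ.+ b ℤ.* y)
  lem = ℤRS.solve-∀
... | Bézout.-+ a b e = + b , divides (+ a) (begin
    + b ℤ.* + y ℤ.- + 1                       ≡⟨ cong (ℤ._- + 1)
        (trans (sym (ℤP.pos-* b y)) (trans (cong +_ (sym e)) (cong (ℤ._+_ (+ 1)) (ℤP.pos-* a p)))) ⟩
    + 1 ℤ.+ + a ℤ.* + p ℤ.- + 1               ≡⟨ lem (+ a ℤ.* + p) ⟩
    + a ℤ.* + p                               ∎)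
  where
  open ≡-Reasoning
  lem : ∀ z → + 1 ℤ.+ z ℤ.- + 1 ≡ z
  lem = ℤRS.solve-∀

form : ℕ → ℕ → ℕ
form x y = 1 * (x * x) + 3 * (y * y)

-- If p did not divide y, then x divided by y would be a square root of -3 modulo p.
inert-descent : ∀ {p} → Prime p → LegendreMinusOne (- (+ 3)) p → ∀ x y → p ∣ℕ form x y → p ∣ℕ x × p ∣ℕ y
inert-descent {p} pp (_ , non-residue) x y p∣ with p Nat∣.∣? y
... | yes p∣y = [ id , id ]′ (euclidsLemma x x pp p∣xx) , p∣y
  where
  p∣xx : p ∣ℕ x * x
  p∣xx = subst (p ∣ℕ_) (ℕP.*-identityˡ (x * x))
      (Nat∣.∣m+n∣m⇒∣n (subst (p ∣ℕ_) (ℕP.+-comm (1 * (x * x)) (3 * (y * y))) p∣)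
    (Nat∣.∣n⇒∣m*n 3 (Nat∣.∣m⇒∣m*n y p∣y)))
... | no p∤y with inverse-mod y pp p∤y
...   | z , p∣zy-1 = contradiction (z ℤ.* + x , Div.∣⇒∣ᵤ residue) non-residue
  where
  Z = z ℤ.* + y
  -- With zy ≡ 1, the number z²(x² + 3y²) differs from (zx)² + 3 by 3(z²y² - 1), a multiple of p.
  lem : ∀ z x y → z ℤ.* z ℤ.* (x ℤ.* x ℤ.+ + 3 ℤ.* (y ℤ.* y)) ℤ.- + 3 ℤ.* (z ℤ.* y ℤ.+ + 1) ℤ.* (z ℤ.* y ℤ.- + 1)
    ≡ z ℤ.* x ℤ.* (z ℤ.* x) ℤ.- - + 3
  lem = ℤRS.solve-∀
  pos-form : + form x y ≡ + x ℤ.* + x ℤ.+ + 3 ℤ.* (+ y ℤ.* + y)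
  pos-form = cong₂ ℤ._+_ (trans (cong +_ (ℕP.*-identityˡ (x * x))) (ℤP.pos-* x x))
      (trans (ℤP.pos-* 3 (y * y)) (cong (ℤ._*_ (+ 3)) (ℤP.pos-* y y)))
  residue : (+ p) Div.∣ z ℤ.* + x ℤ.* (z ℤ.* + x) ℤ.- - + 3
  residue = subst ((+ p) Div.∣_) (lem z (+ x) (+ y)) (Div.∣m∣n⇒∣m-n
    (Div.∣n⇒∣m*n (z ℤ.* z) (subst ((+ p) Div.∣_) pos-form (Div.∣ᵤ⇒∣ p∣)))
    (Div.∣n⇒∣m*n (+ 3 ℤ.* (Z ℤ.+ + 1)) p∣zy-1))

form-scale : ∀ p x y → 1 * (x * p * (x * p)) + 3 * (y * p * (y * p)) ≡ p * (p * (1 * (x * x) + 3 * (y * y)))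
form-scale = ℕRS.solve-∀

-- By descent: p divides x and y, so p² can be removed from both sides. The exponent on the right
-- falls by 2 and stays odd until p would have to divide c.
inert-power : ∀ {p} c → Prime p → LegendreMinusOne (- (+ 3)) p → ¬ p ∣ℕ c →
  ∀ α x y → form x y ≢ p ^ (2 * α + 1) * c
inert-power {p} c pp leg p∤c α x y e with inert-descent pp leg x y (subst (p ∣ℕ_) (sym e) p∣power)
  where
  p∣power : p ∣ℕ p ^ (2 * α + 1) * c
  p∣power = Nat∣.∣m⇒∣m*n c (subst (λ k → p ∣ℕ p ^ k) (ℕP.+-comm 1 (2 * α)) (Nat∣.m∣m*n (p ^ (2 * α))))
... | Nat∣.divides x′ refl , Nat∣.divides y′ refl = go α (trans (sym (form-scale p x′ y′)) e)
  where
  instance _ = prime⇒nonZero pp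
  go : ∀ α → p * (p * form x′ y′) ≢ p ^ (2 * α + 1) * c
  go zero    e = p∤c (subst (p ∣ℕ_) (ℕP.*-cancelˡ-≡ (p * form x′ y′) c p (trans e (cong (_* c) (ℕP.*-identityʳ p))))
      (Nat∣.m∣m*n (form x′ y′)))
  go (suc α) e = inert-power c pp leg p∤c α x′ y′
    (ℕP.*-cancelˡ-≡ _ _ p (ℕP.*-cancelˡ-≡ _ _ p (trans e
        (trans (cong (λ k → p ^ k * c) (exponent α)) (assoc p (p ^ (2 * α + 1)) c)))))
    where
    exponent : ∀ α → 2 * suc α + 1 ≡ suc (suc (2 * α + 1))
    exponent = ℕRS.solve-∀
    assoc : ∀ p q c → p * (p * q) * c ≡ p * (p * (q * c))
    assoc = ℕRS.solve-∀

prime∤power : ∀ {r p} → Prime r → ¬ r ∣ℕ p → ∀ n → ¬ r ∣ℕ p ^ n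
prime∤power pr r∤p zero    d = ¬prime[1] (subst Prime (Nat∣.∣1⇒≡1 d) pr)
prime∤power {r} {p} pr r∤p (suc n) d = [ r∤p , prime∤power pr r∤p n ]′ (euclidsLemma p (p ^ n) pr d)

prime[3] : Prime 3
prime[3] = from-yes (prime? 3)

prime∤prime : ∀ {r p} → Prime r → Prime p → r ≢ 1 → r ≢ p → ¬ r ∣ℕ p
prime∤prime pr pp r≢1 r≢p d = [ r≢1 , r≢p ]′ (prime⇒irreducible pp d)

square%2 : ∀ P → ¬ 2 ∣ℕ P → (P * P) % 2 ≡ 1
square%2 P 2∤P = trans (ℕD.%-distribˡ-* P P 2) (go (P % 2) refl (ℕD.m%n<n P 2))
  where
  go : ∀ r → P % 2 ≡ r → r < 2 → (P % 2 * (P % 2)) % 2 ≡ 1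
  go 0 e _ = contradiction (Nat∣.m%n≡0⇒n∣m P 2 e) 2∤P
  go 1 e _ rewrite e = refl
  go (suc (suc r)) e (s≤s (s≤s ()))

square%3 : ∀ P → ¬ 3 ∣ℕ P → (P * P) % 3 ≡ 1
square%3 P 3∤P = trans (ℕD.%-distribˡ-* P P 3) (go (P % 3) refl (ℕD.m%n<n P 3))
  where
  go : ∀ r → P % 3 ≡ r → r < 3 → (P % 3 * (P % 3)) % 3 ≡ 1
  go 0 e _ = contradiction (Nat∣.m%n≡0⇒n∣m P 3 e) 3∤P
  go 1 e _ rewrite e = refl
  go 2 e _ rewrite e = refl
  go (suc (suc (suc r))) e (s≤s (s≤s (s≤s ())))

-- Powers of the product, and the theorem

module PartialProducts (K : ℕ) where
  open Mod (+ 16) (_≤ K) ℕP.≤-trans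
  open Gauss (+ 16) (_≤ K) ℕP.≤-trans using (1#; identityˡ; interchange; ∏)
  open SetoidReasoning R.setoid

  pow-⊛ : ∀ f g r → pow f r ⊛ pow g r ≋ pow (f ⊛ g) r
  pow-⊛ f g zero    = R.*-identityˡ one
  pow-⊛ f g (suc r) = ≋-trans (interchange f (pow f r) g (pow g r)) (⊛-cong (≋-refl {f ⊛ g}) (pow-⊛ f g r))

  pow-1# : ∀ r → one ≋ pow 1# r
  pow-1# zero    = ≋-refl
  pow-1# (suc r) = ≋-trans (pow-1# r) (≋-sym (identityˡ (pow 1# r)))

  partialProd≋pow : ∀ r N → partialProd r N ≋ pow (∏ factor N) r
  partialProd≋pow r zero    = pow-1# r
  partialProd≋pow r (suc N) = ≋-trans (⊛-cong (partialProd≋pow r N) (≋-refl {pow (factor N) r}))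
      (pow-⊛ (∏ factor N) (factor N) r)

  pow[8m+1] : ∀ f → f ⁸ ≋ 1# → ∀ m → pow f (8 * m + 1) ≋ f
  pow[8m+1] f f⁸≋1 zero    = R.*-identityʳ f
  pow[8m+1] f f⁸≋1 (suc m) = begin
    pow f (8 * suc m + 1)          ≈⟨ ≡⇒≋ (cong (pow f) (cong (_+ 1) (ℕP.*-suc 8 m))) ⟩
    pow f (8 + (8 * m + 1))        ≈⟨ Solver.solve 2 (λ f p → f :* (f :* (f :* (f :* (f :* (f :* (f :* (f :* p)))))))
                                        := (((f :* f) :* (f :* f)) :* ((f :* f) :* (f :* f))) :* p) ≋-refl f
                                            (pow f (8 * m + 1)) ⟩
    f ⁸ ⊛ pow f (8 * m + 1)        ≈⟨ ⊛-cong f⁸≋1 (pow[8m+1] f f⁸≋1 m) ⟩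
    1# ⊛ f                         ≈⟨ identityˡ f ⟩
    f                              ∎
    where
    open Solver using (_:*_; _:=_)

S9bar-∣ : ∀ m k → k % 2 ≡ 1 → k % 3 ≡ 1 → (∀ x y → form x y ≢ k) → (+ 16) ∣ S9bar (8 * m + 1) (k * 3)
S9bar-∣ m k odd-k 1-mod-3 inert = Div.∣⇒∣ᵤ (∣-minus-cancel (S9bar (8 * m + 1) K) (Sixteen.S K K)
    (at (≋-trans (partialProd≋pow (8 * m + 1) (suc K)) (pow[8m+1] (Sixteen.S K) (Expansion.S⁸≋1 K) m)) K ℕP.≤-refl)
    (Vanishing.16∣S k odd-k 1-mod-3 inert))
  where
  K = k * 3
  open PartialProducts K
  open Mod (+ 16) (_≤ K) ℕP.≤-trans

theorem3p7 : (p m α n i : ℕ) → Prime p → 5 ≤ p → LegendreMinusOne (- (+ 3)) p →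
    1 ≤ i → i ≤ p ∸ 1 →
    (+ 16) ∣ S9bar (8 * m + 1)
    (18 * p ^ (2 * α + 2) * n + 3 * (6 * i + p) * p ^ (2 * α + 1))
theorem3p7 p m α n i pp 5≤p leg 1≤i i≤p-1 = subst (λ N → (+ 16) ∣ S9bar (8 * m + 1) N) (sym index)
  (S9bar-∣ m (Q * c) (residue 2 (Nat∣.divides 3 refl) (square%2 (p ^ suc α) (prime∤power prime[2] 2∤p (suc α))))
                     (residue 3 (Nat∣.divides 2 refl) (square%3 (p ^ suc α) (prime∤power prime[3] 3∤p (suc α))))
                     (inert-power c pp leg p∤c α))
  where
  Q = p ^ (2 * α + 1)
  -- The index is 3k with k = Q c; p occurs in Q to an odd power, and p ∤ c because p ∤ 6i.
  c = 6 * (p * n + i) + p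

  index : 18 * p ^ (2 * α + 2) * n + 3 * (6 * i + p) * Q ≡ Q * c * 3
  index = trans (cong (λ k → 18 * p ^ k * n + 3 * (6 * i + p) * Q) (ℕP.+-suc (2 * α) 1)) (lem p Q n i)
    where
    lem : ∀ p Q n i → 18 * (p * Q) * n + 3 * (6 * i + p) * Q ≡ Q * (6 * (p * n + i) + p) * 3
    lem = ℕRS.solve-∀

  2∤p : ¬ 2 ∣ℕ p
  2∤p = prime∤prime prime[2] pp (λ ()) (λ { refl → contradiction 5≤p λ { (s≤s (s≤s ())) } })

  3∤p : ¬ 3 ∣ℕ p
  3∤p = prime∤prime prime[3] pp (λ ()) (λ { refl → contradiction 5≤p λ { (s≤s (s≤s (s≤s ()))) } })

  p∤2 : ¬ p ∣ℕ 2
  p∤2 d = contradiction (ℕP.≤-trans 5≤p (Nat∣.∣⇒≤ d)) λ { (s≤s (s≤s ())) }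

  p∤3 : ¬ p ∣ℕ 3
  p∤3 d = contradiction (ℕP.≤-trans 5≤p (Nat∣.∣⇒≤ d)) λ { (s≤s (s≤s (s≤s ()))) }

  p∤i : ¬ p ∣ℕ i
  p∤i d = ℕP.<-irrefl refl (ℕP.≤-trans (s≤s (ℕP.≤-trans (Nat∣.∣⇒≤ {{ℕ.>-nonZero 1≤i}} d) i≤p-1)) (ℕP.≤-reflexive (ℕP.m+[n∸m]≡n (ℕP.≤-trans (s≤s z≤n) 5≤p))))

  p∤c : ¬ p ∣ℕ c
  p∤c d with euclidsLemma 6 (p * n + i) pp (Nat∣.∣m+n∣m⇒∣n (subst (p ∣ℕ_) (ℕP.+-comm (6 * (p * n + i)) p) d) Nat∣.∣-refl)
  ... | inj₁ p∣6 = [ p∤2 , p∤3 ]′ (euclidsLemma 2 3 pp p∣6)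
  ... | inj₂ p∣i = p∤i (Nat∣.∣m+n∣m⇒∣n p∣i (Nat∣.m∣m*n n))

  -- Modulo 6 the factor c is p, so Q c becomes the square of p^(α+1), a number prime to 6.
  residue : ∀ r .{{_ : NonZero r}} → r ∣ℕ 6 → (p ^ suc α * p ^ suc α) % r ≡ 1 → (Q * c) % r ≡ 1
  residue r (Nat∣.divides t 6≡) e = trans (cong (_% r) expand) (trans (ℕD.[m+kn]%n≡m%n (p ^ suc α * p ^ suc α) (Q * (p * n + i) * t) r) e)
    where
    exponent : ∀ α → 2 * α + 1 ≡ α + suc α
    exponent = ℕRS.solve-∀
    lem : ∀ A p R z u → A * (p * R) * (u * z + p) ≡ p * A * (p * R) + A * (p * R) * z * u
    lem = ℕRS.solve-∀
    lem′ : ∀ a t r → a * (t * r) ≡ a * t * r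
    lem′ = ℕRS.solve-∀
    Q≡ : Q ≡ p ^ α * (p * p ^ α)
    Q≡ = trans (cong (p ^_) (exponent α)) (ℕP.^-distribˡ-+-* p α (suc α))
    expand : Q * c ≡ p ^ suc α * p ^ suc α + Q * (p * n + i) * t * r
    expand = begin
      Q * c                                                             ≡⟨ cong (_* c) Q≡ ⟩
      p ^ α * (p * p ^ α) * c                                           ≡⟨ lem (p ^ α) p (p ^ α) (p * n + i) 6 ⟩
      p ^ suc α * p ^ suc α + p ^ α * (p * p ^ α) * (p * n + i) * 6     ≡⟨ cong₂ (λ q u → p ^ suc α * p ^ suc α + q * (p * n + i) * u) (sym Q≡) 6≡ ⟩
      p ^ suc α * p ^ suc α + Q * (p * n + i) * (t * r)                 ≡⟨ cong (_+_ (p ^ suc α * p ^ suc α)) (lem′ (Q * (p * n + i)) t r) ⟩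
      p ^ suc α * p ^ suc α + Q * (p * n + i) * t * r                   ∎
      where open ≡-Reasoning
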